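{- For every finite constraint pattern $\mathbb{I}=(S,E)$, every complete $\mathbb{I}$-graph $\mathbb{H}$ and every $N\geq 2$ there is a finite $N$-acyclic $\mathbb{I}$-groupoid $\mathbb{G}$ that is compatible with $\mathbb{H}$. Moreover $\mathbb{G}$ can be chosen such that every automorphism $\rho$ of $\mathbb{I}$ that is a symmetry of $\mathbb{H}$ is also a symmetry of $\mathbb{G}$.
   Context: A constraint pattern $\mathbb{I}=(S,E,\iota_1,\iota_2,\cdot^{ -1})$ is a directed multigraph: sets $S$ (vertices) and $E$ (edges), surjective maps $\iota_1,\iota_2\colon E\to S$ (source, target), and a fixpoint-free involution $e\mapsto e^{ -1}$ on $E$ with $\iota_1(e^{ -1})=\iota_2(e)$ (hence $\iota_2(e^{ -1})=\iota_1(e)$). $E^*[\mathbb{I},s,t]$ denotes the set of reduced words $w=e_1\cdots e_n$ over $E$ (no $e_{i+1}=e_i^{ -1}$) with $\iota_2(e_i)=\iota_1(e_{i+1})$, $\iota_1(w)=\iota_1(e_1)=s$, $\iota_2(w)=\iota_2(e_n)=t$ (for $n=0$, the empty word, at $s=t$); for $\alpha\subseteq E$ with $\alpha=\alpha^{ -1}$, $\alpha^*[\mathbb{I},s,t]$ is the subset of words with all letters in $\alpha$. An $\mathbb{I}$-groupoid is $\mathbb{G}=(G,(G_{s,t})_{s,t\in S},\cdot,(1_s)_{s\in S},(g_e)_{e\in E})$ where the $G_{s,t}$ partition $G$, $\cdot$ is an associative composition mapping $G_{s,t}\times G_{t,u}$ into $G_{s,u}$, $1_s\in G_{s,s}$ is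 left and right neutral, and $G$ is generated by pairwise distinct $g_e\in G_{\iota_1(e),\iota_2(e)}$ with $g_{e^{ -1}}$ the inverse of $g_e$. For $w=e_1\cdots e_n\in E^*[\mathbb{I},s,t]$, $[w]_{\mathbb{G}}=g_{e_1}\cdots g_{e_n}\in G_{s,t}$ (and $1_s$ for the empty word at $s$); for $g\in G_{s,t}$ set $\iota_2(g)=t$. For $\alpha=\alpha^{ -1}\subseteq E$ and $g\in G$, the coset is $g\mathbb{G}[\alpha]=\bigcup_{t}\{g\cdot[w]_{\mathbb{G}}: w\in\alpha^*[\mathbb{I},\iota_2(g),t]\}$. A coset cycle of length $n\geq2$ is a cyclically indexed sequence $(g_i\mathbb{G}[\alpha_i],g_i)_{i\in\mathbb{Z}_n}$ with (connectivity) $g_{i+1}\in g_i\mathbb{G}[\alpha_i]$ and (separation) $g_i\mathbb{G}[\alpha_i\cap\alpha_{i-1}]\cap g_{i+1}\mathbb{G}[\alpha_i\cap\alpha_{i+1}]=\emptyset$ for all $i$; $\mathbb{G}$ is $N$-acyclic if it has no coset cycle of length at most $N$. A complete $\mathbb{I}$-graph is $\mathbb{H}=(V,(V_s)_{s\in S},(R_e)_{e\in E})$ with $V$ partitioned into non-empty $V_s$, each $R_e$ the graph of a bijection $\pi_e\colon V_{\iota_1(e)}\to V_{\iota_2(e)}$, and $R_{e^{ -1}}=R_e^{ -1}$; for $w=e_1\cdots e_n\in E^*[\mathbb{I},s,t]$, $[w]_{\mathbb{H}}=\pi_{e_n}\circ\cdots\circ\pi_{e_1}\colon V_s\to V_t$.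 $\mathbb{G}$ is compatible with $\mathbb{H}$ if for all $s$ and $w\in E^*[\mathbb{I},s,s]$, $[w]_{\mathbb{G}}=1_s$ implies $[w]_{\mathbb{H}}=\mathrm{id}_{V_s}$. An automorphism of $\mathbb{I}$ is a pair of permutations of $S$ and $E$ (both denoted $\rho$) commuting with $\iota_1,\iota_2$ and with edge reversal. $\rho$ is a symmetry of $\mathbb{H}$ if there is a bijection $f\colon V\to V$ with $f(V_s)=V_{\rho(s)}$ and $(u,v)\in R_e\Leftrightarrow(f(u),f(v))\in R_{\rho(e)}$; $\rho$ is a symmetry of $\mathbb{G}$ if there is a bijection $\varphi\colon G\to G$ preserving composition with $\varphi(G_{s,t})=G_{\rho(s),\rho(t)}$, $\varphi(1_s)=1_{\rho(s)}$ and $\varphi(g_e)=g_{\rho(e)}$.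
   Formalization: The complete I-graph H is assumed finite; for infinite H the claim fails, e.g. one vertex, edges e and e^{ -1}, V = Z with π_e(n) = n+1, where no finite groupoid is compatible with H. -}

module Defs where

open import Level using (0ℓ)
open import Data.Nat using (ℕ; zero; suc; _+_; _≤_)
open import Data.Nat.DivMod using (_mod_)
open import Data.Fin using (Fin; toℕ)
open import Data.Fin.Subset using (Subset; _∈_; _∩_)
open import Data.List using (List; []; _∷_)
open import Data.List.Relation.Unary.All using (All)
open import Data.List.Relation.Unary.Linked using (Linked)
open import Data.Product using (Σ; ∃; _×_; _,_; proj₁)
open import Function.Bundles using (_↔_; Inverse; _⇔_)
open import Function.Definitions using (Injective)
open import Relation.Binary.PropositionalEquality using (_≡_; _≢_)
open import Relation.Nullary using (¬_)

Finite : Set → Set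
Finite A = Σ ℕ λ k → A ↔ Fin k

record Pattern : Set where
  field
    nS nE   : ℕ
    ι₁ ι₂   : Fin nE → Fin nS
    ι₁-surj : ∀ s → ∃ λ e → ι₁ e ≡ s
    ι₂-surj : ∀ s → ∃ λ e → ι₂ e ≡ s
    _⁻¹     : Fin nE → Fin nE
    ⁻¹-invol : ∀ e → (e ⁻¹) ⁻¹ ≡ e
    ⁻¹-fpf   : ∀ e → e ⁻¹ ≢ e
    ι₁-⁻¹    : ∀ e → ι₁ (e ⁻¹) ≡ ι₂ e

  S : Set
  S = Fin nS

  E : Set
  E = Fin nE

module _ (I : Pattern) where
  open Pattern I

  data IsPath : S → S → List E → Set where
    []  : ∀ {s} → IsPath s s []
    _∷_ : ∀ {s t e w} → ι₁ e ≡ s → IsPath (ι₂ e) t w → IsPath s t (e ∷ w)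

  Reduced : List E → Set
  Reduced = Linked (λ e e′ → e′ ≢ e ⁻¹)

  Word : S → S → List E → Set
  Word s t w = IsPath s t w × Reduced w

  SymmetricSet : Subset nE → Set
  SymmetricSet α = ∀ e → e ∈ α → (e ⁻¹) ∈ α

  -- I-groupoids.  The carrier G is partitioned into the G_{s,t} via
  -- src/tgt : G → S (g ∈ G_{s,t} iff src g ≡ s and tgt g ≡ t).
  -- The composition _·_ is only constrained on composable pairs.

  evalWord : {G : Set} → (G → G → G) → (S → G) → (E → G) → List E → S → G
  evalWord _·_ 𝟙 gen []      s = 𝟙 s
  evalWord _·_ 𝟙 gen (e ∷ w) s = gen e · evalWord _·_ 𝟙 gen w (ι₂ e)

  record IGroupoid : Set₁ where
    field
      G    : Set
      src tgt : G → S
      _·_  : G → G → G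
      ·-src : ∀ g h → tgt g ≡ src h → src (g · h) ≡ src g
      ·-tgt : ∀ g h → tgt g ≡ src h → tgt (g · h) ≡ tgt h
      ·-assoc : ∀ g h k → tgt g ≡ src h → tgt h ≡ src k →
                (g · h) · k ≡ g · (h · k)
      𝟙     : S → G
      𝟙-src : ∀ s → src (𝟙 s) ≡ s
      𝟙-tgt : ∀ s → tgt (𝟙 s) ≡ s
      𝟙-left  : ∀ g → 𝟙 (src g) · g ≡ g
      𝟙-right : ∀ g → g · 𝟙 (tgt g) ≡ g
      gen     : E → G
      gen-src : ∀ e → src (gen e) ≡ ι₁ e
      gen-tgt : ∀ e → tgt (gen e) ≡ ι₂ e
      gen-distinct : Injective _≡_ _≡_ gen
      gen-invˡ : ∀ e → gen e · gen (e ⁻¹) ≡ 𝟙 (ι₁ e)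
      gen-invʳ : ∀ e → gen (e ⁻¹) · gen e ≡ 𝟙 (ι₂ e)

      generated : ∀ g → ∃ λ w → IsPath (src g) (tgt g) w ×
                    evalWord _·_ 𝟙 gen w (src g) ≡ g

    ⟦_⟧[_] : List E → S → G
    ⟦ w ⟧[ s ] = evalWord _·_ 𝟙 gen w s

    _∈Coset[_,_] : G → G → Subset nE → Set
    x ∈Coset[ g , α ] =
      ∃ λ t → ∃ λ w → Word (tgt g) t w × All (_∈ α) w × x ≡ g · ⟦ w ⟧[ tgt g ]

    nxt prv : ∀ {k} → Fin (suc (suc k)) → Fin (suc (suc k))
    nxt {k} i = suc (toℕ i) mod suc (suc k)
    prv {k} i = (toℕ i + suc k) mod suc (suc k)

    -- A coset cycle of length k+2 (indices in ℤ_{k+2} = Fin (k+2)).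
    record CosetCycle (k : ℕ) : Set where
      field
        g     : Fin (suc (suc k)) → G
        α     : Fin (suc (suc k)) → Subset nE
        α-sym : ∀ i → SymmetricSet (α i)
        connectivity : ∀ i → g (nxt i) ∈Coset[ g i , α i ]
        separation   : ∀ i → ¬ (∃ λ x →
                          x ∈Coset[ g i , α i ∩ α (prv i) ] ×
                          x ∈Coset[ g (nxt i) , α i ∩ α (nxt i) ])

    Acyclic : ℕ → Set
    Acyclic N = ∀ k → suc (suc k) ≤ N → ¬ CosetCycle k

  -- Complete I-graphs.  V is partitioned into the V_s via part : V → S;
  -- π e restricted to V_{ι₁ e} is the bijection π_e : V_{ι₁ e} → V_{ι₂ e},
  -- with inverse π (e⁻¹); R_e is its graph.

  record CompleteIGraph : Set₁ where
    field
      V    : Set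
      part : V → S
      nonempty : ∀ s → ∃ λ v → part v ≡ s
      π    : E → V → V
      π-tgt : ∀ e v → part v ≡ ι₁ e → part (π e v) ≡ ι₂ e
      π-inv : ∀ e v → part v ≡ ι₁ e → π (e ⁻¹) (π e v) ≡ v

    R : E → V → V → Set
    R e u v = part u ≡ ι₁ e × π e u ≡ v

    ⟦_⟧H : List E → V → V
    ⟦ [] ⟧H v    = v
    ⟦ e ∷ w ⟧H v = ⟦ w ⟧H (π e v)

  Compatible : IGroupoid → CompleteIGraph → Set
  Compatible 𝔾 ℍ = ∀ s w → Word s s w → ⟦ w ⟧[ s ] ≡ 𝟙 s →
                     ∀ v → part v ≡ s → ⟦ w ⟧H v ≡ v
    where open IGroupoid 𝔾
          open CompleteIGraph ℍ

  record Automorphism : Set where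
    field
      ρS : S ↔ S
      ρE : E ↔ E
    ρₛ : S → S
    ρₛ = Inverse.to ρS
    ρₑ : E → E
    ρₑ = Inverse.to ρE
    field
      ρ-ι₁ : ∀ e → ι₁ (ρₑ e) ≡ ρₛ (ι₁ e)
      ρ-ι₂ : ∀ e → ι₂ (ρₑ e) ≡ ρₛ (ι₂ e)
      ρ-⁻¹ : ∀ e → ρₑ (e ⁻¹) ≡ (ρₑ e) ⁻¹

  SymmetryOfGraph : Automorphism → CompleteIGraph → Set
  SymmetryOfGraph ρ ℍ =
    Σ (V ↔ V) λ f → let f′ = Inverse.to f in
      (∀ v → part (f′ v) ≡ ρₛ (part v)) ×
      (∀ e u v → R e u v ⇔ R (ρₑ e) (f′ u) (f′ v))
    where open Automorphism ρ
          open CompleteIGraph ℍ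

  SymmetryOfGroupoid : Automorphism → IGroupoid → Set
  SymmetryOfGroupoid ρ 𝔾 =
    Σ (G ↔ G) λ φ → let φ′ = Inverse.to φ in
      (∀ g h → tgt g ≡ src h → φ′ (g · h) ≡ φ′ g · φ′ h) ×
      (∀ g → src (φ′ g) ≡ ρₛ (src g)) ×
      (∀ g → tgt (φ′ g) ≡ ρₛ (tgt g)) ×
      (∀ s → φ′ (𝟙 s) ≡ 𝟙 (ρₛ s)) ×
      (∀ e → φ′ (gen e) ≡ gen (ρₑ e))
    where open Automorphism ρ
          open IGroupoid 𝔾

{-# OPTIONS --safe #-}
module Submission where

open import Data.Nat using (ℕ; zero; suc; _+_; _*_; _^_; _≤_; _<_; z≤n; s≤s; _∸_)
import Data.Nat.Properties as ℕₚ
open import Data.Nat.Induction using (<-wellFounded)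
open import Data.Nat.DivMod using (_mod_; _%_; [m+kn]%n≡m%n; m%n<n; n%n≡0; m≡m%n+[m/n]*n; _/_)
open import Data.Fin using (Fin; zero; suc; toℕ; combine; funToFin; finToFun; _≟_)
import Data.Fin.Properties as Finₚ
open import Data.Fin.Subset using (Subset; _∈_; _∉_; _⊆_; _⊂_; _∩_; ∣_∣; ⊤)
open import Data.Fin.Subset.Properties using (_∈?_; _⊆?_; _⊂?_; anySubset?; ⊆-antisym; p⊂q⇒∣p∣<∣q∣; x∈p∩q⁺; x∈p∩q⁻; ∈⊤)
open import Data.Fin.Subset.Induction using (⊂-wellFounded)
import Data.Vec as Vec
import Data.Vec.Properties as Vecₚ
open import Data.Bool using (true; false; if_then_else_)
open import Data.List using (List; []; _∷_; _++_; length; map; take; drop; lookup; concatMap; cartesianProductWith; allFin; _∷ʳ_; tabulate)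
import Data.List.Properties as Listₚ
open import Data.List.Relation.Unary.All as All using (All; []; _∷_)
import Data.List.Relation.Unary.All.Properties as Allₚ
open import Data.List.Relation.Unary.Any as Any using (Any; here; there)
import Data.List.Relation.Unary.Any.Properties as Anyₚ
open import Data.List.Relation.Unary.Linked using ([]; [-]; _∷_)
open import Data.List.Relation.Unary.AllPairs using (AllPairs; []; _∷_)
open import Data.List.Membership.Propositional using (lose; find) renaming (_∈_ to _∈ˡ_)
open import Data.List.Membership.Propositional.Properties using (∈-cartesianProductWith⁺; ∈-allFin; ∈-map⁺; ∈-lookup)
open import Data.Product using (Σ; ∃; _×_; _,_; proj₁; proj₂)
open import Data.Sum using (_⊎_; inj₁; inj₂)
open import Data.Empty using (⊥; ⊥-elim)
open import Function using (id)
open import Function.Bundles using (_↔_; Inverse; mk↔ₛ′)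
import Algebra.Properties.CommutativeMonoid.Sum ℕₚ.+-0-commutativeMonoid as Sum
open import Induction.WellFounded using (Acc; acc)
open import Relation.Binary.PropositionalEquality
open import Relation.Nullary using (¬_; Dec; yes; no)
open import Relation.Nullary.Decidable using (_×-dec_; _→-dec_; ¬?; map′; decidable-stable)
open import Defs

-- By well-founded recursion on sets γ of letters, define a congruence R γ on words: u and u′ are related if they act
-- alike on all actions of the letters of γ on a set of a fixed size, large in comparison with the indices of the
-- R δ for δ ⊂ γ, that respect R δ for every δ ⊂ γ.  The groupoid consists of the classes of paths modulo R ⊤.
-- Every finite action whose γ-orbits are small, or evidently compatible with R γ, respects R γ for all γ; four such
-- actions give everything.  The action on the vertices of ℍ gives compatibility.  The action on the cosets of α
-- shows that R is stable under the erasure of letters.  A chain of at most N cosets, glued along cosets of intersections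
-- of alphabets, unfolds a coset cycle of groups, so that in a cycle some factor uᵢ splits as x y with x and y words over
-- αᵢ₋₁ ∩ αᵢ and αᵢ ∩ αᵢ₊₁.  Finally a chain of two cosets with a record of the position in the pattern shows that x and
-- y can be taken to be paths, which contradicts separation.  The definition of R refers to the pattern and to sizes only, so
-- every automorphism of the pattern is a symmetry.

-- The obstacle is a circularity: the size of the test actions for `γ` must be fixed before `R γ` is
-- known, yet the actions to which `R γ` is applied are built from cosets modulo `R α` for arbitrary
-- `α`. The way out is that only single `γ`-orbits matter. If `γ ⊆ α`, an orbit in a coset of `α`
-- respects `R γ` whatever its size, because `R γ` implies `R α` on words over `γ`. Otherwise the
-- orbit sees only the subgroup generated by `γ ∩ α`, a proper subset of `γ`, so that its size is
-- bounded by an index already known. Gluing up to `D` cosets multiplies such bounds, and `D`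
-- becomes the given `N`. The price is that separation in the groupoid speaks of paths only: a
-- factorisation into words is not yet forbidden. Recording a position of the pattern along a chain
-- turns it into a factorisation into paths.

-- Shortening of words by the pigeonhole principle, and finite search.

module _ {A : Set} where

  -- The pigeonhole principle on the `length w + 1` prefixes of `w`: two of them have the same
  -- value, and `b` is the stretch between them.
  cut : ∀ {m} (f : List A → Fin m) w → m ≤ length w →
        ∃ λ a → ∃ λ b → ∃ λ c → w ≡ a ++ b ++ c × length (a ++ c) < length w × f a ≡ f (a ++ b)
  cut {m} f w m≤w
    with i , j , i<j , fi≡fj ← Finₚ.pigeonhole (s≤s m≤w) (λ (i : Fin (suc (length w))) → f (take (toℕ i) w))
    = take (toℕ i) w , take d (drop (toℕ i) w) , drop d (drop (toℕ i) w)
    , sym (trans (cong (take (toℕ i) w ++_) (Listₚ.take++drop≡id d (drop (toℕ i) w))) (Listₚ.take++drop≡id (toℕ i) w))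
    , shorter
    , trans fi≡fj (cong f take-j)
    where
      d = toℕ j ∸ toℕ i
      i≤j = ℕₚ.<⇒≤ i<j
      j≤w = ℕₚ.≤-pred (Finₚ.toℕ<n j)
      take-+ : ∀ p q (xs : List A) → take (p + q) xs ≡ take p xs ++ take q (drop p xs)
      take-+ zero    q xs       = refl
      take-+ (suc p) q []       = sym (Listₚ.take-[] q)
      take-+ (suc p) q (x ∷ xs) = cong (x ∷_) (take-+ p q xs)
      take-j : take (toℕ j) w ≡ take (toℕ i) w ++ take d (drop (toℕ i) w)
      take-j = trans (cong (λ k → take k w) (sym (ℕₚ.m+[n∸m]≡n i≤j))) (take-+ (toℕ i) d w)
      shorter : length (take (toℕ i) w ++ drop d (drop (toℕ i) w)) < length w
      shorter = ℕₚ.≤-<-trans (ℕₚ.≤-reflexive eq) (ℕₚ.≤-trans lt (ℕₚ.≤-reflexive (ℕₚ.m+[n∸m]≡n j≤w)))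
        where
          eq : length (take (toℕ i) w ++ drop d (drop (toℕ i) w)) ≡ toℕ i + (length w ∸ toℕ j)
          eq = trans (Listₚ.length-++ (take (toℕ i) w)) (cong₂ _+_
                 (trans (Listₚ.length-take (toℕ i) w) (ℕₚ.m≤n⇒m⊓n≡m (ℕₚ.≤-trans i≤j j≤w)))
                 (trans (cong length (Listₚ.drop-drop (toℕ i) d w))
                   (trans (Listₚ.length-drop (toℕ i + d) w) (cong (length w ∸_) (ℕₚ.m+[n∸m]≡n i≤j)))))
          lt : toℕ i + (length w ∸ toℕ j) < toℕ j + (length w ∸ toℕ j)
          lt = ℕₚ.+-monoˡ-< (length w ∸ toℕ j) i<j

  -- The source of the length bounds below: `f` reads off a state after each prefix, and loops in
  -- the states are cut out until none is forced.
  shorten : ∀ {m} (f : List A → Fin m) (Good : List A → Set) (_∼_ : List A → List A → Set) →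
            (∀ {w} → w ∼ w) → (∀ {u v w} → u ∼ v → v ∼ w → u ∼ w) →
            (∀ a b c → f a ≡ f (a ++ b) → Good (a ++ b ++ c) → Good (a ++ c) × (a ++ b ++ c) ∼ (a ++ c)) →
            ∀ w → Good w → ∃ λ w′ → length w′ ≤ m × Good w′ × w ∼ w′
  shorten {m} f Good _∼_ ∼-refl ∼-trans step w = go w (<-wellFounded (length w))
    where
      go : ∀ w → Acc _<_ (length w) → Good w → ∃ λ w′ → length w′ ≤ m × Good w′ × w ∼ w′
      go w (acc rs) g with length w ℕₚ.≤? m
      ... | yes p = w , p , g , ∼-refl
      ... | no ¬p with a , b , c , refl , lt , fa ← cut f w (ℕₚ.<⇒≤ (ℕₚ.≰⇒> ¬p))
                  with g′ , r ← step a b c fa g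
                  with w′ , l , g″ , r′ ← go (a ++ c) (rs lt) g′
                  = w′ , l , g″ , ∼-trans r r′

mutual
  -- The empty word is split off so that the length of the list is a successor by computation, as
  -- the type of `first` demands.
  words : ∀ k → ℕ → List (List (Fin k))
  words k n = [] ∷ nonempty-words k n

  nonempty-words : ∀ k → ℕ → List (List (Fin k))
  nonempty-words k zero    = []
  nonempty-words k (suc n) = cartesianProductWith _∷_ (allFin k) (words k n)

∈-words : ∀ {k} n (w : List (Fin k)) → length w ≤ n → w ∈ˡ words k n
∈-words n       []      _       = here refl
∈-words (suc n) (e ∷ w) (s≤s p) = there (∈-cartesianProductWith⁺ _∷_ (∈-allFin e) (∈-words n w p))

short-word? : ∀ {k} n {Good : List (Fin k) → Set} → (∀ w → Dec (Good w)) →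
              (∀ w → Good w → ∃ λ w′ → length w′ ≤ n × Good w′) → Dec (∃ Good)
short-word? {k} n good? short with Any.any? good? (words k n)
... | yes p = yes (let w , _ , g = find p in w , g)
  where open import Data.List.Membership.Propositional using (find)
... | no ¬p = no λ (w , g) → let w′ , l , g′ = short w g in ¬p (lose (∈-words n w′ l) g′)

-- The value when no index satisfies P is junk.
first : ∀ {n} {P : Fin (suc n) → Set} → (∀ i → Dec (P i)) → Fin (suc n)
first {zero}  P? = zero
first {suc n} P? with P? zero
... | yes _ = zero
... | no  _ = suc (first (λ i → P? (suc i)))

first-cong : ∀ {n} {P Q : Fin (suc n) → Set} (P? : ∀ i → Dec (P i)) (Q? : ∀ i → Dec (Q i)) →
             (∀ i → P i → Q i) → (∀ i → Q i → P i) → first P? ≡ first Q?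
first-cong {zero}  P? Q? f g = refl
first-cong {suc n} P? Q? f g with P? zero | Q? zero
... | yes _ | yes _ = refl
... | yes p | no ¬q = ⊥-elim (¬q (f zero p))
... | no ¬p | yes q = ⊥-elim (¬p (g zero q))
... | no _  | no _  = cong suc (first-cong (λ i → P? (suc i)) (λ i → Q? (suc i)) (λ i → f (suc i)) (λ i → g (suc i)))

first-sat : ∀ {n} {P : Fin (suc n) → Set} (P? : ∀ i → Dec (P i)) i → P i → P (first P?)
first-sat {zero}  P? zero p = p
first-sat {suc n} P? i p with P? zero
... | yes q = q
first-sat {suc n} P? zero    p | no ¬q = ⊥-elim (¬q p)
first-sat {suc n} P? (suc i) p | no ¬q = first-sat (λ i → P? (suc i)) i p

-- Alphabets, words and actions of the letters.

module Letters (I : Pattern) where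
  open Pattern I public

  Sym : Subset nE → Set
  Sym α = SymmetricSet I α

  Sym? : ∀ α → Dec (Sym α)
  Sym? α = Finₚ.all? λ e → (e ∈? α) →-dec ((e ⁻¹) ∈? α)

  sym-∩ : ∀ {α β} → Sym α → Sym β → Sym (α ∩ β)
  sym-∩ {α} {β} sα sβ e e∈ = let p , q = x∈p∩q⁻ α β e∈ in x∈p∩q⁺ (sα e p , sβ e q)

  sym-⊤ : Sym ⊤
  sym-⊤ e _ = ∈⊤

  sym-∉ : ∀ {α} → Sym α → ∀ {e} → e ∉ α → (e ⁻¹) ∉ α
  sym-∉ {α} sα {e} e∉ p = e∉ (subst (_∈ α) (⁻¹-invol e) (sα (e ⁻¹) p))

  infix 4 _⊩_
  _⊩_ : Subset nE → List E → Set
  α ⊩ w = All (_∈ α) w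

  _⊩?_ : ∀ α w → Dec (α ⊩ w)
  α ⊩? w = All.all? (_∈? α) w

  ⊩-⊆ : ∀ {α β w} → α ⊆ β → α ⊩ w → β ⊩ w
  ⊩-⊆ p = All.map (λ q → p q)

  ⊩-∩ : ∀ {α β w} → α ⊩ w → β ⊩ w → (α ∩ β) ⊩ w
  ⊩-∩ []       []       = []
  ⊩-∩ (p ∷ ps) (q ∷ qs) = x∈p∩q⁺ (p , q) ∷ ⊩-∩ ps qs

  ∩⊆ˡ : ∀ {α β : Subset nE} → α ∩ β ⊆ α
  ∩⊆ˡ {α} {β} p = proj₁ (x∈p∩q⁻ α β p)

  ∩⊆ʳ : ∀ {α β : Subset nE} → α ∩ β ⊆ β
  ∩⊆ʳ {α} {β} p = proj₂ (x∈p∩q⁻ α β p)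

  ⊩⊤ : ∀ {w} → ⊤ ⊩ w
  ⊩⊤ {w} = All.universal (λ _ → ∈⊤) w

  ⊩-cut : ∀ {α} a b {c} → α ⊩ (a ++ b ++ c) → α ⊩ (a ++ c)
  ⊩-cut a b p = let q , r = Allₚ.++⁻ a p in Allₚ.++⁺ q (Allₚ.++⁻ʳ b r)

  inv : List E → List E
  inv []      = []
  inv (e ∷ w) = inv w ∷ʳ (e ⁻¹)

  ⊩-inv : ∀ {α w} → Sym α → α ⊩ w → α ⊩ inv w
  ⊩-inv sα []       = []
  ⊩-inv sα (p ∷ ps) = Allₚ.∷ʳ⁺ (⊩-inv sα ps) (sα _ p)

  inv-inv : ∀ w → inv (inv w) ≡ w
  inv-inv []      = refl
  inv-inv (e ∷ w) = trans (inv-∷ʳ (inv w) (e ⁻¹)) (cong₂ _∷_ (⁻¹-invol e) (inv-inv w))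
    where
      inv-∷ʳ : ∀ w e → inv (w ∷ʳ e) ≡ (e ⁻¹) ∷ inv w
      inv-∷ʳ []      e = refl
      inv-∷ʳ (x ∷ w) e = cong (_∷ʳ (x ⁻¹)) (inv-∷ʳ w e)

  infixl 8 _↾_
  _↾_ : List E → Subset nE → List E
  []      ↾ γ = []
  (e ∷ w) ↾ γ with e ∈? γ
  ... | yes _ = e ∷ (w ↾ γ)
  ... | no  _ = w ↾ γ

  ↾-⊩ : ∀ γ w → γ ⊩ w ↾ γ
  ↾-⊩ γ []      = []
  ↾-⊩ γ (e ∷ w) with e ∈? γ
  ... | yes p = p ∷ ↾-⊩ γ w
  ... | no  _ = ↾-⊩ γ w

  ⊩-↾ : ∀ {α} γ {w} → α ⊩ w → α ⊩ w ↾ γ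
  ⊩-↾ γ []       = []
  ⊩-↾ γ {e ∷ w} (p ∷ ps) with e ∈? γ
  ... | yes _ = p ∷ ⊩-↾ γ ps
  ... | no  _ = ⊩-↾ γ ps

  module _ {A : Set} where

    -- Letters outside `γ` act trivially instead of being forbidden. Thus each `R γ` is a relation
    -- on all words, and it does not notice the erasure of letters outside `γ`.
    step-in : Subset nE → (E → A → A) → E → A → A
    step-in γ st e a with e ∈? γ
    ... | yes _ = st e a
    ... | no  _ = a

    run : Subset nE → (E → A → A) → List E → A → A
    run γ st []      a = a
    run γ st (e ∷ w) a = run γ st w (step-in γ st e a)

    step-in-∈ : ∀ {γ e} → e ∈ γ → ∀ st a → step-in γ st e a ≡ st e a
    step-in-∈ {γ} {e} p st a with e ∈? γ
    ... | yes _ = refl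
    ... | no ¬p = ⊥-elim (¬p p)

    step-in-∉ : ∀ {γ e} → e ∉ γ → ∀ st a → step-in γ st e a ≡ a
    step-in-∉ {γ} {e} ¬p st a with e ∈? γ
    ... | yes p = ⊥-elim (¬p p)
    ... | no _  = refl

    run-++ : ∀ γ st u v a → run γ st (u ++ v) a ≡ run γ st v (run γ st u a)
    run-++ γ st []      v a = refl
    run-++ γ st (e ∷ u) v a = run-++ γ st u v _

    run-∷ʳ : ∀ γ st u e a → run γ st (u ∷ʳ e) a ≡ step-in γ st e (run γ st u a)
    run-∷ʳ γ st u e a = run-++ γ st u (e ∷ []) a

    run-↾ : ∀ γ st w a → run γ st (w ↾ γ) a ≡ run γ st w a
    run-↾ γ st []      a = refl
    run-↾ γ st (e ∷ w) a with e ∈? γ in eq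
    ... | no  _ = run-↾ γ st w a
    ... | yes p rewrite eq = run-↾ γ st w _

    run-⊩ : ∀ {α β} → ∀ st {w} → α ⊩ w → β ⊩ w → ∀ a → run α st w a ≡ run β st w a
    run-⊩ st []       []       a = refl
    run-⊩ {α} {β} st {e ∷ w} (p ∷ ps) (q ∷ qs) a =
      trans (cong (run α st w) (trans (step-in-∈ p st a) (sym (step-in-∈ q st a)))) (run-⊩ st ps qs _)

    run-≗ : ∀ γ {st st′ : E → A → A} → (∀ e a → st e a ≡ st′ e a) → ∀ w a → run γ st w a ≡ run γ st′ w a
    run-≗ γ eq []      a = refl
    run-≗ γ {st} {st′} eq (e ∷ w) a =
      trans (cong (run γ st w) step-eq) (run-≗ γ eq w _)
      where
        step-eq : step-in γ st e a ≡ step-in γ st′ e a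
        step-eq with e ∈? γ
        ... | yes _ = eq e a
        ... | no  _ = refl

  -- A setoid, because the main examples are words modulo a congruence and cosets glued together.
  -- Equality is decidable so that the points of an orbit can be numbered.
  record FSet : Set₁ where
    infix 4 _≈_ _≈?_
    field
      Carrier   : Set
      _≈_       : Carrier → Carrier → Set
      ≈-refl    : ∀ {x} → x ≈ x
      ≈-sym     : ∀ {x y} → x ≈ y → y ≈ x
      ≈-trans   : ∀ {x y z} → x ≈ y → y ≈ z → x ≈ z
      _≈?_      : ∀ x y → Dec (x ≈ y)
      step      : E → Carrier → Carrier
      step-cong : ∀ e {x y} → x ≈ y → step e x ≈ step e y
      step-inv  : ∀ e x → step (e ⁻¹) (step e x) ≈ x

    ≡⇒≈ : ∀ {x y} → x ≡ y → x ≈ y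
    ≡⇒≈ refl = ≈-refl

    infixl 7 _·[_]_
    _·[_]_ : Carrier → Subset nE → List E → Carrier
    x ·[ γ ] w = run γ step w x

    step-in-cong : ∀ γ e {x y} → x ≈ y → step-in γ step e x ≈ step-in γ step e y
    step-in-cong γ e p with e ∈? γ
    ... | yes _ = step-cong e p
    ... | no  _ = p

    run-cong : ∀ γ w {x y} → x ≈ y → x ·[ γ ] w ≈ y ·[ γ ] w
    run-cong γ []      p = p
    run-cong γ (e ∷ w) p = run-cong γ w (step-in-cong γ e p)

    step-in-inv : ∀ {γ} → Sym γ → ∀ e x → step-in γ step (e ⁻¹) (step-in γ step e x) ≈ x
    step-in-inv {γ} sγ e x with e ∈? γ
    ... | yes p = ≈-trans (≡⇒≈ (step-in-∈ (sγ e p) step _)) (step-inv e x)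
    ... | no ¬p = ≡⇒≈ (step-in-∉ (sym-∉ sγ ¬p) step x)

    run-inv : ∀ {γ} → Sym γ → ∀ w x → x ·[ γ ] w ·[ γ ] inv w ≈ x
    run-inv         sγ []      x = ≈-refl
    run-inv {γ} sγ (e ∷ w) x =
      ≈-trans (≡⇒≈ (run-∷ʳ γ step (inv w) (e ⁻¹) _))
        (≈-trans (step-in-cong γ (e ⁻¹) (run-inv sγ w _)) (step-in-inv sγ e x))

    run-snoc : ∀ γ w e x → e ∈ γ → x ·[ γ ] (w ∷ʳ e) ≡ step e (x ·[ γ ] w)
    run-snoc γ w e x p = trans (run-∷ʳ γ step w e x) (step-in-∈ p step _)

-- The congruences `R γ`, their finite index and their decidability.

module System (I : Pattern) (b₀ D : ℕ) where
  open Letters I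

  count : ℕ → ℕ
  count n = length (words nE n)

  -- The numbers of self-maps of `b` points, of assignments of a self-map to every letter, and of
  -- maps from such assignments to self-maps. The last bounds the number of classes of words that
  -- test actions on `b` points can distinguish.
  tables codes classes : ℕ → ℕ
  tables b  = b ^ b
  codes b   = tables b ^ nE
  classes b = tables b ^ codes b

  -- If a bounds the number of classes modulo R δ for all δ ⊂ γ, then chainBound a bounds the
  -- γ-orbits in chains of D cosets, and orbitBound a those in their synchronised versions.
  chainBound orbitBound : ℕ → ℕ
  chainBound a = suc (count a) ^ D
  orbitBound a = b₀ + chainBound a * suc (chainBound a * nS)

  abstract
    -- The points of an orbit are named by words of length at most `orbitBound a` that reach them,
    -- so a test action has one point for each such word. Abstract, so that the tower of
    -- exponentials is not unfolded.
    testSize : ℕ → ℕ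
    testSize a = count (orbitBound a)

    testSize-≡ : ∀ a → testSize a ≡ count (orbitBound a)
    testSize-≡ a = refl

  -- Summing over all smaller cardinalities makes `below ∣ γ ∣` a bound for the index of every
  -- proper subset. Dependence on the cardinality alone keeps the sizes invariant under
  -- automorphisms.
  below : ℕ → ℕ
  below zero    = 0
  below (suc k) = below k + classes (testSize (below k))

  rank : Subset nE → ℕ
  rank γ = below ∣ γ ∣

  size index : Subset nE → ℕ
  size γ  = testSize (rank γ)
  index γ = classes (size γ)

  index-below : ∀ {j k} → j < k → classes (testSize (below j)) ≤ below k
  index-below {j} (s≤s {n = k} j≤k) with ℕₚ.m≤n⇒m<n∨m≡n j≤k
  ... | inj₁ j<k  = ℕₚ.≤-trans (index-below j<k) (ℕₚ.m≤m+n (below k) _)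
  ... | inj₂ refl = ℕₚ.m≤n+m _ (below k)

  index-rank : ∀ {δ γ} → δ ⊂ γ → index δ ≤ rank γ
  index-rank δ⊂γ = index-below (p⊂q⇒∣p∣<∣q∣ δ⊂γ)

  -- Wrapped in a record so that `b` can be inferred from the type of a code, which `Fin (codes b)`
  -- would not allow.
  record Code (b : ℕ) : Set where
    constructor code
    field decode : Fin (codes b)
  open Code

  all-codes? : ∀ {b} {P : Code b → Set} → (∀ c → Dec (P c)) → Dec (∀ c → P c)
  all-codes? P? = map′ (λ h c → h (decode c)) (λ h i → h (code i)) (Finₚ.all? (λ i → P? (code i)))

  act : ∀ {b} → Code b → E → Fin b → Fin b
  act {b} c e = finToFun {b} {b} (finToFun {tables b} {nE} (decode c) e)

  encode : ∀ {b} → (E → Fin b → Fin b) → Code b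
  encode {b} f = code (funToFin {nE} {tables b} (λ e → funToFin {b} {b} (f e)))

  act-encode : ∀ {b} (f : E → Fin b → Fin b) e v → act (encode f) e v ≡ f e v
  act-encode {b} f e v = trans (cong (λ c → finToFun {b} {b} c v) (Finₚ.finToFun-funToFin {nE} {tables b} (λ e → funToFin {b} {b} (f e)) e))
                               (Finₚ.finToFun-funToFin {b} {b} (f e) v)

  Invertible : ∀ {b} → Code b → Set
  Invertible c = ∀ e v → act c (e ⁻¹) (act c e v) ≡ v

  Agree : ∀ {b} → Subset nE → Code b → List E → List E → Set
  Agree γ c u u′ = ∀ v → run γ (act c) u v ≡ run γ (act c) u′ v

  -- u and u′ are related if they act alike on every test action of letters from γ that respects R δ for all δ ⊂ γ.
  R-acc : ∀ γ → Acc _⊂_ γ → List E → List E → Set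
  R-acc γ (acc rs) u u′ =
    (c : Code (size γ)) → Invertible c →
    (∀ δ (δ⊂γ : δ ⊂ γ) → Sym δ → ∀ w w′ → R-acc δ (rs δ⊂γ) w w′ → Agree δ c w w′) →
    Agree γ c u u′

  R-acc-irr : ∀ γ (a a′ : Acc _⊂_ γ) {u u′} → R-acc γ a u u′ → R-acc γ a′ u u′
  R-acc-irr γ (acc rs) (acc rs′) h c ic good =
    h c ic (λ δ lt sδ w w′ r → good δ lt sδ w w′ (R-acc-irr δ (rs lt) (rs′ lt) r))

  abstract
    R : Subset nE → List E → List E → Set
    R γ = R-acc γ (⊂-wellFounded γ)

  Good : ∀ {b} → Subset nE → Code b → Set
  Good γ c = Invertible c × (∀ δ → δ ⊂ γ → Sym δ → ∀ w w′ → R δ w w′ → Agree δ c w w′)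

  abstract
    R-elim : ∀ {γ u u′} → R γ u u′ → (c : Code (size γ)) → Good γ c → Agree γ c u u′
    R-elim {γ} {u} {u′} = go (⊂-wellFounded γ)
      where
        go : ∀ (a : Acc _⊂_ γ) → R-acc γ a u u′ → ∀ (c : Code (size γ)) → Good γ c → Agree γ c u u′
        go (acc rs) r c (ic , good) = r c ic (λ δ lt sδ w w′ p → good δ lt sδ w w′ (R-acc-irr δ (rs lt) _ p))

    R-intro : ∀ {γ u u′} → ((c : Code (size γ)) → Good γ c → Agree γ c u u′) → R γ u u′
    R-intro {γ} {u} {u′} h = go (⊂-wellFounded γ)
      where
        go : ∀ (a : Acc _⊂_ γ) → R-acc γ a u u′
        go (acc rs) c ic good = h c (ic , λ δ lt sδ w w′ p → good δ lt sδ w w′ (R-acc-irr δ _ (rs lt) p))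

  R-refl : ∀ {γ u} → R γ u u
  R-refl = R-intro λ c g v → refl

  R-sym : ∀ {γ u v} → R γ u v → R γ v u
  R-sym r = R-intro λ c g v → sym (R-elim r c g v)

  R-trans : ∀ {γ u v w} → R γ u v → R γ v w → R γ u w
  R-trans r s = R-intro λ c g v → trans (R-elim r c g v) (R-elim s c g v)

  R-≡ : ∀ {γ u v} → u ≡ v → R γ u v
  R-≡ refl = R-refl

  R-++ : ∀ {γ u u′ v v′} → R γ u u′ → R γ v v′ → R γ (u ++ v) (u′ ++ v′)
  R-++ {γ} {u} {u′} {v} {v′} r s = R-intro λ c g x →
    trans (run-++ γ (act c) u v x)
      (trans (cong (run γ (act c) v) (R-elim r c g x))
        (trans (R-elim s c g _) (sym (run-++ γ (act c) u′ v′ x))))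

  R-++ˡ : ∀ {γ} u {v v′} → R γ v v′ → R γ (u ++ v) (u ++ v′)
  R-++ˡ u = R-++ (R-refl {u = u})

  R-++ʳ : ∀ {γ u u′} v → R γ u u′ → R γ (u ++ v) (u′ ++ v)
  R-++ʳ v r = R-++ r (R-refl {u = v})

  R-↾ : ∀ γ w → R γ (w ↾ γ) w
  R-↾ γ w = R-intro λ c g v → run-↾ γ (act c) w v

  R-∉ : ∀ {γ e} → e ∉ γ → ∀ w → R γ (w ∷ʳ e) w
  R-∉ {γ} {e} e∉ w = R-intro λ c g v → trans (run-∷ʳ γ (act c) w e v) (step-in-∉ e∉ (act c) _)

  R-cancel : ∀ {γ} → Sym γ → ∀ e → R γ (e ∷ (e ⁻¹) ∷ []) []
  R-cancel {γ} sγ e = R-intro λ c g v → lem c g v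
    where
      lem : ∀ c → Good γ c → Agree γ c (e ∷ (e ⁻¹) ∷ []) []
      lem c g v with e ∈? γ
      ... | yes p = trans (step-in-∈ (sγ e p) (act c) _) (proj₁ g e v)
      ... | no ¬p = step-in-∉ (sym-∉ sγ ¬p) (act c) v

  R-invʳ : ∀ {γ} → Sym γ → ∀ w → R γ (w ++ inv w) []
  R-invʳ sγ []      = R-refl
  R-invʳ sγ (e ∷ w) =
    R-trans (R-≡ (cong (e ∷_) (sym (Listₚ.++-assoc w (inv w) _))))
      (R-trans (R-++ˡ (e ∷ []) (R-++ʳ ((e ⁻¹) ∷ []) (R-invʳ sγ w))) (R-cancel sγ e))

  R-invˡ : ∀ {γ} → Sym γ → ∀ w → R γ (inv w ++ w) []
  R-invˡ {γ} sγ w = subst (λ u → R γ (inv w ++ u) []) (inv-inv w) (R-invʳ sγ (inv w))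

  R-inv-cancelˡ : ∀ {γ} → Sym γ → ∀ u v → R γ (inv u ++ (u ++ v)) v
  R-inv-cancelˡ sγ u v = R-trans (R-≡ (sym (Listₚ.++-assoc (inv u) u v))) (R-++ʳ v (R-invˡ sγ u))

  R-cancelˡ : ∀ {γ} → Sym γ → ∀ u {v w} → R γ (u ++ v) (u ++ w) → R γ v w
  R-cancelˡ sγ u {v} {w} r =
    R-trans (R-sym (R-inv-cancelˡ sγ u v)) (R-trans (R-++ˡ (inv u) r) (R-inv-cancelˡ sγ u w))

  R-moveˡ : ∀ {γ} → Sym γ → ∀ u {v w} → R γ (u ++ v) w → R γ v (inv u ++ w)
  R-moveˡ sγ u {v} r = R-trans (R-sym (R-inv-cancelˡ sγ u v)) (R-++ˡ (inv u) r)

  R-moveʳ : ∀ {γ} → Sym γ → ∀ u v {w} → R γ (u ++ v) w → R γ u (w ++ inv v)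
  R-moveʳ sγ u v {w} r =
    R-trans (R-≡ (sym (Listₚ.++-identityʳ u)))
      (R-trans (R-++ˡ u (R-sym (R-invʳ sγ v)))
        (R-trans (R-≡ (sym (Listₚ.++-assoc u v (inv v)))) (R-++ʳ (inv v) r)))

  table : ∀ {b} → Subset nE → List E → Code b → Fin (tables b)
  table {b} γ u c = funToFin {b} {b} (run γ (act c) u)

  -- Records the action of `u` on every code, good or not. This is finer than `R γ`, but it has
  -- finite range without any knowledge of which codes are good.
  classify : ∀ γ → List E → Fin (index γ)
  classify γ u = funToFin {codes (size γ)} {tables (size γ)} (λ i → table {size γ} γ u (code i))

  table-≡ : ∀ {b} γ {u u′} (c : Code b) → table γ u c ≡ table γ u′ c → Agree γ c u u′
  table-≡ {b} γ {u} {u′} c eq v =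
    trans (sym (Finₚ.finToFun-funToFin {b} {b} (run γ (act c) u) v))
      (trans (cong (λ t → finToFun {b} {b} t v) eq) (Finₚ.finToFun-funToFin {b} {b} (run γ (act c) u′) v))

  tables-≡ : ∀ {b} (f g : Code b → Fin (tables b)) →
             funToFin {codes b} {tables b} (λ i → f (code i)) ≡ funToFin {codes b} {tables b} (λ i → g (code i)) →
             ∀ c → f c ≡ g c
  tables-≡ {b} f g eq c =
    trans (sym (Finₚ.finToFun-funToFin {codes b} {tables b} (λ i → f (code i)) (decode c)))
      (trans (cong (λ t → finToFun {tables b} {codes b} t (decode c)) eq)
        (Finₚ.finToFun-funToFin {codes b} {tables b} (λ i → g (code i)) (decode c)))

  classify-R : ∀ γ {u u′} → classify γ u ≡ classify γ u′ → R γ u u′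
  classify-R γ {u} {u′} eq = R-intro λ c g →
    table-≡ γ {u} {u′} c (tables-≡ (table γ u) (table γ u′) eq c)

  R-shorten : ∀ {α} γ w → α ⊩ w → ∃ λ w′ → length w′ ≤ index γ × α ⊩ w′ × R γ w w′
  R-shorten {α} γ = shorten (classify γ) (α ⊩_) (R γ) R-refl R-trans λ a b c eq α⊩ →
    ⊩-cut a b α⊩ , R-trans (R-≡ (sym (Listₚ.++-assoc a b c))) (R-++ʳ c (R-sym (classify-R γ eq)))

  -- Immediate from the definition for β ⊂ γ: test actions for γ respect R β.
  R-cons : ∀ {β γ u u′} → Sym β → β ⊆ γ → β ⊩ u → β ⊩ u′ → R β u u′ → R γ u u′
  R-cons {β} {γ} {u} {u′} sβ β⊆γ pu pu′ r with γ ⊆? β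
  ... | yes γ⊆β = subst (λ α → R α u u′) (⊆-antisym β⊆γ γ⊆β) r
  ... | no γ⊈β = R-intro λ c g v →
        trans (run-⊩ (act c) (⊩-⊆ β⊆γ pu) pu v)
          (trans (proj₂ g β (β⊆γ , strict) sβ u u′ r v) (run-⊩ (act c) pu′ (⊩-⊆ β⊆γ pu′) v))
    where
      strict : ∃ λ e → e ∈ γ × e ∉ β
      strict with Finₚ.any? (λ e → (e ∈? γ) ×-dec ¬? (e ∈? β))
      ... | yes p = p
      ... | no ¬p = ⊥-elim (γ⊈β λ {e} p → decidable-stable (e ∈? β) λ q → ¬p (e , p , q))

  allSubset? : ∀ {P : Subset nE → Set} → (∀ δ → Dec (P δ)) → Dec (∀ δ → P δ)
  allSubset? P? with anySubset? (λ δ → ¬? (P? δ))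
  ... | yes (δ , ¬p) = no λ h → ¬p (h δ)
  ... | no ¬p = yes λ δ → decidable-stable (P? δ) λ q → ¬p (δ , q)

  Agree? : ∀ {b} γ (c : Code b) u u′ → Dec (Agree γ c u u′)
  Agree? γ c u u′ = Finₚ.all? λ v → run γ (act c) u v ≟ run γ (act c) u′ v

  Invertible? : ∀ {b} (c : Code b) → Dec (Invertible c)
  Invertible? c = Finₚ.all? λ e → Finₚ.all? λ v → act c (e ⁻¹) (act c e v) ≟ v

  module _ {b} (c : Code b) (δ : Subset nE) (R? : ∀ w w′ → Dec (R δ w w′)) where

    private
      shortWords = words nE (suc (index δ))
      Check = All (λ w → All (λ w′ → R δ w w′ → Agree δ c w w′) shortWords) shortWords

    -- Goodness quantifies over all pairs of words and has to be decided. A word is replaced by a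
    -- short one letter by letter: a letter in front of a word of length `index δ` gives length
    -- `suc (index δ)`, still in the checked range, so shortening it again preserves the action.
    agree-on-short⇒agree : Check → ∀ w w′ → R δ w w′ → Agree δ c w w′
    agree-on-short⇒agree check w w′ r v =
      let s , ls , rs , as = rep w
          s′ , ls′ , rs′ , as′ = rep w′
      in trans (as v) (trans (use s s′ (ℕₚ.m≤n⇒m≤1+n ls) (ℕₚ.m≤n⇒m≤1+n ls′) (R-trans (R-sym rs) (R-trans r rs′)) v) (sym (as′ v)))
      where
        use : ∀ s s′ → length s ≤ suc (index δ) → length s′ ≤ suc (index δ) → R δ s s′ → Agree δ c s s′
        use s s′ l l′ r = All.lookup (All.lookup check (∈-words _ s l)) (∈-words _ s′ l′) r
        rep : ∀ w → ∃ λ s → length s ≤ index δ × R δ w s × Agree δ c w s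
        rep []      = [] , z≤n , R-refl , λ v → refl
        rep (e ∷ w) with s , l , r , a ← rep w
                    with s′ , l′ , _ , r′ ← R-shorten δ (e ∷ s) ⊩⊤
          = s′ , l′ , R-trans (R-++ˡ (e ∷ []) r) r′
          , λ v → trans (a _) (use (e ∷ s) s′ (s≤s l) (ℕₚ.m≤n⇒m≤1+n l′) r′ v)

    agree? : Dec (∀ w w′ → R δ w w′ → Agree δ c w w′)
    agree? = map′ agree-on-short⇒agree
      (λ h → All.universal (λ w → All.universal (λ w′ → h w w′) shortWords) shortWords)
      (All.all? (λ w → All.all? (λ w′ → R? w w′ →-dec Agree? δ c w w′) shortWords) shortWords)

  abstract
    -- There are finitely many codes and subsets, and respecting `R δ` is a finite check once `R δ`
    -- is decidable. The glued actions rely on this, as they are defined by cases on membership in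
    -- cosets.
    R? : ∀ γ u u′ → Dec (R γ u u′)
    R? γ = go γ (⊂-wellFounded γ)
      where
        go : ∀ γ → Acc _⊂_ γ → ∀ u u′ → Dec (R γ u u′)
        go γ (acc rs) u u′ = map′ (R-intro {γ} {u} {u′}) (R-elim {γ} {u} {u′})
          (all-codes? {size γ} {λ c → Good γ c → Agree γ c u u′} λ c → good? c →-dec Agree? γ c u u′)
          where
            agree-below? : ∀ (c : Code (size γ)) δ → Dec (δ ⊂ γ → Sym δ → ∀ w w′ → R δ w w′ → Agree δ c w w′)
            agree-below? c δ with δ ⊂? γ
            ... | no ¬lt = yes λ lt → ⊥-elim (¬lt lt)
            ... | yes lt = map′ (λ h _ → h) (λ h → h lt) (Sym? δ →-dec agree? c δ (go δ (rs lt)))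
            good? : ∀ (c : Code (size γ)) → Dec (Good γ c)
            good? c = Invertible? c ×-dec allSubset? (agree-below? c)

-- A criterion for an action to respect every `R γ`.

module Killing (I : Pattern) (b₀ D : ℕ) where
  open Letters I
  open System I b₀ D

  module Orbits (X : FSet) where
    open FSet X

    -- Orbits that are small enough to be test actions themselves.
    Covered : Subset nE → ℕ → Carrier → Set
    Covered γ n x = ∃ λ xs → length xs ≤ n × (∀ u → Any (x ·[ γ ] u ≈_) xs)

    Killed : Subset nE → Carrier → Set
    Killed γ x = ∀ u u′ → R γ u u′ → x ·[ γ ] u ≈ x ·[ γ ] u′

    covered-shorten : ∀ {γ n x} → Covered γ n x → ∀ u → ∃ λ u′ → length u′ ≤ n × x ·[ γ ] u ≈ x ·[ γ ] u′
    covered-shorten {γ} {n} {x} (xs , l , cov) u =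
      let u′ , l′ , _ , r = shorten position (λ _ → Carrier) (λ u v → x ·[ γ ] u ≈ x ·[ γ ] v)
                              ≈-refl ≈-trans (λ a b c eq y → y , cut-step a b c eq) u x
      in u′ , ℕₚ.≤-trans l′ l , r
      where
        position : List E → Fin (length xs)
        position u = Any.index (cov u)
        position-≈ : ∀ {u v} → position u ≡ position v → x ·[ γ ] u ≈ x ·[ γ ] v
        position-≈ {u} {v} eq = ≈-trans (Anyₚ.lookup-index (cov u))
          (≈-trans (≡⇒≈ (cong (lookup xs) eq)) (≈-sym (Anyₚ.lookup-index (cov v))))
        cut-step : ∀ a b c → position a ≡ position (a ++ b) → x ·[ γ ] (a ++ b ++ c) ≈ x ·[ γ ] (a ++ c)
        cut-step a b c eq =
          ≈-trans (≡⇒≈ (trans (cong (x ·[ γ ]_) (sym (Listₚ.++-assoc a b c))) (run-++ γ step (a ++ b) c x)))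
            (≈-trans (run-cong γ c (position-≈ {a ++ b} {a} (sym eq)))
              (≡⇒≈ (sym (run-++ γ step a c x))))

    -- Turns an orbit into an action on exactly `count n` points. A point of the orbit is named by
    -- the first short word that reaches it; all other indices become fixed points, so the size need
    -- not be that of the orbit.
    module Encode {γ} (sγ : Sym γ) {n x} (short : ∀ u → ∃ λ u′ → length u′ ≤ n × x ·[ γ ] u ≈ x ·[ γ ] u′) where

      state : Fin (count n) → Carrier
      state i = x ·[ γ ] lookup (words nE n) i

      number : Carrier → Fin (count n)
      number y = first (λ i → state i ≈? y)

      number-cong : ∀ {y z} → y ≈ z → number y ≡ number z
      number-cong p = first-cong _ _ (λ i q → ≈-trans q p) (λ i q → ≈-trans q (≈-sym p))

      state-number : ∀ u → state (number (x ·[ γ ] u)) ≈ x ·[ γ ] u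
      state-number u =
        let u′ , l , r = short u
            m = ∈-words n u′ l
        in first-sat (λ i → state i ≈? (x ·[ γ ] u)) (Any.index m)
             (≈-sym (≈-trans r (≡⇒≈ (cong (x ·[ γ ]_) (Anyₚ.lookup-index m)))))

      move move-γ : E → Fin (count n) → Fin (count n)
      move e i with number (state i) ≟ i
      ... | yes _ = number (step e (state i))
      ... | no  _ = i
      -- A letter outside `γ` may lead out of the orbit, where `number` is junk; making it trivial
      -- keeps the table invertible.
      move-γ = step-in γ move

      move-number : ∀ e u → move e (number (x ·[ γ ] u)) ≡ number (step e (x ·[ γ ] u))
      move-number e u with number (state (number (x ·[ γ ] u))) ≟ number (x ·[ γ ] u)
      ... | yes _ = number-cong (step-cong e (state-number u))
      ... | no ¬p = ⊥-elim (¬p (number-cong (state-number u)))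

      move-fixed : ∀ e i → number (state i) ≢ i → move e i ≡ i
      move-fixed e i ¬p with number (state i) ≟ i
      ... | yes p = ⊥-elim (¬p p)
      ... | no _  = refl

      run-number : ∀ {δ} → δ ⊆ γ → ∀ w u → run δ move-γ w (number (x ·[ γ ] u)) ≡ number (x ·[ γ ] u ·[ δ ] w)
      run-number δ⊆γ []      u = refl
      run-number {δ} δ⊆γ (e ∷ w) u with e ∈? δ
      ... | no  _ = run-number δ⊆γ w u
      ... | yes p = trans (cong (run δ move-γ w) (trans (step-in-∈ (δ⊆γ p) move _) (trans (move-number e u) (cong number (sym eq)))))
                      (trans (run-number δ⊆γ w (u ∷ʳ e)) (cong (λ y → number (y ·[ δ ] w)) eq))
        where eq = run-snoc γ u e x (δ⊆γ p)

      run-fixed : ∀ {δ} → δ ⊆ γ → ∀ w i → number (state i) ≢ i → run δ move-γ w i ≡ i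
      run-fixed δ⊆γ []      i ¬p = refl
      run-fixed {δ} δ⊆γ (e ∷ w) i ¬p with e ∈? δ
      ... | no  _ = run-fixed δ⊆γ w i ¬p
      ... | yes p = trans (cong (run δ move-γ w) (trans (step-in-∈ (δ⊆γ p) move i) (move-fixed e i ¬p))) (run-fixed δ⊆γ w i ¬p)

      move-γ-invertible : ∀ e i → move-γ (e ⁻¹) (move-γ e i) ≡ i
      move-γ-invertible e i with e ∈? γ
      ... | no ¬p = step-in-∉ (sym-∉ sγ ¬p) move i
      ... | yes p = trans (step-in-∈ (sγ e p) move _) (back (number (state i) ≟ i))
        where
          w = lookup (words nE n) i
          back : Dec (number (state i) ≡ i) → move (e ⁻¹) (move e i) ≡ i
          back (no ¬q) = trans (cong (move (e ⁻¹)) (move-fixed e i ¬q)) (move-fixed (e ⁻¹) i ¬q)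
          back (yes q) =
            trans (cong (move (e ⁻¹)) (trans (cong (move e) (sym q)) (trans (move-number e w) (cong number (sym eq)))))
              (trans (move-number (e ⁻¹) (w ∷ʳ e))
                (trans (number-cong (≈-trans (≡⇒≈ (cong (step (e ⁻¹)) eq)) (step-inv e (state i)))) q))
            where eq = run-snoc γ w e x p

      table-code : Code (count n)
      table-code = encode move-γ

      table-code-good : (∀ δ → δ ⊂ γ → Sym δ → ∀ y → Killed δ y) → Good γ table-code
      table-code-good ih =
        (λ e v → trans (act-encode move-γ (e ⁻¹) _) (trans (cong (move-γ (e ⁻¹)) (act-encode move-γ e v)) (move-γ-invertible e v)))
        , λ δ δ⊂γ sδ w w′ r v →
            trans (run-≗ δ (act-encode move-γ) w v) (trans (agree δ δ⊂γ sδ w w′ r v) (sym (run-≗ δ (act-encode move-γ) w′ v)))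
        where
          agree : ∀ δ → δ ⊂ γ → Sym δ → ∀ w w′ → R δ w w′ → ∀ v → run δ move-γ w v ≡ run δ move-γ w′ v
          agree δ (δ⊆γ , q) sδ w w′ r v with number (state v) ≟ v
          ... | no ¬p = trans (run-fixed δ⊆γ w v ¬p) (sym (run-fixed δ⊆γ w′ v ¬p))
          ... | yes p = trans (cong (run δ move-γ w) (sym p))
                  (trans (run-number δ⊆γ w (lookup (words nE n) v))
                    (trans (number-cong (ih δ (δ⊆γ , q) sδ _ w w′ r))
                      (trans (sym (run-number δ⊆γ w′ (lookup (words nE n) v))) (cong (run δ move-γ w′) p))))

      killed : size γ ≡ count n → (∀ δ → δ ⊂ γ → Sym δ → ∀ y → Killed δ y) → Killed γ x
      killed eq ih u u′ r = ≈-trans (≈-sym (state-number u)) (≈-trans (≡⇒≈ (cong state same)) (state-number u′))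
        where
          elim : ∀ {b} → size γ ≡ b → (c : Code b) → Good γ c → Agree γ c u u′
          elim refl c g = R-elim r c g
          run-u : ∀ u → number (x ·[ γ ] u) ≡ run γ (act table-code) u (number x)
          run-u u = sym (trans (run-≗ γ (act-encode move-γ) u _) (run-number id u []))
          same : number (x ·[ γ ] u) ≡ number (x ·[ γ ] u′)
          same = trans (run-u u) (trans (elim eq table-code (table-code-good ih) (number x)) (sym (run-u u′)))

    Dichotomy : Set
    Dichotomy = ∀ γ → Sym γ → ∀ x → Covered γ (orbitBound (rank γ)) x ⊎ Killed γ x

    -- Induction on `γ`: by the hypothesis for all proper subsets and all points, the encoded orbit
    -- of `x` respects the smaller congruences, hence is one of the test actions that define `R γ`.
    all-killed : Dichotomy → ∀ γ → Sym γ → ∀ x → Killed γ x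
    all-killed dich γ = go γ (⊂-wellFounded γ)
      where
        go : ∀ γ → Acc _⊂_ γ → Sym γ → ∀ x → Killed γ x
        go γ (acc rs) sγ x with dich γ sγ x
        ... | inj₂ k   = k
        ... | inj₁ cov = Encode.killed sγ (covered-shorten cov) (testSize-≡ (rank γ)) (λ δ lt sδ → go δ (rs lt) sδ)

-- Small actions, and the action on a single coset.

module Pieces (I : Pattern) (b₀ D : ℕ) (1≤D : 1 ≤ D) (3≤b₀ : 3 ≤ b₀) (nS≤b₀ : Pattern.nS I ≤ b₀) where
  open Letters I
  open System I b₀ D
  open Killing I b₀ D

  R-restrict : ∀ {γ u u′} → R γ u u′ → R γ (u ↾ γ) (u′ ↾ γ)
  R-restrict r = R-trans (R-↾ _ _) (R-trans r (R-sym (R-↾ _ _)))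

  module Small (X : FSet) (xs : List (FSet.Carrier X)) (small : length xs ≤ b₀)
               (complete : ∀ y → Any (FSet._≈_ X y) xs) where
    open FSet X

    killed : ∀ γ → Sym γ → ∀ x → Orbits.Killed X γ x
    killed = Orbits.all-killed X λ γ sγ x → inj₁ (xs , ℕₚ.≤-trans small (ℕₚ.m≤m+n b₀ _) , λ u → complete _)

    respects : ∀ {γ} → Sym γ → ∀ {u u′} → R γ u u′ → ∀ x → x ·[ γ ] u ≈ x ·[ γ ] u′
    respects {γ} sγ r x = killed γ sγ x _ _ r

  -- The action of e on S must be a permutation; on the walks of the pattern it is just the passage from source to target.
  τ : E → S → S
  τ e s with s ≟ ι₁ e | s ≟ ι₂ e
  ... | yes _ | _     = ι₂ e
  ... | no _  | yes _ = ι₁ e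
  ... | no _  | no _  = s

  ι₂-⁻¹ : ∀ e → ι₂ (e ⁻¹) ≡ ι₁ e
  ι₂-⁻¹ e = trans (sym (ι₁-⁻¹ (e ⁻¹))) (cong ι₁ (⁻¹-invol e))

  τ-ι₁ : ∀ e {s} → s ≡ ι₁ e → τ e s ≡ ι₂ e
  τ-ι₁ e {s} p with s ≟ ι₁ e | s ≟ ι₂ e
  ... | yes _ | _ = refl
  ... | no ¬p | _ = ⊥-elim (¬p p)

  τ-ι₂ : ∀ e {s} → s ≡ ι₂ e → τ e s ≡ ι₁ e
  τ-ι₂ e {s} p with s ≟ ι₁ e | s ≟ ι₂ e
  ... | yes q | _ = trans (sym p) q
  ... | no _  | yes _ = refl
  ... | no _  | no ¬q = ⊥-elim (¬q p)

  τ-other : ∀ e {s} → s ≢ ι₁ e → s ≢ ι₂ e → τ e s ≡ s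
  τ-other e {s} ¬p ¬q with s ≟ ι₁ e | s ≟ ι₂ e
  ... | yes p | _     = ⊥-elim (¬p p)
  ... | no _  | yes q = ⊥-elim (¬q q)
  ... | no _  | no _  = refl

  τ-inv : ∀ e s → τ (e ⁻¹) (τ e s) ≡ s
  τ-inv e s = by (s ≟ ι₁ e) (s ≟ ι₂ e)
    where
      by : Dec (s ≡ ι₁ e) → Dec (s ≡ ι₂ e) → τ (e ⁻¹) (τ e s) ≡ s
      by (yes p) _ = trans (cong (τ (e ⁻¹)) (τ-ι₁ e p)) (trans (τ-ι₁ (e ⁻¹) (sym (ι₁-⁻¹ e))) (trans (ι₂-⁻¹ e) (sym p)))
      by (no _) (yes q) = trans (cong (τ (e ⁻¹)) (τ-ι₂ e q)) (trans (τ-ι₂ (e ⁻¹) (sym (ι₂-⁻¹ e))) (trans (ι₁-⁻¹ e) (sym q)))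
      by (no ¬p) (no ¬q) = trans (cong (τ (e ⁻¹)) (τ-other e ¬p ¬q))
        (τ-other (e ⁻¹) (λ p → ¬q (trans p (ι₁-⁻¹ e))) (λ q → ¬p (trans q (ι₂-⁻¹ e))))

  Sorts : FSet
  Sorts = record
    { Carrier = S ; _≈_ = _≡_ ; ≈-refl = refl ; ≈-sym = sym ; ≈-trans = trans ; _≈?_ = _≟_
    ; step = τ ; step-cong = λ e → cong (τ e) ; step-inv = τ-inv }

  sorts-respect : ∀ {γ} → Sym γ → ∀ {u u′} → R γ u u′ → ∀ s → run γ τ u s ≡ run γ τ u′ s
  sorts-respect = Small.respects Sorts (allFin nS) (ℕₚ.≤-trans (ℕₚ.≤-reflexive (Listₚ.length-tabulate id)) nS≤b₀) ∈-allFin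

  -- A rotation of three points, since a swap of two points would not tell a letter from its
  -- inverse.
  module Letter (e₀ : E) where
    rot rot⁻¹ : Fin 3 → Fin 3
    rot zero = suc zero
    rot (suc zero) = suc (suc zero)
    rot (suc (suc zero)) = zero
    rot⁻¹ j = rot (rot j)

    rot³ : ∀ j → rot (rot (rot j)) ≡ j
    rot³ zero = refl
    rot³ (suc zero) = refl
    rot³ (suc (suc zero)) = refl

    spin : E → Fin 3 → Fin 3
    spin e j with e ≟ e₀ | e ≟ e₀ ⁻¹
    ... | yes _ | _     = rot j
    ... | no _  | yes _ = rot⁻¹ j
    ... | no _  | no _  = j

    spin-e₀ : ∀ j → spin e₀ j ≡ rot j
    spin-e₀ j with e₀ ≟ e₀
    ... | yes _ = refl
    ... | no ¬p = ⊥-elim (¬p refl)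

    spin-e₀⁻¹ : ∀ j → spin (e₀ ⁻¹) j ≡ rot⁻¹ j
    spin-e₀⁻¹ j with (e₀ ⁻¹) ≟ e₀ | (e₀ ⁻¹) ≟ e₀ ⁻¹
    ... | yes p | _     = ⊥-elim (⁻¹-fpf e₀ p)
    ... | no _  | yes _ = refl
    ... | no _  | no ¬p = ⊥-elim (¬p refl)

    spin-other : ∀ {e} → e ≢ e₀ → e ≢ e₀ ⁻¹ → ∀ j → spin e j ≡ j
    spin-other {e} ¬p ¬q j with e ≟ e₀ | e ≟ e₀ ⁻¹
    ... | yes p | _     = ⊥-elim (¬p p)
    ... | no _  | yes q = ⊥-elim (¬q q)
    ... | no _  | no _  = refl

    spin-inv : ∀ e j → spin (e ⁻¹) (spin e j) ≡ j
    spin-inv e j = by (e ≟ e₀) (e ≟ e₀ ⁻¹)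
      where
        by : Dec (e ≡ e₀) → Dec (e ≡ e₀ ⁻¹) → spin (e ⁻¹) (spin e j) ≡ j
        by (yes refl) _ = trans (cong (spin (e ⁻¹)) (spin-e₀ j)) (trans (spin-e₀⁻¹ (rot j)) (rot³ j))
        by (no _) (yes refl) = trans (cong₂ spin (⁻¹-invol e₀) (spin-e₀⁻¹ j)) (trans (spin-e₀ (rot⁻¹ j)) (rot³ j))
        by (no ¬p) (no ¬q) = trans (cong (spin (e ⁻¹)) (spin-other ¬p ¬q j)) (spin-other
          (λ p → ¬q (trans (sym (⁻¹-invol e)) (cong _⁻¹ p)))
          (λ q → ¬p (trans (sym (⁻¹-invol e)) (trans (cong _⁻¹ q) (⁻¹-invol e₀)))) j)

    Spins : FSet
    Spins = record
      { Carrier = Fin 3 ; _≈_ = _≡_ ; ≈-refl = refl ; ≈-sym = sym ; ≈-trans = trans ; _≈?_ = _≟_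
      ; step = spin ; step-cong = λ e → cong (spin e) ; step-inv = spin-inv }

    spins-respect : ∀ {γ} → Sym γ → ∀ {u u′} → R γ u u′ → ∀ j → run γ spin u j ≡ run γ spin u′ j
    spins-respect = Small.respects Spins (allFin 3) 3≤b₀ ∈-allFin

  letter-nontrivial : ∀ {γ} → Sym γ → ∀ {e} → e ∈ γ → ∀ w → ¬ R γ (w ∷ʳ e) w
  letter-nontrivial {γ} sγ {e} e∈ w r =
    one≢zero (trans (sym (trans (step-in-∈ {e = e} e∈ spin zero) (spin-e₀ zero)))
      (spins-respect sγ {e ∷ []} {[]} (R-cancelˡ sγ w (R-trans r (R-≡ (sym (Listₚ.++-identityʳ w))))) zero))
    where
      open Letter e
      one≢zero : ¬ (_≡_ {A = Fin 3} (suc zero) zero)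
      one≢zero ()

  letters-distinct : ∀ {e e′} → R ⊤ (e ∷ []) (e′ ∷ []) → e ≡ e′
  letters-distinct {e} {e′} r with e′ ≟ e
  ... | yes p = sym p
  ... | no ¬p = ⊥-elim (by (e′ ≟ e ⁻¹))
    where
      open Letter e
      eq : suc zero ≡ spin e′ zero
      eq = trans (sym (trans (step-in-∈ {e = e} ∈⊤ spin zero) (spin-e₀ zero)))
             (trans (spins-respect sym-⊤ {e ∷ []} {e′ ∷ []} r zero) (step-in-∈ {e = e′} ∈⊤ spin zero))
      1≢2 : ¬ (_≡_ {A = Fin 3} (suc zero) (suc (suc zero)))
      1≢2 ()
      1≢0 : ¬ (_≡_ {A = Fin 3} (suc zero) zero)
      1≢0 ()
      by : Dec (e′ ≡ e ⁻¹) → ⊥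
      by (yes p) = 1≢2 (trans eq (trans (cong (λ x → spin x zero) p) (spin-e₀⁻¹ zero)))
      by (no ¬q) = 1≢0 (trans eq (spin-other ¬p ¬q zero))

  pieceBound : Subset nE → ℕ
  pieceBound γ = suc (count (rank γ))

  ≤orbitBound : ∀ {n} γ → n ≤ D → pieceBound γ ^ n ≤ orbitBound (rank γ)
  ≤orbitBound γ n≤D = ℕₚ.≤-trans (ℕₚ.^-monoʳ-≤ (pieceBound γ) n≤D) (ℕₚ.≤-trans (ℕₚ.m≤m*n _ _) (ℕₚ.m≤n+m _ b₀))

  ⊂-∩ : ∀ {γ α} → ¬ (γ ⊆ α) → γ ∩ α ⊂ γ
  ⊂-∩ {γ} {α} γ⊈α with Finₚ.any? (λ e → (e ∈? γ) ×-dec ¬? (e ∈? α))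
  ... | yes (e , p , q) = ∩⊆ˡ {γ} {α} , e , p , λ r → q (∩⊆ʳ {γ} {α} r)
  ... | no ¬p = ⊥-elim (γ⊈α λ {e} p → decidable-stable (e ∈? α) λ q → ¬p (e , p , q))

  module _ {α} (sα : Sym α) where

    -- The Cayley graph of the group of words modulo `R α`, with letters acting by multiplication on
    -- the right. By `R-∉` the letters outside `α` act trivially.
    Piece : FSet
    Piece = record
      { Carrier = List E ; _≈_ = R α ; ≈-refl = R-refl ; ≈-sym = R-sym ; ≈-trans = R-trans ; _≈?_ = R? α
      ; step = λ e g → g ∷ʳ e ; step-cong = λ e r → R-++ʳ (e ∷ []) r
      ; step-inv = λ e g → R-trans (R-≡ (Listₚ.++-assoc g (e ∷ []) _))
                             (R-trans (R-++ˡ g (R-cancel sα e)) (R-≡ (Listₚ.++-identityʳ g))) }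

    open FSet Piece using (_·[_]_)
    open Orbits Piece

    piece-run : ∀ γ u g → g ·[ γ ] u ≡ g ++ u ↾ γ
    piece-run γ []      g = sym (Listₚ.++-identityʳ g)
    piece-run γ (e ∷ u) g with e ∈? γ
    ... | yes _ = trans (piece-run γ u (g ∷ʳ e)) (Listₚ.++-assoc g (e ∷ []) _)
    ... | no  _ = piece-run γ u g

    piece-killed : ∀ {γ} → Sym γ → γ ⊆ α → ∀ g → Killed γ g
    piece-killed {γ} sγ γ⊆α g u u′ r =
      R-trans (R-≡ (piece-run γ u g))
        (R-trans (R-++ˡ g (R-cons sγ γ⊆α (↾-⊩ γ u) (↾-⊩ γ u′) (R-restrict r))) (R-≡ (sym (piece-run γ u′ g))))

    -- Modulo `R α` only the letters in `γ ∩ α` count. As `γ ⊈ α`, this is a proper subset of `γ`,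
    -- and `rank γ` was chosen to bound its index.
    shorten-in : ∀ {γ} → Sym γ → ¬ (γ ⊆ α) → ∀ u → γ ⊩ u →
                 ∃ λ u′ → length u′ ≤ rank γ × (γ ∩ α) ⊩ u′ × R α u u′
    shorten-in {γ} sγ γ⊈α u γ⊩u =
      let u′ , l , p , r = R-shorten {γ ∩ α} (γ ∩ α) (u ↾ α) in-∩
      in u′ , ℕₚ.≤-trans l (index-rank (⊂-∩ γ⊈α)) , p
         , R-trans (R-sym (R-↾ α u)) (R-cons (sym-∩ sγ sα) (∩⊆ʳ {γ} {α}) in-∩ p r)
      where
        in-∩ : (γ ∩ α) ⊩ u ↾ α
        in-∩ = ⊩-∩ (⊩-↾ α γ⊩u) (↾-⊩ α u)

    piece-covered : ∀ {γ} → Sym γ → ¬ (γ ⊆ α) → ∀ g → Covered γ (count (rank γ)) g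
    piece-covered {γ} sγ γ⊈α g =
      map (g ++_) (words nE (rank γ)) , ℕₚ.≤-reflexive (Listₚ.length-map (g ++_) (words nE (rank γ))) , λ u →
        let u′ , l , _ , r = shorten-in sγ γ⊈α (u ↾ γ) (↾-⊩ γ u)
        in lose (∈-map⁺ (g ++_) (∈-words _ u′ l)) (R-trans (R-≡ (piece-run γ u g)) (R-++ˡ g r))

    private
      dichotomy : Dichotomy
      dichotomy γ sγ g with γ ⊆? α
      ... | yes γ⊆α = inj₂ (piece-killed sγ γ⊆α g)
      ... | no γ⊈α =
        let xs , l , c = piece-covered sγ γ⊈α g
        in inj₁ (xs , ℕₚ.≤-trans l (ℕₚ.≤-trans (ℕₚ.n≤1+n _) (ℕₚ.≤-trans (ℕₚ.≤-reflexive (sym (ℕₚ.^-identityʳ _))) (≤orbitBound γ 1≤D))) , c)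

    -- Erasing the letters outside α preserves R, since Piece α is an action in which they do nothing.
    R-retract : ∀ {γ} → Sym γ → α ⊆ γ → ∀ {u u′} → R γ u u′ → R α u u′
    R-retract {γ} sγ α⊆γ {u} {u′} r =
      R-trans (R-sym (outside u)) (R-trans
        (R-trans (R-≡ (sym (piece-run γ u []))) (R-trans (all-killed dichotomy γ sγ [] u u′ r) (R-≡ (piece-run γ u′ []))))
        (outside u′))
      where
        ↾-twice : ∀ w → (w ↾ γ) ↾ α ≡ w ↾ α
        ↾-twice []      = refl
        ↾-twice (e ∷ w) with e ∈? γ
        ... | no ¬p with e ∈? α
        ...   | yes q = ⊥-elim (¬p (α⊆γ q))
        ...   | no _  = ↾-twice w
        ↾-twice (e ∷ w) | yes _ with e ∈? α
        ...   | yes _ = cong (e ∷_) (↾-twice w)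
        ...   | no _  = ↾-twice w
        outside : ∀ w → R α (w ↾ γ) w
        outside w = R-trans (R-sym (R-↾ α (w ↾ γ))) (R-trans (R-≡ (↾-twice w)) (R-↾ α w))

  -- Erasing the letters outside `α` changes nothing in `x`, and turns `y` into a word over `α ∩ β`
  -- that is still related to `x`. In group terms, the subgroups of `α` and `β` meet in that of
  -- `α ∩ β`.
  R-meet : ∀ {α β γ} → Sym α → Sym γ → α ⊆ γ → ∀ {x y} → α ⊩ x → β ⊩ y → R γ x y →
           ∃ λ z → (α ∩ β) ⊩ z × R γ x z
  R-meet {α} sα sγ α⊆γ {x} {y} px py r =
    y ↾ α , ⊩-∩ (↾-⊩ α y) (⊩-↾ α py)
    , R-cons sα α⊆γ px (↾-⊩ α y) (R-trans (R-retract sα sγ α⊆γ r) (R-sym (R-↾ α y)))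

  abstract
    R-word? : ∀ δ → Sym δ → {P : List E → Set} → (∀ x → Dec (P x)) →
              (∀ {x y} → δ ⊩ x → δ ⊩ y → R δ x y → P x → P y) → Dec (∃ λ x → δ ⊩ x × P x)
    R-word? δ sδ P? resp = short-word? (index δ) (λ x → (δ ⊩? x) ×-dec P? x) λ x (p , q) →
      let x′ , l , p′ , r = R-shorten δ x p in x′ , l , p′ , resp p p′ r q

-- Gluing cosets into chains.

module Rays (I : Pattern) (b₀ D : ℕ) (1≤D : 1 ≤ D) (3≤b₀ : 3 ≤ b₀) (nS≤b₀ : Pattern.nS I ≤ b₀) where
  open Letters I
  open System I b₀ D
  open Killing I b₀ D
  open Pieces I b₀ D 1≤D 3≤b₀ nS≤b₀

  run-induction : {A : Set} {γ : Subset nE} {st : E → A → A} (P : A → Set) →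
                  (∀ e a → e ∈ γ → P a → P (st e a)) → ∀ u a → P a → P (run γ st u a)
  run-induction         P h []      a p = p
  run-induction {γ = γ} P h (e ∷ u) a p with e ∈? γ
  ... | yes q = run-induction P h u _ (h e a q p)
  ... | no _  = run-induction P h u a p

  -- A chain of n cosets beginning with a coset of α; Zone describes where the first one is glued to the second one.
  record Ray (α : Subset nE) (n : ℕ) : Set₁ where
    field
      fset : FSet
    open FSet fset public
    open Orbits fset public using (Covered; Killed)
    field
      elems     : List Carrier
      complete  : ∀ q → Any (q ≈_) elems
      base      : List E → Carrier
      base-cong : ∀ {x y} → R α x y → base x ≈ base y
      base-inj  : ∀ {x y} → base x ≈ base y → R α x y
      base-step : ∀ {e} → e ∈ α → ∀ x → step e (base x) ≈ base (x ∷ʳ e)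
      Zone      : List E → Set
      base-fix  : ∀ {e} → e ∉ α → ∀ x → ¬ Zone x → step e (base x) ≈ base x

    -- A γ-orbit inside one coset of the chain, for an alphabet containing γ.
    Confined : Subset nE → Carrier → Set
    Confined γ q = Killed γ q × (∀ u e → e ∈ γ → ¬ (q ·[ γ ] (u ∷ʳ e) ≈ q ·[ γ ] u))
                 × (∀ u x → q ·[ γ ] u ≈ base x → γ ⊆ α ⊎ Zone x)

    field
      dichotomy : ∀ γ → Sym γ → ∀ q → Covered γ (pieceBound γ ^ n) q ⊎ Confined γ q

    base-run : ∀ {γ y} → α ⊩ y → γ ⊩ y → ∀ x → base x ·[ γ ] y ≈ base (x ++ y)
    base-run []       []       x = base-cong (R-≡ (sym (Listₚ.++-identityʳ x)))
    base-run {γ} {e ∷ y} (p ∷ ps) (q ∷ qs) x =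
      ≈-trans (run-cong γ y (≈-trans (≡⇒≈ (step-in-∈ q step _)) (base-step p x)))
        (≈-trans (base-run ps qs (x ∷ʳ e)) (base-cong (R-≡ (Listₚ.++-assoc x (e ∷ []) y))))

  single : ∀ {α} → Sym α → Ray α 1
  single {α} sα = record
    { fset = Piece sα
    ; elems = words nE (index α)
    ; complete = λ w → let w′ , l , _ , r = R-shorten α w ⊩⊤ in lose (∈-words _ w′ l) r
    ; base = id ; base-cong = id ; base-inj = id
    ; base-step = λ _ _ → R-refl
    ; Zone = λ _ → ⊥
    ; base-fix = λ e∉ x _ → R-∉ e∉ x
    ; dichotomy = dich }
    where
      open FSet (Piece sα) using (_·[_]_; run-snoc)
      dich : ∀ γ → Sym γ → ∀ q → Orbits.Covered (Piece sα) γ (pieceBound γ ^ 1) q ⊎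
             (Orbits.Killed (Piece sα) γ q × (∀ u e → e ∈ γ → ¬ R α (q ·[ γ ] (u ∷ʳ e)) (q ·[ γ ] u))
              × (∀ u x → R α (q ·[ γ ] u) x → γ ⊆ α ⊎ ⊥))
      dich γ sγ q with γ ⊆? α
      ... | yes γ⊆α = inj₂ (piece-killed sα sγ γ⊆α q
            , (λ u e p r → letter-nontrivial sα (γ⊆α p) (q ·[ γ ] u) (R-trans (R-≡ (sym (run-snoc γ u e q p))) r))
            , λ _ _ _ → inj₁ γ⊆α)
      ... | no γ⊈α = let xs , l , c = piece-covered sα sγ γ⊈α q
            in inj₁ (xs , ℕₚ.≤-trans l (ℕₚ.≤-trans (ℕₚ.n≤1+n _) (ℕₚ.≤-reflexive (sym (ℕₚ.^-identityʳ _)))) , c)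

  -- The coset of α and the chain Q, glued along the (α ∩ β)-cosets of a and of base [].
  module Glue {α β n} (sα : Sym α) (sβ : Sym β) (a : List E) (Q : Ray β n)
              (separated : ∀ x → (α ∩ β) ⊩ x → ¬ Ray.Zone Q x) where
    module Q = Ray Q

    δ : Subset nE
    δ = α ∩ β

    sδ : Sym δ
    sδ = sym-∩ sα sβ

    δ⊆α : δ ⊆ α
    δ⊆α = ∩⊆ˡ {α} {β}

    δ⊆β : δ ⊆ β
    δ⊆β = ∩⊆ʳ {α} {β}

    -- On words over `δ` both relations coincide with `R δ`, by erasure in one direction and
    -- `R-cons` in the other. Hence the two cosets to be glued are copies of each other.
    α⇒β : ∀ {x y} → δ ⊩ x → δ ⊩ y → R α x y → R β x y
    α⇒β p q r = R-cons sδ δ⊆β p q (R-retract sδ sα δ⊆α r)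

    β⇒α : ∀ {x y} → δ ⊩ x → δ ⊩ y → R β x y → R α x y
    β⇒α p q r = R-cons sδ δ⊆α p q (R-retract sδ sβ δ⊆β r)

    Link : List E → Q.Carrier → Set
    Link g q = ∃ λ x → δ ⊩ x × R α g (a ++ x) × q Q.≈ Q.base x

    ZoneP : List E → Set
    ZoneP g = ∃ λ x → δ ⊩ x × R α g (a ++ x)

    ZoneQ : Q.Carrier → Set
    ZoneQ q = ∃ λ x → δ ⊩ x × q Q.≈ Q.base x

    δ-resp : ∀ {x y} → δ ⊩ x → δ ⊩ y → R δ x y → R α x y × Q.base x Q.≈ Q.base y
    δ-resp p q r = R-cons sδ δ⊆α p q r , Q.base-cong (R-cons sδ δ⊆β p q r)

    abstract
      link? : ∀ g q → Dec (Link g q)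
      link? g q = R-word? δ sδ (λ x → R? α g (a ++ x) ×-dec (q Q.≈? Q.base x))
        λ p p′ r (s , t) → let rα , rβ = δ-resp p p′ r in R-trans s (R-++ˡ a rα) , Q.≈-trans t rβ

      zoneP? : ∀ g → Dec (ZoneP g)
      zoneP? g = R-word? δ sδ (λ x → R? α g (a ++ x)) λ p p′ r s → R-trans s (R-++ˡ a (proj₁ (δ-resp p p′ r)))

      zoneQ? : ∀ q → Dec (ZoneQ q)
      zoneQ? q = R-word? δ sδ (λ x → q Q.≈? Q.base x) λ p p′ r s → Q.≈-trans s (proj₂ (δ-resp p p′ r))

    zoneQ-unique : ∀ {x y q} → δ ⊩ x → δ ⊩ y → q Q.≈ Q.base x → q Q.≈ Q.base y → R α x y
    zoneQ-unique p p′ s t = β⇒α p p′ (Q.base-inj (Q.≈-trans (Q.≈-sym s) t))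

    C : Set
    C = List E ⊎ Q.Carrier

    infix 4 _≈ᴳ_
    -- Already transitive, because the links match classes of the two sides one to one
    -- (`zoneQ-unique` and `α⇒β`).
    data _≈ᴳ_ : C → C → Set where
      pp : ∀ {g h} → R α g h → inj₁ g ≈ᴳ inj₁ h
      pq : ∀ {g q} → Link g q → inj₁ g ≈ᴳ inj₂ q
      qp : ∀ {g q} → Link g q → inj₂ q ≈ᴳ inj₁ g
      qq : ∀ {p q} → p Q.≈ q → inj₂ p ≈ᴳ inj₂ q

    reflᴳ : ∀ {x} → x ≈ᴳ x
    reflᴳ {inj₁ _} = pp R-refl
    reflᴳ {inj₂ _} = qq Q.≈-refl

    symᴳ : ∀ {x y} → x ≈ᴳ y → y ≈ᴳ x
    symᴳ (pp r) = pp (R-sym r)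
    symᴳ (pq r) = qp r
    symᴳ (qp r) = pq r
    symᴳ (qq r) = qq (Q.≈-sym r)

    transᴳ : ∀ {x y z} → x ≈ᴳ y → y ≈ᴳ z → x ≈ᴳ z
    transᴳ (pp r) (pp s) = pp (R-trans r s)
    transᴳ (pp r) (pq (x , p , s , t)) = pq (x , p , R-trans r s , t)
    transᴳ (pq (x , p , r , t)) (qp (y , p′ , r′ , t′)) =
      pp (R-trans r (R-trans (R-++ˡ a (zoneQ-unique p p′ t t′)) (R-sym r′)))
    transᴳ (pq (x , p , r , t)) (qq s) = pq (x , p , r , Q.≈-trans (Q.≈-sym s) t)
    transᴳ (qp (x , p , r , t)) (pp s) = qp (x , p , R-trans (R-sym s) r , t)
    transᴳ (qp (x , p , r , t)) (pq (y , p′ , r′ , t′)) =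
      qq (Q.≈-trans t (Q.≈-trans (Q.base-cong (α⇒β p p′ (R-cancelˡ sα a (R-trans (R-sym r) r′)))) (Q.≈-sym t′)))
    transᴳ (qq s) (qp (x , p , r , t)) = qp (x , p , r , Q.≈-trans s t)
    transᴳ (qq r) (qq s) = qq (Q.≈-trans r s)

    decᴳ : ∀ x y → Dec (x ≈ᴳ y)
    decᴳ (inj₁ g) (inj₁ h) = map′ pp (λ { (pp r) → r }) (R? α g h)
    decᴳ (inj₁ g) (inj₂ q) = map′ pq (λ { (pq r) → r }) (link? g q)
    decᴳ (inj₂ q) (inj₁ g) = map′ qp (λ { (qp r) → r }) (link? g q)
    decᴳ (inj₂ p) (inj₂ q) = map′ qq (λ { (qq r) → r }) (p Q.≈? q)

    ≡⇒ᴳ : ∀ {x y} → x ≡ y → x ≈ᴳ y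
    ≡⇒ᴳ refl = reflᴳ

    -- At a glued point the letters of `α` act in the first coset and all others in `Q`. On letters
    -- of both alphabets the two sides agree; a letter of `α` outside `β` fixes the point in `Q`, by
    -- `separated` and `base-fix`, so no movement of `Q` is overridden.
    stepᴳ : E → C → C
    stepᴳ e (inj₁ g) with e ∈? α | zoneP? g
    ... | yes _ | _           = inj₁ (g ∷ʳ e)
    ... | no _  | yes (x , _) = inj₂ (Q.step e (Q.base x))
    ... | no _  | no _        = inj₁ g
    stepᴳ e (inj₂ q) with e ∈? α | zoneQ? q
    ... | yes _ | yes (x , _) = inj₁ (a ++ (x ∷ʳ e))
    ... | yes _ | no _        = inj₂ (Q.step e q)
    ... | no _  | _           = inj₂ (Q.step e q)

    stepP-in : ∀ {e} → e ∈ α → ∀ g → stepᴳ e (inj₁ g) ≡ inj₁ (g ∷ʳ e)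
    stepP-in {e} p g with e ∈? α
    ... | yes _ = refl
    ... | no ¬p = ⊥-elim (¬p p)

    stepP-zone : ∀ {e} → e ∉ α → ∀ {g x} → δ ⊩ x → R α g (a ++ x) → stepᴳ e (inj₁ g) ≈ᴳ inj₂ (Q.step e (Q.base x))
    stepP-zone {e} ¬p {g} {x} px r with e ∈? α | zoneP? g
    ... | yes p | _ = ⊥-elim (¬p p)
    ... | no _  | yes (y , py , s) = qq (Q.step-cong e (Q.base-cong (α⇒β py px (R-cancelˡ sα a (R-trans (R-sym s) r)))))
    ... | no _  | no ¬z = ⊥-elim (¬z (x , px , r))

    stepP-out : ∀ {e} → e ∉ α → ∀ g → ¬ ZoneP g → stepᴳ e (inj₁ g) ≡ inj₁ g
    stepP-out {e} ¬p g ¬z with e ∈? α | zoneP? g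
    ... | yes p | _     = ⊥-elim (¬p p)
    ... | no _  | yes z = ⊥-elim (¬z z)
    ... | no _  | no _  = refl

    stepQ-out : ∀ {e} → e ∉ α → ∀ q → stepᴳ e (inj₂ q) ≡ inj₂ (Q.step e q)
    stepQ-out {e} ¬p q with e ∈? α | zoneQ? q
    ... | yes p | _ = ⊥-elim (¬p p)
    ... | no _  | _ = refl

    stepQ-zone : ∀ {e} → e ∈ α → ∀ {q x} → δ ⊩ x → q Q.≈ Q.base x → stepᴳ e (inj₂ q) ≈ᴳ inj₁ (a ++ (x ∷ʳ e))
    stepQ-zone {e} p {q} {x} px r with e ∈? α | zoneQ? q
    ... | no ¬p | _ = ⊥-elim (¬p p)
    ... | yes _ | yes (y , py , s) = pp (R-++ˡ a (R-++ʳ (e ∷ []) (zoneQ-unique py px s r)))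
    ... | yes _ | no ¬z = ⊥-elim (¬z (x , px , r))

    stepQ-free : ∀ {e} → ∀ q → ¬ ZoneQ q → stepᴳ e (inj₂ q) ≡ inj₂ (Q.step e q)
    stepQ-free {e} q ¬z with e ∈? α | zoneQ? q
    ... | yes _ | yes z = ⊥-elim (¬z z)
    ... | yes _ | no _  = refl
    ... | no _  | _     = refl

    -- If `e` led into the zone, its inverse would lead out. At a zone point, however, that inverse
    -- either multiplies by a letter of `α ∩ β` or lies outside `β` and fixes the point.
    zoneQ-closed : ∀ {e} → e ∈ α → ∀ {q} → ¬ ZoneQ q → ¬ ZoneQ (Q.step e q)
    zoneQ-closed {e} p {q} ¬z (x , px , r) with e ∈? β
    ... | yes p′ = ¬z (x ∷ʳ (e ⁻¹) , Allₚ.∷ʳ⁺ px (sδ e (x∈p∩q⁺ (p , p′))) ,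
            Q.≈-trans back (Q.base-step (sβ e p′) x))
      where back = Q.≈-trans (Q.≈-sym (Q.step-inv e q)) (Q.step-cong (e ⁻¹) r)
    ... | no ¬p′ = ¬z (x , px , Q.≈-trans back (Q.base-fix (sym-∉ sβ ¬p′) x (separated x px)))
      where back = Q.≈-trans (Q.≈-sym (Q.step-inv e q)) (Q.step-cong (e ⁻¹) r)

    stepᴳ-cong₁₂ : ∀ e {g q} → Link g q → stepᴳ e (inj₁ g) ≈ᴳ stepᴳ e (inj₂ q)
    stepᴳ-cong₁₂ e {g} {q} (x , px , r , s) = by (e ∈? α)
      where
      by : Dec (e ∈ α) → stepᴳ e (inj₁ g) ≈ᴳ stepᴳ e (inj₂ q)
      by (yes p) = transᴳ (≡⇒ᴳ (stepP-in p g)) (transᴳ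
            (pp (R-trans (R-++ʳ (e ∷ []) r) (R-≡ (Listₚ.++-assoc a x (e ∷ []))))) (symᴳ (stepQ-zone p px s)))
      by (no ¬p) = transᴳ (stepP-zone ¬p px r) (transᴳ (qq (Q.step-cong e (Q.≈-sym s))) (≡⇒ᴳ (sym (stepQ-out ¬p q))))

    stepᴳ-cong : ∀ e {x y} → x ≈ᴳ y → stepᴳ e x ≈ᴳ stepᴳ e y
    stepᴳ-cong e (pp {g} {h} r) = by (e ∈? α) (zoneP? g)
      where
        by : Dec (e ∈ α) → Dec (ZoneP g) → stepᴳ e (inj₁ g) ≈ᴳ stepᴳ e (inj₁ h)
        by (yes p) _ = transᴳ (≡⇒ᴳ (stepP-in p g)) (transᴳ (pp (R-++ʳ (e ∷ []) r)) (≡⇒ᴳ (sym (stepP-in p h))))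
        by (no ¬p) (yes (x , px , s)) = transᴳ (stepP-zone ¬p px s) (symᴳ (stepP-zone ¬p px (R-trans (R-sym r) s)))
        by (no ¬p) (no ¬z) = transᴳ (≡⇒ᴳ (stepP-out ¬p g ¬z)) (transᴳ (pp r)
          (≡⇒ᴳ (sym (stepP-out ¬p h λ (x , px , s) → ¬z (x , px , R-trans r s)))))
    stepᴳ-cong e (pq r) = stepᴳ-cong₁₂ e r
    stepᴳ-cong e (qp r) = symᴳ (stepᴳ-cong₁₂ e r)
    stepᴳ-cong e (qq {p} {q} r) = by (e ∈? α) (zoneQ? p)
      where
        by : Dec (e ∈ α) → Dec (ZoneQ p) → stepᴳ e (inj₂ p) ≈ᴳ stepᴳ e (inj₂ q)
        by (no ¬p) _ = transᴳ (≡⇒ᴳ (stepQ-out ¬p p)) (transᴳ (qq (Q.step-cong e r)) (≡⇒ᴳ (sym (stepQ-out ¬p q))))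
        by (yes e∈) (yes (x , px , s)) = transᴳ (stepQ-zone e∈ px s) (symᴳ (stepQ-zone e∈ px (Q.≈-trans (Q.≈-sym r) s)))
        by (yes e∈) (no ¬z) = transᴳ (≡⇒ᴳ (stepQ-free p ¬z)) (transᴳ (qq (Q.step-cong e r))
          (≡⇒ᴳ (sym (stepQ-free q λ (x , px , s) → ¬z (x , px , Q.≈-trans r s)))))

    append-inv : ∀ e g → R α ((g ∷ʳ e) ∷ʳ (e ⁻¹)) g
    append-inv = FSet.step-inv (Piece sα)

    stepᴳ-inv : ∀ e x → stepᴳ (e ⁻¹) (stepᴳ e x) ≈ᴳ x
    stepᴳ-inv e (inj₁ g) = by (e ∈? α) (zoneP? g)
      where
        by : Dec (e ∈ α) → Dec (ZoneP g) → stepᴳ (e ⁻¹) (stepᴳ e (inj₁ g)) ≈ᴳ inj₁ g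
        by (yes p) _ = transᴳ (≡⇒ᴳ (trans (cong (stepᴳ (e ⁻¹)) (stepP-in p g)) (stepP-in (sα e p) _))) (pp (append-inv e g))
        by (no ¬p) (yes (x , px , s)) = transᴳ (stepᴳ-cong (e ⁻¹) (stepP-zone ¬p px s))
          (transᴳ (≡⇒ᴳ (stepQ-out (sym-∉ sα ¬p) _)) (qp (x , px , s , Q.step-inv e (Q.base x))))
        by (no ¬p) (no ¬z) = ≡⇒ᴳ (trans (cong (stepᴳ (e ⁻¹)) (stepP-out ¬p g ¬z)) (stepP-out (sym-∉ sα ¬p) g ¬z))
    stepᴳ-inv e (inj₂ q) = by (e ∈? α) (zoneQ? q)
      where
        by : Dec (e ∈ α) → Dec (ZoneQ q) → stepᴳ (e ⁻¹) (stepᴳ e (inj₂ q)) ≈ᴳ inj₂ q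
        by (no ¬p) _ = transᴳ (≡⇒ᴳ (trans (cong (stepᴳ (e ⁻¹)) (stepQ-out ¬p q)) (stepQ-out (sym-∉ sα ¬p) _))) (qq (Q.step-inv e q))
        by (yes p) (yes (x , px , s)) = transᴳ (stepᴳ-cong (e ⁻¹) (stepQ-zone p px s))
          (transᴳ (≡⇒ᴳ (stepP-in (sα e p) _))
            (pq (x , px , R-trans (R-++ʳ ((e ⁻¹) ∷ []) (R-≡ (sym (Listₚ.++-assoc a x (e ∷ []))))) (append-inv e (a ++ x)) , s)))
        by (yes p) (no ¬z) = transᴳ (≡⇒ᴳ (trans (cong (stepᴳ (e ⁻¹)) (stepQ-free q ¬z)) (stepQ-free _ (zoneQ-closed p ¬z)))) (qq (Q.step-inv e q))

    glued : FSet
    glued = record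
      { Carrier = C ; _≈_ = _≈ᴳ_ ; ≈-refl = reflᴳ ; ≈-sym = symᴳ ; ≈-trans = transᴳ
      ; _≈?_ = decᴳ ; step = stepᴳ ; step-cong = stepᴳ-cong ; step-inv = stepᴳ-inv }

    module G = FSet glued
    open Orbits glued using () renaming (Covered to Coveredᴳ; Killed to Killedᴳ)

    Confinedᴳ : Subset nE → C → Set
    Confinedᴳ γ c = Killedᴳ γ c × (∀ u e → e ∈ γ → ¬ (c G.·[ γ ] (u ∷ʳ e) ≈ᴳ c G.·[ γ ] u))
                  × (∀ u x → c G.·[ γ ] u ≈ᴳ inj₁ x → γ ⊆ α ⊎ ZoneP x)

    along : ∀ {γ c d} v → c ≈ᴳ d G.·[ γ ] v → ∀ u → c G.·[ γ ] u ≈ᴳ d G.·[ γ ] (v ++ u)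
    along {γ} {c} {d} v p u = transᴳ (G.run-cong γ u p) (≡⇒ᴳ (sym (run-++ γ stepᴳ v u d)))

    covered-along : ∀ {γ n c d} v → c ≈ᴳ d G.·[ γ ] v → Coveredᴳ γ n d → Coveredᴳ γ n c
    covered-along v p (xs , l , cov) = xs , l , λ u → Any.map (transᴳ (along v p u)) (cov (v ++ u))

    confined-along : ∀ {γ c d} v → c ≈ᴳ d G.·[ γ ] v → Confinedᴳ γ d → Confinedᴳ γ c
    confined-along {γ} {c} {d} v p (k , m , i) =
      (λ u u′ r → transᴳ (along v p u) (transᴳ (k _ _ (R-++ˡ v r)) (symᴳ (along v p u′))))
      , (λ u e e∈ q → m (v ++ u) e e∈ (transᴳ (≡⇒ᴳ (cong (d G.·[ γ ]_) (Listₚ.++-assoc v u (e ∷ []))))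
                        (transᴳ (symᴳ (along v p (u ∷ʳ e))) (transᴳ q (along v p u)))))
      , (λ u x q → i (v ++ u) x (transᴳ (symᴳ (along v p u)) q))

    glue-run : ∀ {γ} → γ ⊆ α → ∀ u g → inj₁ g G.·[ γ ] u ≡ inj₁ (FSet._·[_]_ (Piece sα) g γ u)
    glue-run γ⊆α []      g = refl
    glue-run {γ} γ⊆α (e ∷ u) g with e ∈? γ
    ... | yes p = trans (cong (G._·[ γ ] u) (stepP-in (γ⊆α p) g)) (glue-run γ⊆α u (g ∷ʳ e))
    ... | no _  = glue-run γ⊆α u g

    confined-P : ∀ {γ} → Sym γ → γ ⊆ α → ∀ g → Confinedᴳ γ (inj₁ g)
    confined-P {γ} sγ γ⊆α g =
      (λ u u′ r → transᴳ (≡⇒ᴳ (glue-run γ⊆α u g)) (transᴳ (pp (piece-killed sα sγ γ⊆α g u u′ r)) (≡⇒ᴳ (sym (glue-run γ⊆α u′ g)))))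
      , (λ u e e∈ p → moving u e e∈ (transᴳ (≡⇒ᴳ (sym (glue-run γ⊆α (u ∷ʳ e) g))) (transᴳ p (≡⇒ᴳ (glue-run γ⊆α u g)))))
      , (λ _ _ _ → inj₁ γ⊆α)
      where
        open FSet (Piece sα) using (_·[_]_; run-snoc)
        moving : ∀ u e → e ∈ γ → ¬ (_≈ᴳ_ (inj₁ (g ·[ γ ] (u ∷ʳ e))) (inj₁ (g ·[ γ ] u)))
        moving u e e∈ (pp r) = letter-nontrivial sα (γ⊆α e∈) (g ·[ γ ] u) (R-trans (R-≡ (sym (run-snoc γ u e g e∈))) r)

    -- If the orbit hits the zone, `separated` leaves `γ ⊆ β` as the only alternative. The letters
    -- of `γ` in `α` then lie in `δ`, and acting in the first coset gives the same point as acting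
    -- in `Q`.
    confined-Q : ∀ {γ} → ∀ q → Q.Confined γ q → Confinedᴳ γ (inj₂ q)
    confined-Q {γ} q (k , m , i) =
      (λ u u′ r → transᴳ (lift u) (transᴳ (qq (k u u′ r)) (symᴳ (lift u′))))
      , (λ u e e∈ p → moving u e e∈ (transᴳ (symᴳ (lift (u ∷ʳ e))) (transᴳ p (lift u))))
      , (λ u x p → inj₂ (zone u x (transᴳ (symᴳ (lift u)) p)))
      where
        lift-step : ∀ u e → e ∈ γ → stepᴳ e (inj₂ (q Q.·[ γ ] u)) ≈ᴳ inj₂ (Q.step e (q Q.·[ γ ] u))
        lift-step u e e∈γ = by (e ∈? α) (zoneQ? q′)
          where
            q′ = q Q.·[ γ ] u
            by : Dec (e ∈ α) → Dec (ZoneQ q′) → stepᴳ e (inj₂ q′) ≈ᴳ inj₂ (Q.step e q′)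
            by (no ¬p) _ = ≡⇒ᴳ (stepQ-out ¬p q′)
            by (yes _) (no ¬z) = ≡⇒ᴳ (stepQ-free q′ ¬z)
            by (yes p) (yes (x , px , s)) with i u x s
            ... | inj₂ z   = ⊥-elim (separated x px z)
            ... | inj₁ γ⊆β = transᴳ (stepQ-zone p px s)
                  (pq (x ∷ʳ e , Allₚ.∷ʳ⁺ px (x∈p∩q⁺ (p , γ⊆β e∈γ)) , R-refl
                      , Q.≈-trans (Q.step-cong e s) (Q.base-step (γ⊆β e∈γ) x)))
        lift-from : ∀ w u c → c ≈ᴳ inj₂ (q Q.·[ γ ] u) → c G.·[ γ ] w ≈ᴳ inj₂ (q Q.·[ γ ] (u ++ w))
        lift-from []      u c p = transᴳ p (≡⇒ᴳ (cong (λ w → inj₂ (q Q.·[ γ ] w)) (sym (Listₚ.++-identityʳ u))))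
        lift-from (e ∷ w) u c p with e ∈? γ
        ... | yes e∈ = transᴳ (lift-from w (u ∷ʳ e) (stepᴳ e c)
                (transᴳ (stepᴳ-cong e p) (transᴳ (lift-step u e e∈) (≡⇒ᴳ (cong inj₂ (sym (Q.run-snoc γ u e q e∈)))))))
                (≡⇒ᴳ (cong (λ w → inj₂ (q Q.·[ γ ] w)) (Listₚ.++-assoc u (e ∷ []) w)))
        ... | no e∉ = transᴳ (lift-from w u c p) (≡⇒ᴳ (cong inj₂ (trans (run-++ γ Q.step u w q)
                (sym (trans (run-++ γ Q.step u (e ∷ w) q) (cong (run γ Q.step w) (step-in-∉ e∉ Q.step _)))))))
        lift : ∀ u → inj₂ q G.·[ γ ] u ≈ᴳ inj₂ (q Q.·[ γ ] u)
        lift u = lift-from u [] (inj₂ q) reflᴳ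
        moving : ∀ u e → e ∈ γ → ¬ (_≈ᴳ_ (inj₂ (q Q.·[ γ ] (u ∷ʳ e))) (inj₂ (q Q.·[ γ ] u)))
        moving u e e∈ (qq r) = m u e e∈ r
        zone : ∀ u x → inj₂ (q Q.·[ γ ] u) ≈ᴳ inj₁ x → ZoneP x
        zone u x (qp (y , py , r , _)) = y , py , r

    pieceBound-suc : ∀ {γ l} → l ≤ pieceBound γ ^ n → l + l * count (rank γ) ≤ pieceBound γ ^ suc n
    pieceBound-suc {γ} {l} p = ℕₚ.≤-trans (ℕₚ.≤-reflexive (sym (ℕₚ.*-suc l (count (rank γ)))))
      (ℕₚ.≤-trans (ℕₚ.*-monoˡ-≤ (pieceBound γ) p) (ℕₚ.≤-reflexive (ℕₚ.*-comm (pieceBound γ ^ n) (pieceBound γ))))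

    covered-Q-free : ∀ {γ m} → γ ⊆ α → ∀ q → ¬ ZoneQ q → Q.Covered γ m q → Coveredᴳ γ m (inj₂ q)
    covered-Q-free {γ} γ⊆α q ¬z (xs , l , cov) =
      map inj₂ xs , ℕₚ.≤-trans (ℕₚ.≤-reflexive (Listₚ.length-map inj₂ xs)) l
      , λ u → Anyₚ.map⁺ (Any.map (λ p → transᴳ (≡⇒ᴳ (run-free u q ¬z)) (qq p)) (cov u))
      where
        run-free : ∀ u q → ¬ ZoneQ q → inj₂ q G.·[ γ ] u ≡ inj₂ (q Q.·[ γ ] u)
        run-free []      q ¬z = refl
        run-free (e ∷ u) q ¬z with e ∈? γ
        ... | yes p = trans (cong (G._·[ γ ] u) (stepQ-free q ¬z)) (run-free u _ (zoneQ-closed (γ⊆α p) ¬z))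
        ... | no _  = run-free u q ¬z

    -- The orbit of a vertex of Q consists of an orbit in Q and of the cosets in P through the zone points of this orbit.
    covered-Q : ∀ {γ} → Sym γ → ¬ (γ ⊆ α) → ∀ q → Q.Covered γ (pieceBound γ ^ n) q →
                Coveredᴳ γ (pieceBound γ ^ suc n) (inj₂ q)
    covered-Q {γ} sγ γ⊈α q (xs , l , cov) =
      map inj₂ xs ++ cosets xs , bound , λ u → locate (run-induction Visited visit u (inj₂ q) (inj₁ ([] , reflᴳ)))
      where
        W = words nE (rank γ)

        coset : Q.Carrier → List C
        coset z with zoneQ? z
        ... | yes (x , _) = map (λ y → inj₁ ((a ++ x) ++ y)) W
        ... | no _        = []

        coset-length : ∀ z → length (coset z) ≤ count (rank γ)
        coset-length z with zoneQ? z
        ... | yes (x , _) = ℕₚ.≤-reflexive (Listₚ.length-map (λ y → inj₁ ((a ++ x) ++ y)) W)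
        ... | no _        = z≤n

        cosets : List Q.Carrier → List C
        cosets []       = []
        cosets (z ∷ zs) = coset z ++ cosets zs

        cosets-length : ∀ zs → length (cosets zs) ≤ length zs * count (rank γ)
        cosets-length []       = z≤n
        cosets-length (z ∷ zs) = ℕₚ.≤-trans (ℕₚ.≤-reflexive (Listₚ.length-++ (coset z)))
          (ℕₚ.+-mono-≤ (coset-length z) (cosets-length zs))

        bound : length (map inj₂ xs ++ cosets xs) ≤ pieceBound γ ^ suc n
        bound = ℕₚ.≤-trans (ℕₚ.≤-reflexive (Listₚ.length-++ (map inj₂ xs)))
          (ℕₚ.≤-trans (ℕₚ.+-mono-≤ (ℕₚ.≤-reflexive (Listₚ.length-map inj₂ xs)) (cosets-length xs)) (pieceBound-suc {γ} l))

        Visited : C → Set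
        Visited c = (∃ λ u → c ≈ᴳ inj₂ (q Q.·[ γ ] u))
                  ⊎ (∃ λ u → ∃ λ x → ∃ λ y → δ ⊩ x × (γ ∩ α) ⊩ y × q Q.·[ γ ] u Q.≈ Q.base x × c ≈ᴳ inj₁ ((a ++ x) ++ y))

        visit : ∀ e c → e ∈ γ → Visited c → Visited (stepᴳ e c)
        visit e c e∈γ (inj₁ (u , p)) = by (e ∈? α) (zoneQ? q′)
          where
            q′ = q Q.·[ γ ] u
            stay : stepᴳ e (inj₂ q′) ≡ inj₂ (Q.step e q′) → Visited (stepᴳ e c)
            stay eq = inj₁ (u ∷ʳ e , transᴳ (stepᴳ-cong e p) (≡⇒ᴳ (trans eq (cong inj₂ (sym (Q.run-snoc γ u e q e∈γ))))))
            by : Dec (e ∈ α) → Dec (ZoneQ q′) → Visited (stepᴳ e c)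
            by (no ¬p) _ = stay (stepQ-out ¬p q′)
            by (yes _) (no ¬z) = stay (stepQ-free q′ ¬z)
            by (yes e∈α) (yes (x , px , s)) = inj₂ (u , x , e ∷ [] , px , x∈p∩q⁺ (e∈γ , e∈α) ∷ [] , s
              , transᴳ (stepᴳ-cong e p) (transᴳ (stepQ-zone e∈α px s) (pp (R-≡ (sym (Listₚ.++-assoc a x (e ∷ [])))))))
        visit e c e∈γ (inj₂ (u , x , y , px , py , s , p)) = by (e ∈? α) (zoneP? ((a ++ x) ++ y))
          where
            by : Dec (e ∈ α) → Dec (ZoneP ((a ++ x) ++ y)) → Visited (stepᴳ e c)
            by (yes e∈α) _ = inj₂ (u , x , y ∷ʳ e , px , Allₚ.∷ʳ⁺ py (x∈p∩q⁺ (e∈γ , e∈α)) , s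
              , transᴳ (stepᴳ-cong e p) (transᴳ (≡⇒ᴳ (stepP-in e∈α _)) (pp (R-≡ (Listₚ.++-assoc (a ++ x) y (e ∷ []))))))
            by (no e∉α) (no ¬z) = inj₂ (u , x , y , px , py , s , transᴳ (stepᴳ-cong e p) (≡⇒ᴳ (stepP-out e∉α _ ¬z)))
            -- Return to `Q` through another zone point. Modulo `R α`, `y` equals `inv x ++ x′`, a
            -- word over `δ`; by `R-meet` it can be rewritten over `γ` and `δ` at once, so `base x′`
            -- already belongs to the orbit of `q` in `Q`.
            by (no e∉α) (yes (x′ , px′ , r)) =
              let r′ : R α (x ++ y) x′
                  r′ = R-cancelˡ sα a (R-trans (R-≡ (sym (Listₚ.++-assoc a x y))) r)
                  y″ , py″ , r″ = R-meet (sym-∩ sγ sα) sα (∩⊆ʳ {γ} {α}) py (Allₚ.++⁺ (⊩-inv sδ px) px′) (R-moveˡ sα x r′)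
                  py-γ = ⊩-⊆ (λ p → ∩⊆ˡ {γ} {α} (∩⊆ˡ {γ ∩ α} {δ} p)) py″
                  py-δ = ⊩-⊆ (∩⊆ʳ {γ ∩ α} {δ}) py″
                  x′≈ : Q.base x′ Q.≈ q Q.·[ γ ] (u ++ y″)
                  x′≈ = Q.≈-trans (Q.base-cong (α⇒β px′ (Allₚ.++⁺ px py-δ) (R-trans (R-sym r′) (R-++ˡ x r″))))
                          (Q.≈-trans (Q.≈-sym (Q.base-run (⊩-⊆ δ⊆β py-δ) py-γ x))
                            (Q.≈-trans (Q.run-cong γ y″ (Q.≈-sym s)) (Q.≡⇒≈ (sym (run-++ γ Q.step u y″ q)))))
              in inj₁ ((u ++ y″) ∷ʳ e , transᴳ (stepᴳ-cong e p) (transᴳ (stepP-zone e∉α px′ r)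
                   (qq (Q.≈-trans (Q.step-cong e x′≈) (Q.≡⇒≈ (sym (Q.run-snoc γ (u ++ y″) e q e∈γ)))))))

        in-coset : ∀ {z x y c} → δ ⊩ x → γ ⊩ y → z Q.≈ Q.base x → c ≈ᴳ inj₁ ((a ++ x) ++ y) → Any (c ≈ᴳ_) (coset z)
        in-coset {z} {x} {y} px py s p with zoneQ? z
        ... | no ¬z = ⊥-elim (¬z (x , px , s))
        ... | yes (x′ , px′ , s′) =
          let y′ , l′ , _ , r = shorten-in sα sγ γ⊈α y py
          in lose (∈-map⁺ (λ y → inj₁ ((a ++ x′) ++ y)) (∈-words _ y′ l′))
               (transᴳ p (pp (R-++ (R-++ˡ a (zoneQ-unique px px′ s s′)) r)))

        in-cosets : ∀ {x y c zs q′} → δ ⊩ x → γ ⊩ y → q′ Q.≈ Q.base x → c ≈ᴳ inj₁ ((a ++ x) ++ y) →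
                    Any (q′ Q.≈_) zs → Any (c ≈ᴳ_) (cosets zs)
        in-cosets px py s p (here t)  = Anyₚ.++⁺ˡ (in-coset px py (Q.≈-trans (Q.≈-sym t) s) p)
        in-cosets {zs = z ∷ _} px py s p (there t) = Anyₚ.++⁺ʳ (coset z) (in-cosets px py s p t)

        locate : ∀ {c} → Visited c → Any (c ≈ᴳ_) (map inj₂ xs ++ cosets xs)
        locate (inj₁ (u , p)) = Anyₚ.++⁺ˡ (Anyₚ.map⁺ (Any.map (λ t → transᴳ p (qq t)) (cov u)))
        locate (inj₂ (u , x , y , px , py , s , p)) =
          Anyₚ.++⁺ʳ (map inj₂ xs) (in-cosets px (⊩-⊆ (∩⊆ˡ {γ} {α}) py) s p (cov u))

    -- When `γ ⊆ α`, an orbit that is small in `Q` may still become large: from a zone point it runs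
    -- inside the first coset, where it is confined. From a point off the zone it never gets there.
    dichotomy-Q : ∀ γ → Sym γ → ∀ q → Coveredᴳ γ (pieceBound γ ^ suc n) (inj₂ q) ⊎ Confinedᴳ γ (inj₂ q)
    dichotomy-Q γ sγ q with Q.dichotomy γ sγ q
    ... | inj₂ conf = inj₂ (confined-Q q conf)
    ... | inj₁ cov with γ ⊆? α
    ...   | no γ⊈α = inj₁ (covered-Q sγ γ⊈α q cov)
    ...   | yes γ⊆α with zoneQ? q
    ...     | yes (x , px , s) = inj₂ (confined-along [] (qp (x , px , R-refl , s)) (confined-P sγ γ⊆α (a ++ x)))
    ...     | no ¬z = let xs , l , c = covered-Q-free γ⊆α q ¬z cov
                      in inj₁ (xs , ℕₚ.≤-trans l (ℕₚ.^-monoʳ-≤ (pieceBound γ) (ℕₚ.n≤1+n n)) , c)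

    covered-P : ∀ {γ} → Sym γ → ¬ (γ ⊆ α) → ∀ g → ¬ (∃ λ y → (γ ∩ α) ⊩ y × ZoneP (g ++ y)) →
                Coveredᴳ γ (pieceBound γ ^ suc n) (inj₁ g)
    covered-P {γ} sγ γ⊈α g ¬meets =
      map (λ y → inj₁ (g ++ y)) W
      , ℕₚ.≤-trans (ℕₚ.≤-reflexive (Listₚ.length-map (λ y → inj₁ (g ++ y)) W)) (ℕₚ.≤-trans (ℕₚ.n≤1+n _)
          (ℕₚ.≤-trans (ℕₚ.≤-reflexive (sym (ℕₚ.^-identityʳ _))) (ℕₚ.^-monoʳ-≤ (pieceBound γ) (s≤s (z≤n {n})))))
      , λ u → locate (run-induction Visited visit u (inj₁ g) ([] , [] , pp (R-≡ (sym (Listₚ.++-identityʳ g)))))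
      where
        W = words nE (rank γ)
        Visited : C → Set
        Visited c = ∃ λ y → (γ ∩ α) ⊩ y × c ≈ᴳ inj₁ (g ++ y)
        visit : ∀ e c → e ∈ γ → Visited c → Visited (stepᴳ e c)
        visit e c e∈γ (y , py , p) = by (e ∈? α)
          where
            by : Dec (e ∈ α) → Visited (stepᴳ e c)
            by (yes e∈α) = y ∷ʳ e , Allₚ.∷ʳ⁺ py (x∈p∩q⁺ (e∈γ , e∈α))
              , transᴳ (stepᴳ-cong e p) (transᴳ (≡⇒ᴳ (stepP-in e∈α _)) (pp (R-≡ (Listₚ.++-assoc g y (e ∷ [])))))
            by (no e∉α) = y , py , transᴳ (stepᴳ-cong e p) (≡⇒ᴳ (stepP-out e∉α _ λ z → ¬meets (y , py , z)))
        locate : ∀ {c} → Visited c → Any (c ≈ᴳ_) (map (λ y → inj₁ (g ++ y)) W)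
        locate (y , py , p) = let y′ , l , _ , r = shorten-in sα sγ γ⊈α y (⊩-⊆ (∩⊆ˡ {γ} {α}) py)
          in lose (∈-map⁺ (λ y → inj₁ (g ++ y)) (∈-words _ y′ l)) (transᴳ p (pp (R-++ˡ g r)))

    run-P : ∀ {γ y} → γ ⊩ y → α ⊩ y → ∀ g → inj₁ g G.·[ γ ] y ≡ inj₁ (g ++ y)
    run-P []       []       g = cong inj₁ (sym (Listₚ.++-identityʳ g))
    run-P {γ} {e ∷ y} (p ∷ ps) (q ∷ qs) g =
      trans (cong (G._·[ γ ] y) (trans (step-in-∈ p stepᴳ _) (stepP-in q g)))
        (trans (run-P ps qs (g ∷ʳ e)) (cong inj₁ (Listₚ.++-assoc g (e ∷ []) y)))

    meets? : ∀ {γ} → Sym γ → ∀ g → Dec (∃ λ y → (γ ∩ α) ⊩ y × ZoneP (g ++ y))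
    meets? {γ} sγ g = R-word? (γ ∩ α) (sym-∩ sγ sα) (λ y → zoneP? (g ++ y))
      λ p p′ r (x , px , s) → x , px , R-trans (R-++ˡ g (R-sym (R-cons (sym-∩ sγ sα) (∩⊆ʳ {γ} {α}) p p′ r))) s

    dichotomyᴳ : ∀ γ → Sym γ → ∀ c → Coveredᴳ γ (pieceBound γ ^ suc n) c ⊎ Confinedᴳ γ c
    dichotomyᴳ γ sγ (inj₂ q) = dichotomy-Q γ sγ q
    dichotomyᴳ γ sγ (inj₁ g) with γ ⊆? α
    ... | yes γ⊆α = inj₂ (confined-P sγ γ⊆α g)
    ... | no γ⊈α with meets? sγ g
    ...   | no ¬m = inj₁ (covered-P sγ γ⊈α g ¬m)
    -- The orbit of `g` passes through `Q.base x`, and both alternatives depend on the orbit only.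
    ...   | yes (y , py , x , px , r) = transfer (dichotomy-Q γ sγ (Q.base x))
      where
        back : inj₁ g ≈ᴳ inj₂ (Q.base x) G.·[ γ ] inv y
        back = transᴳ (symᴳ (G.run-inv sγ y (inj₁ g))) (G.run-cong γ (inv y)
          (transᴳ (≡⇒ᴳ (run-P (⊩-⊆ (∩⊆ˡ {γ} {α}) py) (⊩-⊆ (∩⊆ʳ {γ} {α}) py) g)) (pq (x , px , r , Q.≈-refl))))
        transfer : Coveredᴳ γ (pieceBound γ ^ suc n) (inj₂ (Q.base x)) ⊎ Confinedᴳ γ (inj₂ (Q.base x)) →
                   Coveredᴳ γ (pieceBound γ ^ suc n) (inj₁ g) ⊎ Confinedᴳ γ (inj₁ g)
        transfer (inj₁ cov)  = inj₁ (covered-along (inv y) back cov)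
        transfer (inj₂ conf) = inj₂ (confined-along (inv y) back conf)

    ray : Ray α (suc n)
    ray = record
      { fset = glued
      ; elems = map inj₁ (words nE (index α)) ++ map inj₂ Q.elems
      ; complete = complete
      ; base = inj₁
      ; base-cong = pp
      ; base-inj = λ { (pp r) → r }
      ; base-step = λ p g → ≡⇒ᴳ (stepP-in p g)
      ; Zone = ZoneP
      ; base-fix = λ e∉ g ¬z → ≡⇒ᴳ (stepP-out e∉ g ¬z)
      ; dichotomy = dichotomyᴳ }
      where
        complete : ∀ c → Any (c ≈ᴳ_) (map inj₁ (words nE (index α)) ++ map inj₂ Q.elems)
        complete (inj₁ g) = let g′ , l , _ , r = R-shorten α g ⊩⊤
          in Anyₚ.++⁺ˡ (lose (∈-map⁺ inj₁ (∈-words _ g′ l)) (pp r))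
        complete (inj₂ q) = Anyₚ.++⁺ʳ (map inj₁ (words nE (index α))) (Anyₚ.map⁺ (Any.map qq (Q.complete q)))

-- Unfolding a cycle of cosets of groups into a chain.

module Chains (I : Pattern) (b₀ D : ℕ) (1≤D : 1 ≤ D) (3≤b₀ : 3 ≤ b₀) (nS≤b₀ : Pattern.nS I ≤ b₀) where
  open Letters I
  open System I b₀ D
  open Killing I b₀ D
  open Pieces I b₀ D 1≤D 3≤b₀ nS≤b₀
  open Rays I b₀ D 1≤D 3≤b₀ nS≤b₀

  ray-killed : ∀ {α n} (Q : Ray α n) → n ≤ D → ∀ γ → Sym γ → ∀ q → Ray.Killed Q γ q
  ray-killed Q n≤D = Orbits.all-killed (Ray.fset Q) dich
    where
      dich : Orbits.Dichotomy (Ray.fset Q)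
      dich γ sγ q with Ray.dichotomy Q γ sγ q
      ... | inj₁ (xs , l , c) = inj₁ (xs , ℕₚ.≤-trans l (≤orbitBound γ n≤D) , c)
      ... | inj₂ (k , _)      = inj₂ k

  module _ (X : FSet) where
    open FSet X

    -- Every letter has to move its point. Such walks survive gluing, whereas a letter that is idle
    -- in `Q` may start to act in the new coset.
    data Moves : List E → Carrier → Carrier → Set where
      stop : ∀ {x y} → x ≈ y → Moves [] x y
      move : ∀ {e w x y} → ¬ (step e x ≈ x) → Moves w (step e x) y → Moves (e ∷ w) x y

  module _ {X : FSet} where
    open FSet X

    moves-cong : ∀ {w x x′ y} → x′ ≈ x → Moves X w x y → Moves X w x′ y
    moves-cong p (stop q)   = stop (≈-trans p q)
    moves-cong p (move ¬q m) =
      move (λ q → ¬q (≈-trans (step-cong _ (≈-sym p)) (≈-trans q p))) (moves-cong (step-cong _ p) m)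

    moves-++ : ∀ {u v x y z} → Moves X u x y → Moves X v y z → Moves X (u ++ v) x z
    moves-++ (stop p)    m′ = moves-cong p m′
    moves-++ (move ¬q m) m′ = move ¬q (moves-++ m m′)

    moves-run : ∀ {w x y} → Moves X w x y → x ·[ ⊤ ] w ≈ y
    moves-run (stop p) = p
    moves-run {e ∷ w} (move _ m) = ≈-trans (≡⇒≈ (cong (_·[ ⊤ ] w) (step-in-∈ ∈⊤ step _))) (moves-run m)

  base-moves : ∀ {α n} (Q : Ray α n) → Sym α → ∀ {y} → α ⊩ y → ∀ x → Moves (Ray.fset Q) y (Ray.base Q x) (Ray.base Q (x ++ y))
  base-moves Q sα []       x = stop (Ray.base-cong Q (R-≡ (sym (Listₚ.++-identityʳ x))))
  base-moves Q sα {e ∷ y} (p ∷ ps) x = move (λ q → letter-nontrivial sα p x (base-inj (≈-trans (≈-sym (base-step p x)) q)))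
    (moves-cong (base-step p x) (subst (λ z → Moves fset y (base (x ∷ʳ e)) (base z)) (Listₚ.++-assoc x (e ∷ []) y)
      (base-moves Q sα ps (x ∷ʳ e))))
    where open Ray Q

  module _ {α β n} (sα : Sym α) (sβ : Sym β) (a : List E) (Q : Ray β n)
           (separated : ∀ x → (α ∩ β) ⊩ x → ¬ Ray.Zone Q x) where
    open Glue sα sβ a Q separated

    lift-move : ∀ e q → ¬ (Q.step e q Q.≈ q) → stepᴳ e (inj₂ q) ≈ᴳ inj₂ (Q.step e q)
    lift-move e q ¬p = by (e ∈? α) (zoneQ? q) (e ∈? β)
      where
        by : Dec (e ∈ α) → Dec (ZoneQ q) → Dec (e ∈ β) → stepᴳ e (inj₂ q) ≈ᴳ inj₂ (Q.step e q)
        by (no e∉) _ _ = ≡⇒ᴳ (stepQ-out e∉ q)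
        by _ (no ¬z) _ = ≡⇒ᴳ (stepQ-free q ¬z)
        by (yes e∈) (yes (x , px , s)) (yes e∈β) = transᴳ (stepQ-zone e∈ px s)
          (pq (x ∷ʳ e , Allₚ.∷ʳ⁺ px (x∈p∩q⁺ (e∈ , e∈β)) , R-refl , Q.≈-trans (Q.step-cong e s) (Q.base-step e∈β x)))
        by (yes _) (yes (x , px , s)) (no e∉β) = ⊥-elim (¬p (Q.≈-trans (Q.step-cong e s)
          (Q.≈-trans (Q.base-fix e∉β x (separated x px)) (Q.≈-sym s))))

    lift-moves : ∀ {w q q′} → Moves Q.fset w q q′ → Moves glued w (inj₂ q) (inj₂ q′)
    lift-moves (stop p) = stop (qq p)
    lift-moves {e ∷ w} {q} (move ¬p m) =
      move (λ r → not-fixed (transᴳ (symᴳ (lift-move e q ¬p)) r)) (moves-cong (lift-move e q ¬p) (lift-moves m))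
      where
        not-fixed : ¬ (_≈ᴳ_ (inj₂ (Q.step e q)) (inj₂ q))
        not-fixed (qq r) = ¬p r

  record Segment : Set where
    field
      set  : Subset nE
      symm : Sym set
      word : List E
      fits : set ⊩ word
  open Segment

  -- The negation of separation, read in the group of words modulo `R (set s)`.
  Separable : Segment → Segment → Segment → Set
  Separable r s t = ∃ λ x → ∃ λ y → (set r ∩ set s) ⊩ x × (set s ∩ set t) ⊩ y × R (set s) (word s) (x ++ y)

  Separated : List Segment → Set
  Separated (r ∷ s ∷ t ∷ l) = ¬ Separable r s t × Separated (s ∷ t ∷ l)
  Separated _               = ⊤′
    where open import Data.Unit using () renaming (⊤ to ⊤′)

  total : List Segment → List E
  total = concatMap word

  ZoneSpec : Segment → List Segment → List E → Set
  ZoneSpec s []      g = ⊥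
  ZoneSpec s (t ∷ l) g = ∃ λ x → (set s ∩ set t) ⊩ x × R (set s) g (word s ++ x)

  record Chain (s : Segment) (l : List Segment) : Set₁ where
    field
      ray       : Ray (set s) (suc (length l))
    open Ray ray public
    field
      end       : Carrier
      moves     : Moves fset (word s ++ total l) (base []) end
      zone-spec : ∀ g → Zone g → ZoneSpec s l g
      end-zone  : ∀ g → end ≈ base g → 1 ≤ length l → Zone g

  -- A point in both zones of the coset of `t` is `g` and `word t ++ x` at once, so `word t` equals
  -- `g ++ inv x`, a forbidden factorisation. This is the hypothesis `separated` under which chains
  -- are glued.
  zone-separated : ∀ s t l → Separated (s ∷ t ∷ l) → ∀ g → (set s ∩ set t) ⊩ g → ¬ ZoneSpec t l g
  zone-separated s t (r ∷ l) (¬sep , _) g pg (x , px , q) =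
    ¬sep (g , inv x , pg , ⊩-inv (sym-∩ (symm t) (symm r)) px , R-moveʳ (symm t) (word t) x (R-sym q))

  chain : ∀ s l → Separated (s ∷ l) → Chain s l
  chain s [] _ = record
    { ray = single (symm s) ; end = word s ; moves = subst (λ w → Moves _ w [] (word s)) (sym (Listₚ.++-identityʳ (word s))) (base-moves (single (symm s)) (symm s) (fits s) [])
    ; zone-spec = λ _ z → z ; end-zone = λ _ _ () }
  chain s (t ∷ l) sep = record
    { ray = G.ray ; end = inj₂ Q.end
    ; moves = moves-++ (base-moves G.ray (symm s) (fits s) [])
        (moves-cong (G.pq ([] , [] , R-≡ (sym (Listₚ.++-identityʳ (word s))) , Q.≈-refl)) (lift-moves (symm s) (symm t) (word s) Q.ray separated Q.moves))
    ; zone-spec = λ _ z → z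
    ; end-zone = λ { _ (G.qp (x , px , r , _)) _ → x , px , r } }
    where
      tail : ∀ l → Separated (s ∷ t ∷ l) → Separated (t ∷ l)
      tail []      _         = _
      tail (_ ∷ _) (_ , sep) = sep
      module Q = Chain (chain t l (tail l sep))
      separated : ∀ x → (set s ∩ set t) ⊩ x → ¬ Q.Zone x
      separated x px z = zone-separated s t l sep x px (Q.zone-spec x z)
      module G = Glue (symm s) (symm t) (word s) Q.ray separated

  -- The total word leads from `base []` to `end`. Were it trivial, `end` would be identified with
  -- `base []`; it would then lie in the second coset, in the zone towards the first and, by
  -- `end-zone`, in the zone towards the third.
  no-group-cycle : ∀ r s t l → 3 + length l ≤ D → Separated (r ∷ s ∷ t ∷ l) → ¬ R ⊤ (total (r ∷ s ∷ t ∷ l)) []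
  no-group-cycle r s t l len sep rel =
    closed (C.≈-trans (C.≈-sym (moves-run C.moves)) (ray-killed C.ray len ⊤ sym-⊤ (C.base []) _ _ rel))
    where
      module C = Chain (chain r (s ∷ t ∷ l) sep)
      module Q = Chain (chain s (t ∷ l) (proj₂ sep))
      open Glue (symm r) (symm s) (word r) Q.ray (λ x px z → zone-separated r s (t ∷ l) sep x px (Q.zone-spec x z)) using (qp)
      closed : ¬ (C.end C.≈ C.base [])
      closed (qp (x , px , _ , q)) = zone-separated r s (t ∷ l) sep x px (Q.zone-spec x (Q.end-zone x q (s≤s z≤n)))

-- Chains with a record of the position in the pattern.

module Synchronised (I : Pattern) (b₀ D : ℕ) (1≤D : 1 ≤ D) (3≤b₀ : 3 ≤ b₀) (nS≤b₀ : Pattern.nS I ≤ b₀) where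
  open Letters I
  open System I b₀ D
  open Killing I b₀ D
  open Pieces I b₀ D 1≤D 3≤b₀ nS≤b₀
  open Rays I b₀ D 1≤D 3≤b₀ nS≤b₀
  open Chains I b₀ D 1≤D 3≤b₀ nS≤b₀

  Path : S → S → List E → Set
  Path = IsPath I

  path-++ : ∀ {s t r u v} → Path s t u → Path t r v → Path s r (u ++ v)
  path-++ []      q = q
  path-++ (e ∷ p) q = e ∷ path-++ p q

  path-split : ∀ u {v s r} → Path s r (u ++ v) → ∃ λ t → Path s t u × Path t r v
  path-split []      p       = _ , [] , p
  path-split (e ∷ u) (q ∷ p) = let t , p₁ , p₂ = path-split u p in t , q ∷ p₁ , p₂

  path-letter : ∀ {e s} → ι₁ e ≡ s → Path s (ι₂ e) (e ∷ [])
  path-letter p = p ∷ []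

  path-inv : ∀ {s t w} → Path s t w → Path t s (inv w)
  path-inv [] = []
  path-inv {s} (_∷_ {e = e} p ps) = path-++ (path-inv ps)
    (subst (λ r → Path (ι₂ e) r ((e ⁻¹) ∷ [])) (trans (ι₂-⁻¹ e) p) (path-letter (ι₁-⁻¹ e)))

  path? : ∀ s t w → Dec (Path s t w)
  path? s t [] with s ≟ t
  ... | yes refl = yes []
  ... | no ¬p    = no λ { [] → ¬p refl }
  path? s t (e ∷ w) = map′ (λ (p , q) → p ∷ q) (λ { (p ∷ q) → p , q }) ((ι₁ e ≟ s) ×-dec path? (ι₂ e) t w)

  target : S → List E → S
  target s []      = s
  target s (e ∷ w) = target (ι₂ e) w

  path-target : ∀ {s t w} → Path s t w → t ≡ target s w
  path-target []      = refl
  path-target (_ ∷ p) = path-target p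

  target-++ : ∀ s u v → target s (u ++ v) ≡ target (target s u) v
  target-++ s []      v = refl
  target-++ s (e ∷ u) v = target-++ (ι₂ e) u v

  path-cut : ∀ {s t} a b {c} → target s a ≡ target s (a ++ b) → Path s t (a ++ b ++ c) → Path s t (a ++ c)
  path-cut {s} {t} a b {c} eq p =
    let r , p₁ , q = path-split a p
        r′ , p₂ , p₃ = path-split b q
    in path-++ p₁ (subst (λ r → Path r t c)
         (trans (path-target p₂) (trans (cong (λ r → target r b) (path-target p₁))
           (trans (sym (target-++ s a b)) (trans (sym eq) (sym (path-target p₁)))))) p₃)

  module _ {X : FSet} where
    open FSet X

    moves-split : ∀ u {v x y} → Moves X (u ++ v) x y → Moves X u x (x ·[ ⊤ ] u) × Moves X v (x ·[ ⊤ ] u) y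
    moves-split []      m = stop ≈-refl , m
    moves-split (e ∷ u) {v} {x} {y} (move ¬p m) rewrite step-in-∈ {γ = ⊤} {e} ∈⊤ step x =
      let m₁ , m₂ = moves-split u m in move ¬p m₁ , m₂

    moves-inv : ∀ {w x y} → Moves X w x y → Moves X (inv w) y x
    moves-inv (stop p) = stop (≈-sym p)
    moves-inv {e ∷ w} {x} (move ¬p m) = moves-++ (moves-inv m)
      (move (λ q → ¬p (≈-trans (≈-sym q) (step-inv e x))) (stop (step-inv e x)))

    moves? : ∀ w x y → Dec (Moves X w x y)
    moves? []      x y = map′ stop (λ { (stop p) → p }) (x ≈? y)
    moves? (e ∷ w) x y = map′ (λ (p , m) → move p m) (λ { (move p m) → p , m }) (¬? (step e x ≈? x) ×-dec moves? w (step e x) y)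

  module _ (X : FSet) where
    open FSet X

    Conn : Carrier × S → Carrier × S → Set
    Conn (v , s) (v′ , s′) = ∃ λ w → Moves X w v v′ × Path s s′ w

  length-product : {A B C : Set} (f : A → B → C) (xs : List A) (ys : List B) →
                   length (cartesianProductWith f xs ys) ≡ length xs * length ys
  length-product f []       ys = refl
  length-product f (x ∷ xs) ys = trans (Listₚ.length-++ (map (f x) ys)) (cong₂ _+_ (Listₚ.length-map (f x) ys) (length-product f xs ys))

  -- A labelling of the vertices by permutations of S makes the endpoint of a moving path
  -- depend on its last vertex only.
  record Labelling (X : FSet) : Set where
    open FSet X
    field
      lab      : Carrier → S → S
      lab-cong : ∀ {x y} → x ≈ y → ∀ s → lab x s ≡ lab y s
      lab-move : ∀ {e x} → ¬ (step e x ≈ x) → ∀ s → lab (step e x) s ≡ τ e (lab x s)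
      lab-surj : ∀ x s → ∃ λ r → lab x r ≡ s

  -- A state is a vertex v of the chain and a reference point p.  It is synchronised if a moving path
  -- of the pattern leads from p to v.  A letter that does not move v moves the reference point if the state
  -- is synchronised, so that a path of the pattern never loses synchronisation while moving words never
  -- change the reference point.
  module Sync {α n} (Q : Ray α n) (n≤D : n ≤ D) (L : Labelling (Ray.fset Q)) where
    open Ray Q
    open Labelling L

    P : Set
    P = Carrier × S

    infix 4 _~_
    _~_ : P → P → Set
    _~_ = Conn fset

    ~-at : ∀ {v v′ s} → v ≈ v′ → (v , s) ~ (v′ , s)
    ~-at p = [] , stop p , []

    ~-trans : ∀ {p q r} → p ~ q → q ~ r → p ~ r
    ~-trans (u , m , p) (u′ , m′ , p′) = u ++ u′ , moves-++ m m′ , path-++ p p′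

    ~-sym : ∀ {p q} → p ~ q → q ~ p
    ~-sym (u , m , p) = inv u , moves-inv m , path-inv p

    lab-walk : ∀ {w v v′ s s′} → Moves fset w v v′ → Path s s′ w → ∀ {r} → lab v r ≡ s → lab v′ r ≡ s′
    lab-walk (stop p) [] eq = trans (sym (lab-cong p _)) eq
    lab-walk {e ∷ w} (move ¬p m) (q ∷ ps) eq = lab-walk m ps (trans (lab-move ¬p _) (τ-ι₁ e (trans eq (sym q))))

    -- Take `r` whose label at the start is the initial position. Along either walk the label of `r`
    -- follows the position, and at `v` it has one value.
    ~-unique : ∀ {p v s s′} → p ~ (v , s) → p ~ (v , s′) → s ≡ s′
    ~-unique {v₀ , s₀} (u , m , p) (u′ , m′ , p′) =
      let r , eq = lab-surj v₀ s₀ in trans (sym (lab-walk m p eq)) (lab-walk m′ p′ eq)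

    abstract
      sync? : ∀ p v → Dec (∃ λ s → p ~ (v , s))
      sync? (v₀ , s₀) v = map′ (λ (w , s , m , p) → s , w , m , p) (λ (s , w , m , p) → w , s , m , p)
        (short-word? (length elems * nS) walk? shorten-walk)
        where
          Walk : List E → Set
          Walk w = ∃ λ s → Moves fset w v₀ v × Path s₀ s w
          walk? : ∀ w → Dec (Walk w)
          walk? w = Finₚ.any? λ s → moves? w v₀ v ×-dec path? s₀ s w
          position : List E → Fin (length elems)
          position w = Any.index (complete (v₀ ·[ ⊤ ] w))
          position-≈ : ∀ {u w} → position u ≡ position w → v₀ ·[ ⊤ ] u ≈ v₀ ·[ ⊤ ] w
          position-≈ {u} {w} eq = ≈-trans (Anyₚ.lookup-index (complete (v₀ ·[ ⊤ ] u)))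
            (≈-trans (≡⇒≈ (cong (lookup elems) eq)) (≈-sym (Anyₚ.lookup-index (complete (v₀ ·[ ⊤ ] w)))))
          state : List E → Fin (length elems * nS)
          state w = combine (position w) (target s₀ w)
          shorten-walk : ∀ w → Walk w → ∃ λ w′ → length w′ ≤ length elems * nS × Walk w′
          shorten-walk w wk =
            -- Only `Walk` has to survive the cutting; `S × S → S × S`, inhabited by `id`, serves as
            -- the trivial relation.
            let w′ , l , wk′ , _ = shorten state Walk (λ _ _ → S × S → S × S) id (λ _ _ → id) cut-walk w wk in w′ , l , wk′
            where
              cut-walk : ∀ a b c → state a ≡ state (a ++ b) → Walk (a ++ b ++ c) → Walk (a ++ c) × (S × S → S × S)
              cut-walk a b c eq (s , m , p) =
                let eq₁ , eq₂ = Finₚ.combine-injective (position a) (target s₀ a) (position (a ++ b)) (target s₀ (a ++ b)) eq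
                    m₁ , m₂ = moves-split a m
                    m₃ , m₄ = moves-split b m₂
                in (s , moves-++ m₁ (moves-cong (≈-trans (position-≈ {a} {a ++ b} eq₁) (≡⇒≈ (run-++ ⊤ step a b v₀))) m₄)
                      , path-cut a b eq₂ p) , id

    infix 4 _≈ˢ_
    -- Reference points joined by a moving path are identified; otherwise the inverse letter could
    -- not undo a reset of the reference point.
    data _≈ˢ_ : Carrier × P → Carrier × P → Set where
      same : ∀ {v v′ p p′} → v ≈ v′ → p ~ p′ → (v , p) ≈ˢ (v′ , p′)

    ~-refl : ∀ {p} → p ~ p
    ~-refl = ~-at ≈-refl

    ~? : ∀ p q → Dec (p ~ q)
    ~? p (v , s) with sync? p v
    ... | no ¬c = no λ c → ¬c (s , c)
    ... | yes (s′ , c) with s′ ≟ s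
    ...   | yes refl = yes c
    ...   | no ¬eq   = no λ c′ → ¬eq (~-unique c c′)

    stepˢ : E → Carrier × P → Carrier × P
    stepˢ e (v , p) with step e v ≈? v | sync? p v
    ... | no _  | _           = step e v , p
    ... | yes _ | yes (s , _) = v , v , τ e s
    ... | yes _ | no _        = v , p

    step-moving : ∀ {e v} p → ¬ (step e v ≈ v) → stepˢ e (v , p) ≡ (step e v , p)
    step-moving {e} {v} p ¬q with step e v ≈? v | sync? p v
    ... | no _  | _ = refl
    ... | yes q | _ = ⊥-elim (¬q q)

    step-sync : ∀ {e v p s} → step e v ≈ v → p ~ (v , s) → stepˢ e (v , p) ≡ (v , v , τ e s)
    step-sync {e} {v} {p} {s} q c with step e v ≈? v | sync? p v
    ... | no ¬q | _            = ⊥-elim (¬q q)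
    ... | yes _ | yes (s′ , c′) = cong (λ s → v , v , τ e s) (~-unique c′ c)
    ... | yes _ | no ¬c         = ⊥-elim (¬c (s , c))

    step-stay : ∀ {e v p} → step e v ≈ v → ¬ (∃ λ s → p ~ (v , s)) → stepˢ e (v , p) ≡ (v , p)
    step-stay {e} {v} {p} q ¬c with step e v ≈? v | sync? p v
    ... | no ¬q | _     = ⊥-elim (¬q q)
    ... | yes _ | yes c = ⊥-elim (¬c c)
    ... | yes _ | no _  = refl

    ≈ˢ-refl : ∀ {x} → x ≈ˢ x
    ≈ˢ-refl = same ≈-refl ~-refl

    ≈ˢ-sym : ∀ {x y} → x ≈ˢ y → y ≈ˢ x
    ≈ˢ-sym (same p q) = same (≈-sym p) (~-sym q)

    ≈ˢ-trans : ∀ {x y z} → x ≈ˢ y → y ≈ˢ z → x ≈ˢ z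
    ≈ˢ-trans (same p q) (same p′ q′) = same (≈-trans p p′) (~-trans q q′)

    ≡⇒≈ˢ : ∀ {x y} → x ≡ y → x ≈ˢ y
    ≡⇒≈ˢ refl = ≈ˢ-refl

    stepˢ-cong : ∀ e {x y} → x ≈ˢ y → stepˢ e x ≈ˢ stepˢ e y
    stepˢ-cong e (same {v} {v′} {p} {p′} q c) = by (step e v ≈? v) (sync? p v)
      where
        fixed : step e v ≈ v → step e v′ ≈ v′
        fixed f = ≈-trans (step-cong e (≈-sym q)) (≈-trans f q)
        unfixed : ¬ (step e v ≈ v) → ¬ (step e v′ ≈ v′)
        unfixed ¬f f = ¬f (≈-trans (step-cong e q) (≈-trans f (≈-sym q)))
        by : Dec (step e v ≈ v) → Dec (∃ λ s → p ~ (v , s)) → stepˢ e (v , p) ≈ˢ stepˢ e (v′ , p′)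
        by (no ¬f) _ = ≈ˢ-trans (≡⇒≈ˢ (step-moving p ¬f)) (≈ˢ-trans (same (step-cong e q) c) (≡⇒≈ˢ (sym (step-moving p′ (unfixed ¬f)))))
        by (yes f) (yes (s , d)) = ≈ˢ-trans (≡⇒≈ˢ (step-sync f d)) (≈ˢ-trans (same q (~-at q))
          (≡⇒≈ˢ (sym (step-sync (fixed f) (~-trans (~-sym c) (~-trans d (~-at q)))))))
        by (yes f) (no ¬d) = ≈ˢ-trans (≡⇒≈ˢ (step-stay f ¬d)) (≈ˢ-trans (same q c)
          (≡⇒≈ˢ (sym (step-stay (fixed f) λ (s , d) → ¬d (s , ~-trans c (~-trans d (~-at (≈-sym q))))))))

    stepˢ-inv : ∀ e x → stepˢ (e ⁻¹) (stepˢ e x) ≈ˢ x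
    stepˢ-inv e (v , p) = by (step e v ≈? v) (sync? p v)
      where
        fixed : step e v ≈ v → step (e ⁻¹) v ≈ v
        fixed f = ≈-trans (step-cong (e ⁻¹) (≈-sym f)) (step-inv e v)
        by : Dec (step e v ≈ v) → Dec (∃ λ s → p ~ (v , s)) → stepˢ (e ⁻¹) (stepˢ e (v , p)) ≈ˢ (v , p)
        by (no ¬f) _ = ≈ˢ-trans (≡⇒≈ˢ (trans (cong (stepˢ (e ⁻¹)) (step-moving p ¬f))
          (step-moving p λ q → ¬f (≈-trans (≈-sym q) (step-inv e v))))) (same (step-inv e v) ~-refl)
        by (yes f) (yes (s , d)) = ≈ˢ-trans (≡⇒≈ˢ (trans (cong (stepˢ (e ⁻¹)) (step-sync f d))
          (trans (step-sync (fixed f) ~-refl) (cong (λ s → v , v , s) (τ-inv e s))))) (same ≈-refl (~-sym d))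
        by (yes f) (no ¬d) = ≡⇒≈ˢ (trans (cong (stepˢ (e ⁻¹)) (step-stay f ¬d)) (step-stay (fixed f) ¬d))

    synced : FSet
    synced = record
      { Carrier = Carrier × P ; _≈_ = _≈ˢ_ ; ≈-refl = ≈ˢ-refl ; ≈-sym = ≈ˢ-sym ; ≈-trans = ≈ˢ-trans
      ; _≈?_ = λ (v , p) (v′ , p′) → map′ (λ (q , c) → same q c) (λ { (same q c) → q , c }) ((v ≈? v′) ×-dec ~? p p′)
      ; step = stepˢ ; step-cong = stepˢ-cong ; step-inv = stepˢ-inv }

    module Y = FSet synced

    -- The reference point is `p` or, after a reset, a point of the orbit with a vertex of the
    -- pattern. With `m` points in the orbit this gives `m * suc (m * nS)` states, the product in
    -- `orbitBound`.
    covered-sync : ∀ {γ} v p → Covered γ (pieceBound γ ^ n) v → Orbits.Covered synced γ (orbitBound (rank γ)) (v , p)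
    covered-sync {γ} v p (xs , l , cov) =
      states , bound , λ u → locate (run-induction Visited visit u (v , p) ([] , p , inj₁ refl , ≈ˢ-refl))
      where
        refs = p ∷ cartesianProductWith _,_ xs (allFin nS)
        states = cartesianProductWith _,_ xs refs

        bound : length states ≤ orbitBound (rank γ)
        bound = ℕₚ.≤-trans (ℕₚ.≤-reflexive (trans (length-product _,_ xs refs)
            (cong (λ k → length xs * suc k) (trans (length-product _,_ xs (allFin nS)) (cong (length xs *_) (Listₚ.length-tabulate id))))))
          (ℕₚ.≤-trans (ℕₚ.*-mono-≤ l′ (s≤s (ℕₚ.*-monoˡ-≤ nS l′))) (ℕₚ.m≤n+m _ b₀))
          where l′ = ℕₚ.≤-trans l (ℕₚ.^-monoʳ-≤ (pieceBound γ) n≤D)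

        Ref : P → Set
        Ref r = r ≡ p ⊎ (∃ λ u → ∃ λ s → r ≡ (v ·[ γ ] u , s))

        Visited : Carrier × P → Set
        Visited c = ∃ λ u → ∃ λ r → Ref r × c ≈ˢ (v ·[ γ ] u , r)

        visit : ∀ e c → e ∈ γ → Visited c → Visited (stepˢ e c)
        visit e c e∈ (u , r , ref , q) = by (step e v′ ≈? v′) (sync? r v′)
          where
            v′ = v ·[ γ ] u
            by : Dec (step e v′ ≈ v′) → Dec (∃ λ s → r ~ (v′ , s)) → Visited (stepˢ e c)
            by (no ¬f) _ = u ∷ʳ e , r , ref , ≈ˢ-trans (stepˢ-cong e q)
              (≡⇒≈ˢ (trans (step-moving r ¬f) (cong (_, r) (sym (run-snoc γ u e v e∈)))))
            by (yes f) (yes (s , d)) = u , (v′ , τ e s) , inj₂ (u , τ e s , refl) , ≈ˢ-trans (stepˢ-cong e q) (≡⇒≈ˢ (step-sync f d))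
            by (yes f) (no ¬d) = u , r , ref , ≈ˢ-trans (stepˢ-cong e q) (≡⇒≈ˢ (step-stay f ¬d))

        find-ref : ∀ {r} → Ref r → ∃ λ r′ → r′ ∈ˡ refs × r ~ r′
        find-ref (inj₁ refl) = p , here refl , ~-refl
        find-ref (inj₂ (u , s , refl)) =
          let x , x∈ , q = find (cov u) in (x , s) , there (∈-cartesianProductWith⁺ _,_ x∈ (∈-allFin s)) , ~-at q

        locate : ∀ {c} → Visited c → Any (c ≈ˢ_) states
        locate (u , r , ref , q) =
          let x , x∈ , q′ = find (cov u)
              r′ , r∈ , c = find-ref ref
          in lose (∈-cartesianProductWith⁺ _,_ x∈ r∈) (≈ˢ-trans q (same q′ c))

    -- In a confined orbit every letter of `γ` moves every point, so the reference point never
    -- changes. This is the purpose of the clause on moving letters in `Confined`.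
    killed-sync : ∀ {γ} v p → Confined γ v → Orbits.Killed synced γ (v , p)
    killed-sync {γ} v p (k , m , _) u u′ r =
      ≈ˢ-trans (≡⇒≈ˢ (lift u [])) (≈ˢ-trans (same (k u u′ r) ~-refl) (≡⇒≈ˢ (sym (lift u′ []))))
      where
        lift : ∀ u w → (v ·[ γ ] w , p) Y.·[ γ ] u ≡ (v ·[ γ ] (w ++ u) , p)
        lift [] w = cong (λ w → v ·[ γ ] w , p) (sym (Listₚ.++-identityʳ w))
        lift (e ∷ u) w with e ∈? γ
        ... | yes e∈ = trans (cong (Y._·[ γ ] u) (trans (step-moving p λ q → m w e e∈ (≈-trans (≡⇒≈ (run-snoc γ w e v e∈)) q))
                (cong (_, p) (sym (run-snoc γ w e v e∈)))))
                (trans (lift u (w ∷ʳ e)) (cong (λ w → v ·[ γ ] w , p) (Listₚ.++-assoc w (e ∷ []) u)))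
        ... | no e∉ = trans (lift u w) (cong (_, p) (trans (run-++ γ step w u v)
                (sym (trans (run-++ γ step w (e ∷ u) v) (cong (_·[ γ ] u) (step-in-∉ e∉ step _))))))

    sync-killed : ∀ γ → Sym γ → ∀ x → Orbits.Killed synced γ x
    sync-killed = Orbits.all-killed synced dich
      where
        dich : Orbits.Dichotomy synced
        dich γ sγ (v , p) with dichotomy γ sγ v
        ... | inj₁ cov  = inj₁ (covered-sync v p cov)
        ... | inj₂ conf = inj₂ (killed-sync v p conf)

    run-path : ∀ {s t w} → Path s t w → ∀ v p → p ~ (v , s) →
               ∃ λ v′ → ∃ λ p′ → (v , p) Y.·[ ⊤ ] w ≈ˢ (v′ , p′) × p′ ~ (v′ , t)
    run-path [] v p c = v , p , ≈ˢ-refl , c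
    run-path {s} {t} {e ∷ w} (eq ∷ q) v p c rewrite step-in-∈ {γ = ⊤} {e} ∈⊤ stepˢ (v , p) = by (step e v ≈? v)
      where
        by : Dec (step e v ≈ v) → ∃ λ v′ → ∃ λ p′ → stepˢ e (v , p) Y.·[ ⊤ ] w ≈ˢ (v′ , p′) × p′ ~ (v′ , t)
        by (no ¬f) rewrite step-moving p ¬f =
          run-path q (step e v) p (~-trans c (e ∷ [] , move ¬f (stop ≈-refl) , path-letter eq))
        by (yes f) rewrite step-sync f c | τ-ι₁ e (sym eq) = run-path q v (v , ι₂ e) ~-refl

    run-moves : ∀ {w v v′} → Moves fset w v v′ → ∀ p → (v , p) Y.·[ ⊤ ] w ≈ˢ (v′ , p)
    run-moves (stop q) p = same q ~-refl
    run-moves {e ∷ w} {v} (move ¬f m) p =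
      ≈ˢ-trans (≡⇒≈ˢ (cong (Y._·[ ⊤ ] w) (trans (step-in-∈ ∈⊤ stepˢ _) (step-moving p ¬f)))) (run-moves m p)

    -- Both words are read from `v` with reference point `(v , s)` and reach the same state. The
    -- moving word `u` keeps the reference point and the path `w` keeps synchronisation with its
    -- position, so a moving path leads from `(v , s)` to `(v′ , t)`.
    connect : ∀ {s t w u v v′} → Path s t w → R ⊤ w u → Moves fset u v v′ → (v , s) ~ (v′ , t)
    connect {s} {t} {w} {u} {v} {v′} pw r m
      with run-path pw v (v , s) ~-refl
    ... | v″ , p″ , eq , c with ≈ˢ-trans (≈ˢ-sym (run-moves m (v , s))) (≈ˢ-trans (sync-killed ⊤ sym-⊤ _ _ _ (R-sym r)) eq)
    ...   | same q d = ~-trans d (~-trans c (~-at (≈-sym q)))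

-- From factorisations into words to factorisations into paths.

module PathProperty (I : Pattern) (b₀ D : ℕ) (2≤D : 2 ≤ D) (3≤b₀ : 3 ≤ b₀) (nS≤b₀ : Pattern.nS I ≤ b₀) where
  1≤D : 1 ≤ D
  1≤D = ℕₚ.≤-trans (s≤s z≤n) 2≤D

  open Letters I
  open System I b₀ D
  open Pieces I b₀ D 1≤D 3≤b₀ nS≤b₀
  open Rays I b₀ D 1≤D 3≤b₀ nS≤b₀
  open Chains I b₀ D 1≤D 3≤b₀ nS≤b₀
  open Synchronised I b₀ D 1≤D 3≤b₀ nS≤b₀

  module _ {δ} (sδ : Sym δ) where

    run-τ-snoc : ∀ {e} → e ∈ δ → ∀ g s → run δ τ (g ∷ʳ e) s ≡ τ e (run δ τ g s)
    run-τ-snoc e∈ g s = FSet.run-snoc Sorts δ g _ s e∈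

    run-τ-surj : ∀ g s → ∃ λ r → run δ τ g r ≡ s
    run-τ-surj g s = run δ τ (inv g) s ,
      trans (cong (λ w → run δ τ w (run δ τ (inv g) s)) (sym (inv-inv g))) (FSet.run-inv Sorts sδ (inv g) s)

    moving-letter : ∀ {e g} → ¬ R δ (g ∷ʳ e) g → e ∈ δ
    moving-letter {e} {g} ¬r with e ∈? δ
    ... | yes p = p
    ... | no ¬p = ⊥-elim (¬r (R-∉ ¬p g))

    label-piece : Labelling (Piece sδ)
    label-piece = record
      { lab = run δ τ
      ; lab-cong = sorts-respect sδ
      ; lab-move = λ {e} {g} ¬r s → run-τ-snoc (moving-letter ¬r) g s
      ; lab-surj = run-τ-surj }

    moves-in : ∀ {w g h} → Moves (Piece sδ) w g h → δ ⊩ w × R δ (g ++ w) h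
    moves-in (stop p) = [] , R-trans (R-≡ (Listₚ.++-identityʳ _)) p
    moves-in {e ∷ w} {g} (move ¬r m) =
      let p , r = moves-in m in moving-letter ¬r ∷ p , R-trans (R-≡ (sym (Listₚ.++-assoc g (e ∷ []) w))) r

    -- In the single coset of `δ` only letters of `δ` move anything, so the moving path that
    -- `connect` supplies from `[]` to `x` is a path over `δ`.
    path-within : ∀ {s t p x} → Path s t p → δ ⊩ x → R ⊤ p x → ∃ λ q → Path s t q × δ ⊩ q × R ⊤ q x
    path-within {s} {t} {p} {x} path px r =
      let q , m , path′ = Sync.connect (single sδ) 1≤D label-piece path r (base-moves (single sδ) sδ px [])
          q⊩ , r′ = moves-in m
      in q , path′ , q⊩ , R-cons sδ (λ _ → ∈⊤) q⊩ px r′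

  module _ {α β} (sα : Sym α) (sβ : Sym β) where
    private
      Q : Ray β 1
      Q = single sβ
    open Glue sα sβ [] Q (λ _ _ ())

    lab₂ : C → S → S
    lab₂ (inj₁ g) = run α τ g
    lab₂ (inj₂ h) = run β τ h

    lab₂-link : ∀ {g h} → Link g h → ∀ s → run α τ g s ≡ run β τ h s
    lab₂-link (x , px , r , r′) s = trans (sorts-respect sα r s)
      (trans (run-⊩ τ (⊩-⊆ δ⊆α px) (⊩-⊆ δ⊆β px) s) (sym (sorts-respect sβ r′ s)))

    moves-off : ∀ {e h} → ¬ R β (h ∷ʳ e) h → stepᴳ e (inj₂ h) ≈ᴳ inj₂ (h ∷ʳ e)
    moves-off = lift-move sα sβ [] Q (λ _ _ ()) _ _

    lab₂-cong : ∀ {x y} → x ≈ᴳ y → ∀ s → lab₂ x s ≡ lab₂ y s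
    lab₂-cong (pp r) s = sorts-respect sα r s
    lab₂-cong (pq l) s = lab₂-link l s
    lab₂-cong (qp l) s = sym (lab₂-link l s)
    lab₂-cong (qq r) s = sorts-respect sβ r s

    lab₂-move : ∀ {e x} → ¬ (stepᴳ e x ≈ᴳ x) → ∀ s → lab₂ (stepᴳ e x) s ≡ τ e (lab₂ x s)
    lab₂-move {e} {inj₁ g} ¬f s = by (e ∈? α) (zoneP? g) (e ∈? β)
      where
        by : Dec (e ∈ α) → Dec (ZoneP g) → Dec (e ∈ β) → lab₂ (stepᴳ e (inj₁ g)) s ≡ τ e (run α τ g s)
        by (yes e∈) _ _ = trans (lab₂-cong (≡⇒ᴳ (stepP-in e∈ g)) s) (run-τ-snoc sα e∈ g s)
        by (no e∉) (no ¬z) _ = ⊥-elim (¬f (≡⇒ᴳ (stepP-out e∉ g ¬z)))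
        by (no e∉) (yes (x , px , r)) (yes e∈β) = trans (lab₂-cong (stepP-zone e∉ px r) s)
          (trans (run-τ-snoc sβ e∈β x s) (cong (τ e) (sym (lab₂-link (x , px , r , R-refl) s))))
        by (no e∉) (yes (x , px , r)) (no e∉β) =
          ⊥-elim (¬f (transᴳ (stepP-zone e∉ px r) (qp (x , px , r , R-∉ e∉β x))))
    lab₂-move {e} {inj₂ h} ¬f s = by (e ∈? β) (e ∈? α) (zoneQ? h)
      where
        by : Dec (e ∈ β) → Dec (e ∈ α) → Dec (ZoneQ h) → lab₂ (stepᴳ e (inj₂ h)) s ≡ τ e (run β τ h s)
        by (yes e∈) _ _ = trans (lab₂-cong (moves-off (letter-nontrivial sβ e∈ h)) s) (run-τ-snoc sβ e∈ h s)
        by (no e∉) (no e∉α) _ = ⊥-elim (¬f (transᴳ (≡⇒ᴳ (stepQ-out e∉α h)) (qq (R-∉ e∉ h))))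
        by (no e∉) (yes _) (no ¬z) = ⊥-elim (¬f (transᴳ (≡⇒ᴳ (stepQ-free h ¬z)) (qq (R-∉ e∉ h))))
        by (no e∉) (yes e∈α) (yes (x , px , r)) = trans (lab₂-cong (stepQ-zone e∈α px r) s)
          (trans (run-τ-snoc sα e∈α x s) (cong (τ e) (lab₂-link (x , px , R-refl , r) s)))

    lab₂-surj : ∀ x s → ∃ λ r → lab₂ x r ≡ s
    lab₂-surj (inj₁ g) = run-τ-surj sα g
    lab₂-surj (inj₂ h) = run-τ-surj sβ h

    label₂ : Labelling glued
    label₂ = record { lab = lab₂ ; lab-cong = lab₂-cong ; lab-move = lab₂-move ; lab-surj = lab₂-surj }

    private
      -- A moving path may alternate between the two cosets. The invariant condenses it to one path
      -- over `α`, followed in the second coset by one over `β`; `z` is the glued point between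
      -- them.
      data Reached (x : List E) (s : S) (c : C) (t : S) : Set where
        inα : ∀ {g q} → c ≈ᴳ inj₁ g → Path s t q → α ⊩ q → R α g (inv x ++ q) → Reached x s c t
        inβ : ∀ {h q q′ r z} → c ≈ᴳ inj₂ h → Path s r q → Path r t q′ → α ⊩ q → β ⊩ q′ → δ ⊩ z →
              R α (inv x ++ q) z → R β h (z ++ q′) → Reached x s c t

    reach-step : ∀ {x s c t e} → Reached x s c t → ι₁ e ≡ t → ¬ (stepᴳ e c ≈ᴳ c) → Reached x s (stepᴳ e c) (ι₂ e)
    reach-step {x} {s} {c} {t} {e} (inα {g} {q} c≈ path q⊩ r) et ¬f = by (e ∈? α) (zoneP? g) (e ∈? β)
      where
        by : Dec (e ∈ α) → Dec (ZoneP g) → Dec (e ∈ β) → Reached x s (stepᴳ e c) (ι₂ e)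
        by (yes e∈) _ _ = inα (transᴳ (stepᴳ-cong e c≈) (≡⇒ᴳ (stepP-in e∈ g))) (path-++ path (path-letter et)) (Allₚ.∷ʳ⁺ q⊩ e∈)
          (R-trans (R-++ʳ (e ∷ []) r) (R-≡ (Listₚ.++-assoc (inv x) q (e ∷ []))))
        by (no e∉) (no ¬z) _ = ⊥-elim (¬f (transᴳ (stepᴳ-cong e c≈) (transᴳ (≡⇒ᴳ (stepP-out e∉ g ¬z)) (symᴳ c≈))))
        by (no e∉) (yes (z , pz , r′)) (yes e∈β) =
          inβ (transᴳ (stepᴳ-cong e c≈) (stepP-zone e∉ pz r′)) path (path-letter et) q⊩ (e∈β ∷ []) pz (R-trans (R-sym r) r′) R-refl
        by (no e∉) (yes (z , pz , r′)) (no e∉β) = ⊥-elim (¬f (transᴳ (stepᴳ-cong e c≈)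
          (transᴳ (stepP-zone e∉ pz r′) (transᴳ (qp (z , pz , r′ , R-∉ e∉β z)) (symᴳ c≈)))))
    reach-step {x} {s} {c} {t} {e} (inβ {h} {q} {q′} {r} {z} c≈ path path′ q⊩ q⊩′ pz ρ ρ′) et ¬f = by (e ∈? β) (e ∈? α) (zoneQ? h)
      where
        by : Dec (e ∈ β) → Dec (e ∈ α) → Dec (ZoneQ h) → Reached x s (stepᴳ e c) (ι₂ e)
        by (yes e∈) _ _ = inβ (transᴳ (stepᴳ-cong e c≈) (moves-off (letter-nontrivial sβ e∈ h))) path (path-++ path′ (path-letter et))
          q⊩ (Allₚ.∷ʳ⁺ q⊩′ e∈) pz ρ (R-trans (R-++ʳ (e ∷ []) ρ′) (R-≡ (Listₚ.++-assoc z q′ (e ∷ []))))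
        by (no e∉) (no e∉α) _ = ⊥-elim (¬f (transᴳ (stepᴳ-cong e c≈)
          (transᴳ (≡⇒ᴳ (stepQ-out e∉α h)) (transᴳ (qq (R-∉ e∉ h)) (symᴳ c≈)))))
        by (no e∉) (yes _) (no ¬z) = ⊥-elim (¬f (transᴳ (stepᴳ-cong e c≈)
          (transᴳ (≡⇒ᴳ (stepQ-free h ¬z)) (transᴳ (qq (R-∉ e∉ h)) (symᴳ c≈)))))
        -- Back to the first coset: `q′` joins two zone points, hence equals a word over `δ`. By
        -- `path-within` it can be replaced by a path over `δ`, which the part over `α` absorbs.
        by (no e∉) (yes e∈α) (yes (z′ , pz′ , σ)) =
          let pzz = Allₚ.++⁺ (⊩-inv sδ pz) pz′
              q″ , path″ , q⊩″ , ρ″ = path-within sδ path′ pzz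
                (R-cons sβ (λ _ → ∈⊤) q⊩′ (⊩-⊆ δ⊆β pzz) (R-moveˡ sβ z (R-trans (R-sym ρ′) σ)))
              ρα : R α q″ (inv z ++ z′)
              ρα = R-retract sα sym-⊤ (λ _ → ∈⊤) ρ″
              eq : R α (inv x ++ (q ++ q″)) z′
              eq = R-trans (R-≡ (sym (Listₚ.++-assoc (inv x) q q″))) (R-trans (R-++ ρ ρα)
                     (R-trans (R-≡ (sym (Listₚ.++-assoc z (inv z) z′))) (R-++ʳ z′ (R-invʳ sα z))))
          in inα (transᴳ (stepᴳ-cong e c≈) (stepQ-zone e∈α pz′ σ))
               (path-++ (path-++ path path″) (path-letter et))
               (Allₚ.∷ʳ⁺ (Allₚ.++⁺ q⊩ (⊩-⊆ δ⊆α q⊩″)) e∈α)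
               (R-trans (R-++ʳ (e ∷ []) (R-sym eq)) (R-≡ (Listₚ.++-assoc (inv x) (q ++ q″) (e ∷ []))))

    reach : ∀ {x s c t w c′ t′} → Reached x s c t → Moves glued w c c′ → Path t t′ w → Reached x s c′ t′
    reach (inα c≈ a b d) (stop p) [] = inα (transᴳ (symᴳ p) c≈) a b d
    reach (inβ c≈ a b d e f g h) (stop p) [] = inβ (transᴳ (symᴳ p) c≈) a b d e f g h
    reach ρ (move ¬f m) (eq ∷ path) = reach (reach-step ρ eq ¬f) m path

    path-factors : ∀ {s t p x y} → Path s t p → α ⊩ x → β ⊩ y → R ⊤ p (x ++ y) →
                   ∃ λ r → ∃ λ q → ∃ λ q′ → Path s r q × α ⊩ q × Path r t q′ × β ⊩ q′ × R ⊤ (q ++ q′) p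
    path-factors {s} {t} {p} {x} {y} path px py r = conclude
        (reach {x = x} (inα {q = []} (pp (R-≡ (sym (Listₚ.++-identityʳ (inv x))))) [] [] R-refl)
          (proj₁ (proj₂ connected)) (proj₂ (proj₂ connected)))
      where
        up : ∀ {u v} → α ⊩ u → α ⊩ v → R α u v → R ⊤ u v
        up = R-cons sα (λ _ → ∈⊤)
        up′ : ∀ {u v} → β ⊩ u → β ⊩ v → R β u v → R ⊤ u v
        up′ = R-cons sβ (λ _ → ∈⊤)
        -- From `inv x` the word `x` leads exactly to the glued point `[]`, from which `y` runs in
        -- the second coset.
        start : C
        start = inj₁ (inv x)
        moves : Moves glued (x ++ y) start (inj₂ y)
        moves = moves-++ (base-moves ray sα px (inv x))
          (moves-cong {x = inj₂ []} (pq ([] , [] , R-invˡ sα x , R-refl))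
            (lift-moves sα sβ [] Q (λ _ _ ()) (base-moves Q sβ py [])))
        connected : Conn glued (start , s) (inj₂ y , t)
        connected = Sync.connect ray 2≤D label₂ path r moves
        conclude : Reached x s (inj₂ y) t →
                   ∃ λ r → ∃ λ q → ∃ λ q′ → Path s r q × α ⊩ q × Path r t q′ × β ⊩ q′ × R ⊤ (q ++ q′) p
        conclude (inα {g} {q} (qp (z , pz , ρ , σ)) path′ q⊩ ρ′) =
          t , q , [] , path′ , q⊩ , [] , []
          , R-trans (R-≡ (Listₚ.++-identityʳ q))
              (R-trans (up q⊩ (Allₚ.++⁺ px (⊩-⊆ δ⊆α pz)) q~xz)
                (R-trans (R-++ˡ x (up′ (⊩-⊆ δ⊆β pz) py (R-sym σ))) (R-sym r)))
          where
            q~xz : R α q (x ++ z)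
            q~xz = R-trans (R-sym (R-inv-cancelˡ sα (inv x) q)) (R-trans (R-≡ (cong (_++ (inv x ++ q)) (inv-inv x)))
                     (R-++ˡ x (R-trans (R-sym ρ′) ρ)))
        conclude (inβ {h} {q} {q′} {r′} {z} (qq σ) path₁ path₂ q⊩ q⊩′ pz ρ ρ′) =
          r′ , q , q′ , path₁ , q⊩ , path₂ , q⊩′
          , R-trans (R-++ʳ q′ (up q⊩ (Allₚ.++⁺ px (⊩-⊆ δ⊆α pz)) q~xz))
              (R-trans (R-≡ (Listₚ.++-assoc x z q′))
                (R-trans (R-++ˡ x (up′ (Allₚ.++⁺ (⊩-⊆ δ⊆β pz) q⊩′) py (R-sym (R-trans σ ρ′)))) (R-sym r)))
          where
            q~xz : R α q (x ++ z)
            q~xz = R-trans (R-sym (R-inv-cancelˡ sα (inv x) q)) (R-trans (R-≡ (cong (_++ (inv x ++ q)) (inv-inv x)))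
                     (R-++ˡ x ρ))

-- Invariance of the congruences under automorphisms of the pattern.

module Invariance (I : Pattern) (b₀ D : ℕ) where
  open Letters I
  open System I b₀ D

  module _ (ρ : Automorphism I) where
    open Automorphism ρ

    ρₑ⁻ : E → E
    ρₑ⁻ = Inverse.from ρE

    ρₑ-ρₑ⁻ : ∀ e → ρₑ (ρₑ⁻ e) ≡ e
    ρₑ-ρₑ⁻ = Inverse.strictlyInverseˡ ρE

    ρₑ⁻-ρₑ : ∀ e → ρₑ⁻ (ρₑ e) ≡ e
    ρₑ⁻-ρₑ = Inverse.strictlyInverseʳ ρE

    image : Subset nE → Subset nE
    image γ = Vec.tabulate (λ e → Vec.lookup γ (ρₑ⁻ e))

    ∈-image⁺ : ∀ {γ e} → e ∈ γ → ρₑ e ∈ image γ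
    ∈-image⁺ {γ} {e} p = Vecₚ.lookup⇒[]= (ρₑ e) (image γ)
      (trans (Vecₚ.lookup∘tabulate (λ e → Vec.lookup γ (ρₑ⁻ e)) (ρₑ e))
        (trans (cong (Vec.lookup γ) (ρₑ⁻-ρₑ e)) (Vecₚ.[]=⇒lookup p)))

    ∈-image⁻ : ∀ {γ e} → e ∈ image γ → ρₑ⁻ e ∈ γ
    ∈-image⁻ {γ} {e} p = Vecₚ.lookup⇒[]= (ρₑ⁻ e) γ
      (trans (sym (Vecₚ.lookup∘tabulate (λ e → Vec.lookup γ (ρₑ⁻ e)) e)) (Vecₚ.[]=⇒lookup p))

    ∈-image⁻′ : ∀ {γ e} → ρₑ e ∈ image γ → e ∈ γ
    ∈-image⁻′ {γ} {e} p = subst (_∈ γ) (ρₑ⁻-ρₑ e) (∈-image⁻ p)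

    image-⊂ : ∀ {δ γ} → δ ⊂ γ → image δ ⊂ image γ
    image-⊂ {δ} {γ} (δ⊆γ , e , p , q) =
      (λ {e} r → subst (_∈ image γ) (ρₑ-ρₑ⁻ e) (∈-image⁺ (δ⊆γ (∈-image⁻ r)))) , ρₑ e , ∈-image⁺ p , λ r → q (∈-image⁻′ r)

    image-sym : ∀ {γ} → Sym γ → Sym (image γ)
    image-sym {γ} sγ e p = subst (_∈ image γ) (trans (ρ-⁻¹ (ρₑ⁻ e)) (cong _⁻¹ (ρₑ-ρₑ⁻ e))) (∈-image⁺ (sγ _ (∈-image⁻ p)))

    indicator : ∀ {n} → Subset n → Fin n → ℕ
    indicator γ e = if Vec.lookup γ e then 1 else 0

    card-sum : ∀ {n} (γ : Subset n) → ∣ γ ∣ ≡ Sum.sum (indicator γ)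
    card-sum Vec.[] = refl
    card-sum (true  Vec.∷ γ) = cong suc (card-sum γ)
    card-sum (false Vec.∷ γ) = card-sum γ

    -- A cardinality is a sum of indicators, which a permutation of the letters preserves. Hence `γ`
    -- and its image have test actions of the same size.
    card-image : ∀ γ → ∣ image γ ∣ ≡ ∣ γ ∣
    card-image γ = trans (card-sum (image γ)) (trans (Sum.sum-permute (indicator (image γ)) ρE)
      (trans (Sum.sum-cong-≗ λ e → cong (if_then 1 else 0)
        (trans (Vecₚ.lookup∘tabulate (λ e → Vec.lookup γ (ρₑ⁻ e)) (ρₑ e)) (cong (Vec.lookup γ) (ρₑ⁻-ρₑ e))))
        (sym (card-sum γ))))

    run-image : ∀ {A : Set} γ (st : E → A → A) w a → run γ (λ e → st (ρₑ e)) w a ≡ run (image γ) st (map ρₑ w) a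
    run-image γ st []      a = refl
    run-image γ st (e ∷ w) a with e ∈? γ
    ... | yes p = trans (run-image γ st w _) (cong (run (image γ) st (map ρₑ w)) (sym (step-in-∈ (∈-image⁺ p) st a)))
    ... | no ¬p = trans (run-image γ st w _) (cong (run (image γ) st (map ρₑ w)) (sym (step-in-∉ (λ q → ¬p (∈-image⁻′ q)) st a)))

    -- A good action for `image γ`, precomposed with `ρₑ`, is a good action for `γ`: the induction
    -- hypothesis carries `R δ` to the image of `δ`.
    R-image : ∀ {γ} → Sym γ → ∀ {u u′} → R γ u u′ → R (image γ) (map ρₑ u) (map ρₑ u′)
    R-image {γ} sγ {u} {u′} = go γ (⊂-wellFounded γ) sγ u u′
      where
        go : ∀ γ → Acc _⊂_ γ → Sym γ → ∀ u u′ → R γ u u′ → R (image γ) (map ρₑ u) (map ρₑ u′)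
        go γ (acc rs) sγ u u′ r = R-intro λ c g →
          elim c g (cong (λ k → testSize (below k)) (sym (card-image γ)))
          where
            elim : ∀ {b} (c : Code b) → Good (image γ) c → size γ ≡ b → Agree (image γ) c (map ρₑ u) (map ρₑ u′)
            elim c (ic , good) refl v = trans (sym (along u v)) (trans (R-elim r c′ (ic′ , good′) v) (along u′ v))
              where
                moved : E → Fin (size γ) → Fin (size γ)
                moved e = act c (ρₑ e)
                c′ : Code (size γ)
                c′ = encode moved
                along : ∀ {δ} w v → run δ (act c′) w v ≡ run (image δ) (act c) (map ρₑ w) v
                along {δ} w v = trans (run-≗ δ (act-encode moved) w v) (run-image δ (act c) w v)
                ic′ : Invertible c′
                ic′ e v = trans (act-encode moved (e ⁻¹) _) (trans (cong (moved (e ⁻¹)) (act-encode moved e v))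
                  (trans (cong (λ e′ → act c e′ (act c (ρₑ e) v)) (ρ-⁻¹ e)) (ic (ρₑ e) v)))
                good′ : ∀ δ → δ ⊂ γ → Sym δ → ∀ w w′ → R δ w w′ → Agree δ c′ w w′
                good′ δ lt sδ w w′ r v = trans (along w v)
                  (trans (good (image δ) (image-⊂ lt) (image-sym sδ) _ _ (go δ (rs lt) sδ w w′ r) v) (sym (along w′ v)))

    R⊤-image : ∀ {u u′} → R ⊤ u u′ → R ⊤ (map ρₑ u) (map ρₑ u′)
    R⊤-image {u} {u′} r = subst (λ γ → R γ (map ρₑ u) (map ρₑ u′)) (⊆-antisym (λ _ → ∈⊤) (λ {e} _ → subst (_∈ image ⊤) (ρₑ-ρₑ⁻ e) (∈-image⁺ ∈⊤))) (R-image sym-⊤ r)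

-- Finite quotients by decidable equivalences.

record Quotient {A : Set} (_≈_ : A → A → Set) : Set where
  field
    card      : ℕ
    rep       : Fin card → A
    cls       : A → Fin card
    rep-cls   : ∀ a → rep (cls a) ≈ a
    rep-inj   : ∀ {i j} → rep i ≈ rep j → i ≡ j

finite-quotient : {A : Set} (_≈_ : A → A → Set) → (∀ {x} → x ≈ x) → (∀ {x y} → x ≈ y → y ≈ x) →
                  (∀ {x y z} → x ≈ y → y ≈ z → x ≈ z) → (∀ x y → Dec (x ≈ y)) →
                  (xs : List A) → (∀ a → Any (a ≈_) xs) → Quotient _≈_
finite-quotient {A} _≈_ ≈-refl ≈-sym ≈-trans _≈?_ xs cover = record
  { card = length (nub xs) ; rep = lookup (nub xs) ; cls = λ a → Any.index (nub-cover xs (cover a))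
  ; rep-cls = λ a → ≈-sym (Anyₚ.lookup-index (nub-cover xs (cover a)))
  ; rep-inj = distinct (nub-distinct xs) _ _ }
  where
    nub : List A → List A
    nub [] = []
    nub (x ∷ xs) with Any.any? (x ≈?_) (nub xs)
    ... | yes _ = nub xs
    ... | no _  = x ∷ nub xs
    nub-cover : ∀ xs {a} → Any (a ≈_) xs → Any (a ≈_) (nub xs)
    nub-cover (x ∷ xs) p with Any.any? (x ≈?_) (nub xs)
    nub-cover (x ∷ xs) (here p)  | yes q = Any.map (≈-trans p) q
    nub-cover (x ∷ xs) (there p) | yes q = nub-cover xs p
    nub-cover (x ∷ xs) (here p)  | no _  = here p
    nub-cover (x ∷ xs) (there p) | no _  = there (nub-cover xs p)
    nub-distinct : ∀ xs → AllPairs (λ x y → ¬ (x ≈ y)) (nub xs)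
    nub-distinct [] = []
    nub-distinct (x ∷ xs) with Any.any? (x ≈?_) (nub xs)
    ... | yes _ = nub-distinct xs
    ... | no ¬p = Allₚ.¬Any⇒All¬ (nub xs) ¬p ∷ nub-distinct xs
    distinct : ∀ {ys} → AllPairs (λ x y → ¬ (x ≈ y)) ys → ∀ i j → lookup ys i ≈ lookup ys j → i ≡ j
    distinct (p ∷ ps) zero    zero    q = refl
    distinct {y ∷ ys} (p ∷ ps) zero (suc j) q = ⊥-elim (All.lookup p (∈-lookup j) q)
    distinct {y ∷ ys} (p ∷ ps) (suc i) zero q = ⊥-elim (All.lookup p (∈-lookup i) (≈-sym q))
    distinct (p ∷ ps) (suc i) (suc j) q = cong suc (distinct ps i j q)

-- The groupoid of paths modulo `R ⊤`, and its compatibility.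

module Construction (I : Pattern) (ℍ : CompleteIGraph I) (k : ℕ) (V↔ : CompleteIGraph.V ℍ ↔ Fin k) (N : ℕ) (2≤N : 2 ≤ N) where
  open Letters I
  open CompleteIGraph ℍ hiding (R)

  -- Room for the small actions: on three points, on `S` and on the `k` vertices.
  b₀ : ℕ
  b₀ = 3 + (nS + k)

  3≤b₀ : 3 ≤ b₀
  3≤b₀ = ℕₚ.m≤m+n 3 (nS + k)

  nS≤b₀ : nS ≤ b₀
  nS≤b₀ = ℕₚ.≤-trans (ℕₚ.m≤m+n nS k) (ℕₚ.m≤n+m (nS + k) 3)

  k≤b₀ : k ≤ b₀
  k≤b₀ = ℕₚ.≤-trans (ℕₚ.m≤n+m k nS) (ℕₚ.m≤n+m (nS + k) 3)

  1≤N : 1 ≤ N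
  1≤N = ℕₚ.≤-trans (s≤s z≤n) 2≤N

  open System I b₀ N
  open Pieces I b₀ N 1≤N 3≤b₀ nS≤b₀
  open Synchronised I b₀ N 1≤N 3≤b₀ nS≤b₀

  -- G_{s,t} consists of the classes of the walks from s to t modulo R ⊤.
  record Walk : Set where
    constructor walk
    field
      from : S
      to   : S
      word : List E
      path : Path from to word
  open Walk

  infix 4 _≋_
  _≋_ : Walk → Walk → Set
  a ≋ b = from a ≡ from b × to a ≡ to b × R ⊤ (word a) (word b)

  short-path : ∀ s t w → Path s t w → ∃ λ w′ → length w′ ≤ index ⊤ * nS × Path s t w′ × R ⊤ w w′
  short-path s t = shorten state (Path s t) (R ⊤) R-refl R-trans λ a b c eq p →
      let eq₁ , eq₂ = Finₚ.combine-injective (classify ⊤ a) (target s a) (classify ⊤ (a ++ b)) (target s (a ++ b)) eq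
      in path-cut a b eq₂ p , R-trans (R-≡ (sym (Listₚ.++-assoc a b c))) (R-++ʳ c (R-sym (classify-R ⊤ eq₁)))
    where
      state : List E → Fin (index ⊤ * nS)
      state w = combine (classify ⊤ w) (target s w)

  collect : List (S × S × List E) → List Walk
  collect [] = []
  collect ((s , t , w) ∷ l) with path? s t w
  ... | yes p = walk s t w p ∷ collect l
  ... | no _  = collect l

  collect-complete : ∀ {s t w} l → (s , t , w) ∈ˡ l → Path s t w →
                     Any (λ a → s ≡ from a × t ≡ to a × w ≡ word a) (collect l)
  collect-complete ((s , t , w) ∷ l) m p with path? s t w
  collect-complete (_ ∷ l) (here refl) p | yes _ = here (refl , refl , refl)
  collect-complete (_ ∷ l) (here refl) p | no ¬p = ⊥-elim (¬p p)
  collect-complete (_ ∷ l) (there m)   p | yes _ = there (collect-complete l m p)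
  collect-complete (_ ∷ l) (there m)   p | no _  = collect-complete l m p

  abstract
    walks : Quotient _≋_
    walks = finite-quotient _≋_ (refl , refl , R-refl) (λ (p , q , r) → sym p , sym q , R-sym r)
      (λ (p , q , r) (p′ , q′ , r′) → trans p p′ , trans q q′ , R-trans r r′)
      (λ a b → (from a ≟ from b) ×-dec ((to a ≟ to b) ×-dec R? ⊤ (word a) (word b)))
      (collect candidates) λ (walk s t w p) →
        let w′ , l , p′ , r = short-path s t w p
        in Any.map (λ (q₁ , q₂ , q₃) → q₁ , q₂ , R-trans r (R-≡ q₃))
             (collect-complete candidates (∈-cartesianProductWith⁺ _,_ (∈-allFin s)
               (∈-cartesianProductWith⁺ _,_ (∈-allFin t) (∈-words _ w′ l))) p′)
      where
        candidates : List (S × S × List E)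
        candidates = cartesianProductWith _,_ (allFin nS) (cartesianProductWith _,_ (allFin nS) (words nE (index ⊤ * nS)))

  open Quotient walks

  Elt : Set
  Elt = Fin card

  src tgt : Elt → S
  src g = from (rep g)
  tgt g = to (rep g)

  wd : Elt → List E
  wd g = word (rep g)

  wd-path : ∀ g → Path (src g) (tgt g) (wd g)
  wd-path g = path (rep g)

  class : ∀ {s t w} → Path s t w → Elt
  class p = cls (walk _ _ _ p)

  module _ {s t w} (p : Path s t w) where
    class-src : src (class p) ≡ s
    class-src = proj₁ (rep-cls (walk s t w p))
    class-tgt : tgt (class p) ≡ t
    class-tgt = proj₁ (proj₂ (rep-cls (walk s t w p)))
    class-wd : R ⊤ (wd (class p)) w
    class-wd = proj₂ (proj₂ (rep-cls (walk s t w p)))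

  elt-≡ : ∀ {g h} → src g ≡ src h → tgt g ≡ tgt h → R ⊤ (wd g) (wd h) → g ≡ h
  elt-≡ p q r = rep-inj (p , q , r)

  infixl 7 _·_
  _·_ : Elt → Elt → Elt
  g · h with tgt g ≟ src h
  ... | yes eq = class (path-++ (wd-path g) (subst (λ s → Path s (tgt h) (wd h)) (sym eq) (wd-path h)))
  -- A default value for pairs that are not composable.
  ... | no _   = g

  module _ {g h} (eq : tgt g ≡ src h) where
    ·-path : Path (src g) (tgt h) (wd g ++ wd h)
    ·-path = path-++ (wd-path g) (subst (λ s → Path s (tgt h) (wd h)) (sym eq) (wd-path h))

    ·-≋ : rep (g · h) ≋ walk (src g) (tgt h) (wd g ++ wd h) ·-path
    ·-≋ with tgt g ≟ src h
    ... | yes eq′ = rep-cls (walk _ _ _ (path-++ (wd-path g) (subst (λ s → Path s (tgt h) (wd h)) (sym eq′) (wd-path h))))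
    ... | no ¬eq = ⊥-elim (¬eq eq)

    ·-srcᴳ : src (g · h) ≡ src g
    ·-srcᴳ = proj₁ ·-≋

    ·-tgtᴳ : tgt (g · h) ≡ tgt h
    ·-tgtᴳ = proj₁ (proj₂ ·-≋)

    ·-wd : R ⊤ (wd (g · h)) (wd g ++ wd h)
    ·-wd = proj₂ (proj₂ ·-≋)

  𝟙ᴳ : S → Elt
  𝟙ᴳ s = class {s} []

  genᴳ : E → Elt
  genᴳ e = class (path-letter {e} refl)

  eval : List E → S → Elt
  eval = evalWord I _·_ 𝟙ᴳ genᴳ

  eval-≋ : ∀ {s t w} (p : Path s t w) → rep (eval w s) ≋ walk s t w p
  eval-≋ [] = rep-cls _
  eval-≋ {s} {t} {e ∷ w} (q ∷ p) =
    let s′ , t′ , r′ = eval-≋ p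
        eq = trans (class-tgt (path-letter {e} refl)) (sym s′)
    in trans (·-srcᴳ eq) (trans (class-src (path-letter {e} refl)) q) , trans (·-tgtᴳ eq) t′
       , R-trans (·-wd eq) (R-++ (class-wd (path-letter {e} refl)) r′)

  assocᴳ : ∀ g h k → tgt g ≡ src h → tgt h ≡ src k → (g · h) · k ≡ g · (h · k)
  assocᴳ g h k p q =
    elt-≡ (trans (·-srcᴳ p′) (trans (·-srcᴳ p) (sym (·-srcᴳ q′)))) (trans (·-tgtᴳ p′) (sym (trans (·-tgtᴳ q′) (·-tgtᴳ q))))
      (R-trans (·-wd p′) (R-trans (R-++ʳ (wd k) (·-wd p)) (R-trans (R-≡ (Listₚ.++-assoc (wd g) (wd h) (wd k)))
        (R-sym (R-trans (·-wd q′) (R-++ˡ (wd g) (·-wd q)))))))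
    where
      p′ = trans (·-tgtᴳ p) q
      q′ = trans p (sym (·-srcᴳ q))

  left-unit : ∀ g → 𝟙ᴳ (src g) · g ≡ g
  left-unit g = elt-≡ (trans (·-srcᴳ p) (class-src _)) (·-tgtᴳ p) (R-trans (·-wd p) (R-++ʳ (wd g) (class-wd [])))
    where p = class-tgt {src g} []

  right-unit : ∀ g → g · 𝟙ᴳ (tgt g) ≡ g
  right-unit g = elt-≡ (·-srcᴳ p) (trans (·-tgtᴳ p) (class-tgt _))
      (R-trans (·-wd p) (R-trans (R-++ˡ (wd g) (class-wd [])) (R-≡ (Listₚ.++-identityʳ (wd g)))))
    where p = sym (class-src {tgt g} [])

  gen-cancel : ∀ e → genᴳ e · genᴳ (e ⁻¹) ≡ 𝟙ᴳ (ι₁ e)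
  gen-cancel e = elt-≡ (trans (·-srcᴳ p) (trans (class-src _) (sym (class-src _))))
      (trans (·-tgtᴳ p) (trans (class-tgt _) (trans (ι₂-⁻¹ e) (sym (class-tgt _)))))
      (R-trans (·-wd p) (R-trans (R-++ (class-wd _) (class-wd _)) (R-trans (R-cancel sym-⊤ e) (R-sym (class-wd [])))))
    where p = trans (class-tgt _) (trans (sym (ι₁-⁻¹ e)) (sym (class-src _)))

  𝔾 : IGroupoid I
  𝔾 = record
    { G = Elt ; src = src ; tgt = tgt ; _·_ = _·_
    ; ·-src = λ g h → ·-srcᴳ ; ·-tgt = λ g h → ·-tgtᴳ ; ·-assoc = assocᴳ
    ; 𝟙 = 𝟙ᴳ ; 𝟙-src = λ s → class-src [] ; 𝟙-tgt = λ s → class-tgt []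
    ; 𝟙-left = left-unit ; 𝟙-right = right-unit
    ; gen = genᴳ ; gen-src = λ e → class-src _ ; gen-tgt = λ e → class-tgt _
    ; gen-distinct = λ {e} {e′} eq → letters-distinct
        (R-trans (R-sym (class-wd _)) (subst (λ g → R ⊤ (wd g) (e′ ∷ [])) (sym eq) (class-wd _)))
    ; gen-invˡ = gen-cancel
    ; gen-invʳ = λ e → subst₂ (λ e′ s → genᴳ (e ⁻¹) · genᴳ e′ ≡ 𝟙ᴳ s) (⁻¹-invol e) (ι₁-⁻¹ e) (gen-cancel (e ⁻¹))
    ; generated = λ g → wd g , wd-path g , (let p , q , r = eval-≋ (wd-path g) in elt-≡ p q r) }

  -- Makes a permutation of all of V from π_e, which acts on V_{ι₁ e} only, so that words which are no paths act as well.
  vertex-step : E → V → V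
  vertex-step e v with part v ≟ ι₁ e | part v ≟ ι₂ e
  ... | yes _ | _     = π e v
  ... | no _  | yes _ = π (e ⁻¹) v
  ... | no _  | no _  = v

  vertex-step-ι₁ : ∀ e v → part v ≡ ι₁ e → vertex-step e v ≡ π e v
  vertex-step-ι₁ e v p with part v ≟ ι₁ e | part v ≟ ι₂ e
  ... | yes _ | _ = refl
  ... | no ¬p | _ = ⊥-elim (¬p p)

  vertex-step-ι₂ : ∀ e v → part v ≢ ι₁ e → part v ≡ ι₂ e → vertex-step e v ≡ π (e ⁻¹) v
  vertex-step-ι₂ e v ¬p q with part v ≟ ι₁ e | part v ≟ ι₂ e
  ... | yes p | _     = ⊥-elim (¬p p)
  ... | no _  | yes _ = refl
  ... | no _  | no ¬q = ⊥-elim (¬q q)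

  vertex-step-other : ∀ e v → part v ≢ ι₁ e → part v ≢ ι₂ e → vertex-step e v ≡ v
  vertex-step-other e v ¬p ¬q with part v ≟ ι₁ e | part v ≟ ι₂ e
  ... | yes p | _     = ⊥-elim (¬p p)
  ... | no _  | yes q = ⊥-elim (¬q q)
  ... | no _  | no _  = refl

  vertex-step-inv : ∀ e v → vertex-step (e ⁻¹) (vertex-step e v) ≡ v
  vertex-step-inv e v = by (part v ≟ ι₁ e) (part v ≟ ι₂ e)
    where
      by : Dec (part v ≡ ι₁ e) → Dec (part v ≡ ι₂ e) → vertex-step (e ⁻¹) (vertex-step e v) ≡ v
      by (yes p) _ = trans (cong (vertex-step (e ⁻¹)) (vertex-step-ι₁ e v p))
        (trans (vertex-step-ι₁ (e ⁻¹) (π e v) (trans (π-tgt e v p) (sym (ι₁-⁻¹ e)))) (π-inv e v p))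
      by (no ¬p) (yes q) = trans (cong (vertex-step (e ⁻¹)) (vertex-step-ι₂ e v ¬p q))
        (trans (vertex-step-ι₂ (e ⁻¹) v′ ¬loop (π-tgt (e ⁻¹) v q′)) (π-inv (e ⁻¹) v q′))
        where
          v′ = π (e ⁻¹) v
          q′ : part v ≡ ι₁ (e ⁻¹)
          q′ = trans q (sym (ι₁-⁻¹ e))
          ¬loop : part v′ ≢ ι₁ (e ⁻¹)
          ¬loop r = ¬p (trans q′ (trans (sym r) (trans (π-tgt (e ⁻¹) v q′) (ι₂-⁻¹ e))))
      by (no ¬p) (no ¬q) = trans (cong (vertex-step (e ⁻¹)) (vertex-step-other e v ¬p ¬q))
        (vertex-step-other (e ⁻¹) v (λ p → ¬q (trans p (ι₁-⁻¹ e))) (λ q → ¬p (trans q (ι₂-⁻¹ e))))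

  Vertices : FSet
  Vertices = record
    { Carrier = V ; _≈_ = _≡_ ; ≈-refl = refl ; ≈-sym = sym ; ≈-trans = trans
    ; _≈?_ = λ v v′ → map′ (λ p → trans (sym (Inverse.strictlyInverseʳ V↔ v)) (trans (cong (Inverse.from V↔) p) (Inverse.strictlyInverseʳ V↔ v′)))
                        (cong (Inverse.to V↔)) (Inverse.to V↔ v ≟ Inverse.to V↔ v′)
    ; step = vertex-step ; step-cong = λ e → cong (vertex-step e) ; step-inv = vertex-step-inv }

  run-vertices : ∀ {s t w} → Path s t w → ∀ v → part v ≡ s → run ⊤ vertex-step w v ≡ ⟦ w ⟧H v
  run-vertices [] v eq = refl
  run-vertices {w = e ∷ w} (p ∷ ps) v eq =
    trans (cong (run ⊤ vertex-step w) (trans (step-in-∈ ∈⊤ vertex-step v) (vertex-step-ι₁ e v v∈)))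
      (run-vertices ps (π e v) (π-tgt e v v∈))
    where v∈ = trans eq (sym p)

  compatible : Compatible I 𝔾 ℍ
  compatible s w (p , _) eq v v∈ = trans (sym (run-vertices p v v∈))
    (Small.respects Vertices (map (Inverse.from V↔) (allFin k))
      (ℕₚ.≤-trans (ℕₚ.≤-reflexive (trans (Listₚ.length-map (Inverse.from V↔) (allFin k)) (Listₚ.length-tabulate id))) k≤b₀)
      (λ v → lose (∈-map⁺ (Inverse.from V↔) (∈-allFin (Inverse.to V↔ v))) (sym (Inverse.strictlyInverseʳ V↔ v)))
      sym-⊤ trivial v)
    where
      trivial : R ⊤ w []
      trivial = R-trans (R-sym (proj₂ (proj₂ (eval-≋ p)))) (subst (λ g → R ⊤ (wd g) []) (sym eq) (class-wd []))

-- Acyclicity and symmetry of the groupoid.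

module Acyclicity (I : Pattern) (ℍ : CompleteIGraph I) (k : ℕ) (V↔ : CompleteIGraph.V ℍ ↔ Fin k) (N : ℕ) (2≤N : 2 ≤ N) where
  open Letters I
  open Construction I ℍ k V↔ N 2≤N
  open System I b₀ N
  open Pieces I b₀ N 1≤N 3≤b₀ nS≤b₀
  open Chains I b₀ N 1≤N 3≤b₀ nS≤b₀
  open Synchronised I b₀ N 1≤N 3≤b₀ nS≤b₀
  open PathProperty I b₀ N 2≤N 3≤b₀ nS≤b₀ using (path-within; path-factors)
  open Invariance I b₀ N
  open IGroupoid 𝔾 using (_∈Coset[_,_]; nxt; prv; CosetCycle; Acyclic)

  -- Cosets are defined by reduced words, the congruence by arbitrary ones; free cancellation does
  -- not change the class.
  reduce : ∀ {α s t} w → Path s t w → α ⊩ w → ∃ λ w′ → Word I s t w′ × α ⊩ w′ × R ⊤ w w′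
  reduce [] p q = [] , (p , []) , [] , R-refl
  reduce {α} {s} {t} (e ∷ w) (p ∷ ps) (q ∷ qs) with reduce w ps qs
  ... | [] , (p′ , _) , q′ , r = e ∷ [] , (p ∷ p′ , [-]) , q ∷ [] , R-++ˡ (e ∷ []) r
  ... | e′ ∷ w′ , (p₁ ∷ p′ , red) , q₁ ∷ q′ , r with e′ ≟ e ⁻¹
  ...   | no e′≢ = e ∷ e′ ∷ w′ , (p ∷ p₁ ∷ p′ , e′≢ ∷ red) , q ∷ q₁ ∷ q′ , R-++ˡ (e ∷ []) r
  ...   | yes refl = w′ , (subst (λ s → Path s t w′) (trans (ι₂-⁻¹ e) p) p′ , tail red) , q′
                   , R-trans (R-++ˡ (e ∷ []) r) (R-++ʳ w′ (R-cancel sym-⊤ e))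
    where
      tail : ∀ {e w} → Reduced I (e ∷ w) → Reduced I w
      tail [-]     = []
      tail (_ ∷ l) = l

  ∈coset : ∀ {α g h p} → Path (tgt g) (tgt h) p → α ⊩ p → src h ≡ src g → R ⊤ (wd h) (wd g ++ p) → h ∈Coset[ g , α ]
  ∈coset {α} {g} {h} {p} path p∈ eq r with reduce p path p∈
  ... | w , (pw , red) , w∈ , rw = tgt h , w , (pw , red) , w∈ ,
        elt-≡ (trans eq (sym (·-srcᴳ link))) (sym (trans (·-tgtᴳ link) t′))
          (R-trans r (R-trans (R-++ˡ (wd g) (R-trans rw (R-sym r′))) (R-sym (·-wd link))))
    where
      s′ = proj₁ (eval-≋ pw)
      t′ = proj₁ (proj₂ (eval-≋ pw))
      r′ = proj₂ (proj₂ (eval-≋ pw))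
      link : tgt g ≡ src (eval w (tgt g))
      link = sym s′

  coset-word : ∀ {α g h} → h ∈Coset[ g , α ] →
               ∃ λ w → α ⊩ w × Path (tgt g) (tgt h) w × src h ≡ src g × R ⊤ (wd h) (wd g ++ w)
  coset-word {α} {g} (t , w , (p , _) , w∈ , refl) =
    let s′ , t′ , r′ = eval-≋ p
        link = sym s′
    in w , w∈ , subst (λ t → Path (tgt g) t w) (sym (trans (·-tgtᴳ link) t′)) p , ·-srcᴳ link
       , R-trans (·-wd link) (R-++ˡ (wd g) r′)

  module Cycle (m : ℕ) (cyc : CosetCycle m) where
    open CosetCycle cyc

    n : ℕ
    n = suc (suc m)

    step-word : Fin n → List E
    step-word i = proj₁ (coset-word (connectivity i))

    step-∈ : ∀ i → α i ⊩ step-word i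
    step-∈ i = proj₁ (proj₂ (coset-word (connectivity i)))

    step-path : ∀ i → Path (tgt (g i)) (tgt (g (nxt i))) (step-word i)
    step-path i = proj₁ (proj₂ (proj₂ (coset-word (connectivity i))))

    step-src : ∀ i → src (g (nxt i)) ≡ src (g i)
    step-src i = proj₁ (proj₂ (proj₂ (proj₂ (coset-word (connectivity i)))))

    step-R : ∀ i → R ⊤ (wd (g (nxt i))) (wd (g i) ++ step-word i)
    step-R i = proj₂ (proj₂ (proj₂ (proj₂ (coset-word (connectivity i)))))

    -- The element reached from `g i` by `q` is also reached from `g (nxt i)` by `inv q′`, so it
    -- would lie in both cosets that separation keeps disjoint.
    not-factored : ∀ i {r q q′} → Path (tgt (g i)) r q → (α i ∩ α (prv i)) ⊩ q → Path r (tgt (g (nxt i))) q′ → (α i ∩ α (nxt i)) ⊩ q′ →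
                   ¬ R ⊤ (q ++ q′) (step-word i)
    not-factored i {r} {q} {q′} p q∈ p′ q′∈ rel = separation i
      ( x
      , ∈coset (subst (λ t → Path (tgt (g i)) t q) (sym (class-tgt px)) p) q∈ (class-src px) (class-wd px)
      , ∈coset (subst (λ t → Path (tgt (g (nxt i))) t (inv q′)) (sym (class-tgt px)) (path-inv p′))
          (⊩-inv (sym-∩ (α-sym i) (α-sym (nxt i))) q′∈)
          (trans (class-src px) (sym (step-src i)))
          (R-trans (class-wd px) (R-moveʳ sym-⊤ (wd (g i) ++ q) q′
            (R-trans (R-≡ (Listₚ.++-assoc (wd (g i)) q q′)) (R-trans (R-++ˡ (wd (g i)) rel) (R-sym (step-R i)))))) )
      where
        px : Path (src (g i)) r (wd (g i) ++ q)
        px = path-++ (wd-path (g i)) p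
        x : Elt
        x = class px

    segment : Fin n → Segment
    segment i = record { set = α i ; symm = α-sym i ; word = step-word i ; fits = step-∈ i }

    not-separable : ∀ i → ¬ Separable (segment (prv i)) (segment i) (segment (nxt i))
    not-separable i (x , y , x∈ , y∈ , r) =
      let _ , q , q′ , p , q∈ , p′ , q′∈ , rel = path-factors
            (sym-∩ (α-sym i) (α-sym (prv i))) (sym-∩ (α-sym i) (α-sym (nxt i))) (step-path i)
            x∈′ y∈ (R-cons (α-sym i) (λ _ → ∈⊤) (step-∈ i)
              (Allₚ.++⁺ (⊩-⊆ (∩⊆ˡ {α i} {α (prv i)}) x∈′) (⊩-⊆ (∩⊆ˡ {α i} {α (nxt i)}) y∈)) r)
      in not-factored i p q∈ p′ q′∈ rel
      where
        x∈′ : (α i ∩ α (prv i)) ⊩ x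
        x∈′ = ⊩-∩ (⊩-⊆ (∩⊆ʳ {α (prv i)} {α i}) x∈) (⊩-⊆ (∩⊆ˡ {α (prv i)} {α i}) x∈)

    %-absorb : ∀ a c → (a % n + c) % n ≡ (a + c) % n
    %-absorb a c = trans (sym ([m+kn]%n≡m%n (a % n + c) (a / n) n)) (cong (_% n)
      (trans (ℕₚ.+-assoc (a % n) c _) (trans (cong (a % n +_) (ℕₚ.+-comm c _))
        (trans (sym (ℕₚ.+-assoc (a % n) _ c)) (cong (_+ c) (sym (m≡m%n+[m/n]*n a n)))))))

    toℕ-mod : ∀ a → toℕ (a mod n) ≡ a % n
    toℕ-mod a = Finₚ.toℕ-fromℕ< (m%n<n a n)

    mod-cong : ∀ {a b} → a % n ≡ b % n → a mod n ≡ b mod n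
    mod-cong {a} {b} eq = Finₚ.toℕ-injective (trans (toℕ-mod a) (trans eq (sym (toℕ-mod b))))

    nxt-mod : ∀ j → nxt (j mod n) ≡ suc j mod n
    nxt-mod j = mod-cong {suc (toℕ (j mod n))} {suc j} (trans (cong (λ a → suc a % n) (toℕ-mod j))
      (trans (cong (_% n) (ℕₚ.+-comm 1 (j % n))) (trans (%-absorb j 1) (cong (_% n) (ℕₚ.+-comm j 1)))))

    prv-mod : ∀ j → prv (suc j mod n) ≡ j mod n
    prv-mod j = mod-cong {toℕ (suc j mod n) + suc m} {j} (trans (cong (λ a → (a + suc m) % n) (toℕ-mod (suc j)))
      (trans (%-absorb (suc j) (suc m)) (trans (cong (_% n) (trans (sym (ℕₚ.+-suc j (suc m))) (cong (j +_) (sym (ℕₚ.*-identityˡ n))))) ([m+kn]%n≡m%n j 1 n))))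

    segmentsFrom : ℕ → ℕ → List Segment
    segmentsFrom j zero    = []
    segmentsFrom j (suc l) = segment (j mod n) ∷ segmentsFrom (suc j) l

    length-segmentsFrom : ∀ j l → length (segmentsFrom j l) ≡ l
    length-segmentsFrom j zero    = refl
    length-segmentsFrom j (suc l) = cong suc (length-segmentsFrom (suc j) l)

    telescope : ∀ j l → R ⊤ (wd (g (j mod n)) ++ total (segmentsFrom j l)) (wd (g ((j + l) mod n)))
    telescope j zero = R-≡ (trans (Listₚ.++-identityʳ _) (cong (λ a → wd (g (a mod n))) (sym (ℕₚ.+-identityʳ j))))
    telescope j (suc l) =
      R-trans (R-≡ (sym (Listₚ.++-assoc (wd (g (j mod n))) (step-word (j mod n)) _)))
        (R-trans (R-++ʳ (total (segmentsFrom (suc j) l)) (R-sym (step-R (j mod n))))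
          (R-trans (R-≡ (cong (λ i → wd (g i) ++ total (segmentsFrom (suc j) l)) (nxt-mod j)))
            (R-trans (telescope (suc j) l) (R-≡ (cong (λ a → wd (g (a mod n))) (sym (ℕₚ.+-suc j l)))))))

    total-trivial : R ⊤ (total (segmentsFrom 0 n)) []
    total-trivial = R-cancelˡ sym-⊤ (wd (g (0 mod n)))
      (R-trans (telescope 0 n) (R-≡ (trans (cong (λ i → wd (g i)) (mod-cong {n} {0} (n%n≡0 n))) (sym (Listₚ.++-identityʳ _)))))

    separatedFrom : ∀ j l → Separated (segmentsFrom j l)
    separatedFrom j zero = _
    separatedFrom j (suc zero) = _
    separatedFrom j (suc (suc zero)) = _
    separatedFrom j (suc (suc (suc l))) =
      subst₂ (λ i i′ → ¬ Separable (segment i) (segment (suc j mod n)) (segment i′)) (prv-mod j) (nxt-mod (suc j)) (not-separable (suc j mod n))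
      , separatedFrom (suc j) (suc (suc l))

  acyclic : Acyclic N
  acyclic (suc m) le cyc =
    no-group-cycle (segment (0 mod n)) (segment (1 mod n)) (segment (2 mod n)) (segmentsFrom 3 m)
      (ℕₚ.≤-trans (ℕₚ.≤-reflexive (cong (3 +_) (length-segmentsFrom 3 m))) le) (separatedFrom 0 n) total-trivial
    where open Cycle (suc m) cyc
  -- Two cosets are too few for `no-group-cycle`. Here the second step is inverse to the first, so
  -- by `R-meet` it is a word over both alphabets and by `path-within` a path over both: a
  -- factorisation with empty second factor.
  acyclic zero le cyc =
    let z , z∈ , r = R-meet {β = α zero} (α-sym (suc zero)) sym-⊤ (λ _ → ∈⊤) (step-∈ (suc zero)) (⊩-inv (α-sym zero) (step-∈ zero))
                       (R-trans (R-≡ (sym (Listₚ.++-identityʳ _))) (R-trans (R-moveˡ sym-⊤ (step-word zero) total-trivial) (R-≡ (Listₚ.++-identityʳ _))))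
        q , p , q∈ , r′ = path-within (sym-∩ (α-sym (suc zero)) (α-sym zero)) (step-path (suc zero)) z∈ r
    in not-factored (suc zero) p q∈ [] [] (R-trans (R-≡ (Listₚ.++-identityʳ q)) (R-trans r′ (R-sym r)))
    where
      open Cycle zero cyc
      open CosetCycle cyc

  module Symmetry (ρ : Automorphism I) where
    open Automorphism ρ

    path-image : ∀ {s t w} → Path s t w → Path (ρₛ s) (ρₛ t) (map ρₑ w)
    path-image [] = []
    path-image {t = t} (_∷_ {e = e} {w = w} p ps) =
      trans (ρ-ι₁ e) (cong ρₛ p) ∷ subst (λ s → Path s (ρₛ t) (map ρₑ w)) (sym (ρ-ι₂ e)) (path-image ps)

    φ : Elt → Elt
    φ g = class (path-image (wd-path g))

    φ-src : ∀ g → src (φ g) ≡ ρₛ (src g)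
    φ-src g = class-src (path-image (wd-path g))

    φ-tgt : ∀ g → tgt (φ g) ≡ ρₛ (tgt g)
    φ-tgt g = class-tgt (path-image (wd-path g))

    φ-wd : ∀ g → R ⊤ (wd (φ g)) (map ρₑ (wd g))
    φ-wd g = class-wd (path-image (wd-path g))

    φ-≡ : ∀ {g h} → ρₛ (src g) ≡ src h → ρₛ (tgt g) ≡ tgt h → R ⊤ (map ρₑ (wd g)) (wd h) → φ g ≡ h
    φ-≡ {g} p q r = elt-≡ (trans (φ-src g) p) (trans (φ-tgt g) q) (R-trans (φ-wd g) r)

    φ-· : ∀ g h → tgt g ≡ src h → φ (g · h) ≡ φ g · φ h
    φ-· g h eq = φ-≡ (trans (cong ρₛ (·-srcᴳ eq)) (sym (trans (·-srcᴳ eq′) (φ-src g))))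
        (trans (cong ρₛ (·-tgtᴳ eq)) (sym (trans (·-tgtᴳ eq′) (φ-tgt h))))
        (R-trans (R⊤-image ρ (·-wd eq)) (R-trans (R-≡ (Listₚ.map-++ ρₑ (wd g) (wd h)))
          (R-sym (R-trans (·-wd eq′) (R-++ (φ-wd g) (φ-wd h))))))
      where
        eq′ : tgt (φ g) ≡ src (φ h)
        eq′ = trans (φ-tgt g) (trans (cong ρₛ eq) (sym (φ-src h)))

    φ-𝟙 : ∀ s → φ (𝟙ᴳ s) ≡ 𝟙ᴳ (ρₛ s)
    φ-𝟙 s = φ-≡ (trans (cong ρₛ (class-src _)) (sym (class-src _))) (trans (cong ρₛ (class-tgt _)) (sym (class-tgt _)))
      (R-trans (R⊤-image ρ (class-wd [])) (R-sym (class-wd [])))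

    φ-gen : ∀ e → φ (genᴳ e) ≡ genᴳ (ρₑ e)
    φ-gen e = φ-≡ (trans (cong ρₛ (class-src _)) (trans (sym (ρ-ι₁ e)) (sym (class-src _))))
      (trans (cong ρₛ (class-tgt _)) (trans (sym (ρ-ι₂ e)) (sym (class-tgt _))))
      (R-trans (R⊤-image ρ (class-wd _)) (R-sym (class-wd _)))

  inverse : Automorphism I → Automorphism I
  inverse ρ = record
    { ρS = mk↔ₛ′ (Inverse.from ρS) (Inverse.to ρS) (Inverse.strictlyInverseʳ ρS) (Inverse.strictlyInverseˡ ρS)
    ; ρE = mk↔ₛ′ (Inverse.from ρE) (Inverse.to ρE) (Inverse.strictlyInverseʳ ρE) (Inverse.strictlyInverseˡ ρE)
    ; ρ-ι₁ = λ e → swap (ρ-ι₁ (Inverse.from ρE e)) (cong ι₁ (Inverse.strictlyInverseˡ ρE e))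
    ; ρ-ι₂ = λ e → swap (ρ-ι₂ (Inverse.from ρE e)) (cong ι₂ (Inverse.strictlyInverseˡ ρE e))
    ; ρ-⁻¹ = λ e → trans (cong (λ e → Inverse.from ρE (e ⁻¹)) (sym (Inverse.strictlyInverseˡ ρE e)))
               (trans (cong (Inverse.from ρE) (sym (ρ-⁻¹ (Inverse.from ρE e)))) (Inverse.strictlyInverseʳ ρE _)) }
    where
      open Automorphism ρ
      swap : ∀ {s t u} → t ≡ ρₛ s → t ≡ u → s ≡ Inverse.from ρS u
      swap p q = trans (sym (Inverse.strictlyInverseʳ ρS _)) (cong (Inverse.from ρS) (trans (sym p) q))

  φ-cancel : ∀ ρ σ → (∀ s → Automorphism.ρₛ ρ (Automorphism.ρₛ σ s) ≡ s) → (∀ e → Automorphism.ρₑ ρ (Automorphism.ρₑ σ e) ≡ e) →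
             ∀ g → Symmetry.φ ρ (Symmetry.φ σ g) ≡ g
  φ-cancel ρ σ p q g = Symmetry.φ-≡ ρ (trans (cong (Automorphism.ρₛ ρ) (Symmetry.φ-src σ g)) (p _))
    (trans (cong (Automorphism.ρₛ ρ) (Symmetry.φ-tgt σ g)) (p _))
    (R-trans (R⊤-image ρ (Symmetry.φ-wd σ g)) (R-≡ (trans (sym (Listₚ.map-∘ (wd g))) (trans (Listₚ.map-cong q (wd g)) (Listₚ.map-id (wd g))))))

  symmetric : (ρ : Automorphism I) → SymmetryOfGroupoid I ρ 𝔾
  symmetric ρ =
    mk↔ₛ′ φ (Symmetry.φ (inverse ρ))
      (φ-cancel ρ (inverse ρ) (Inverse.strictlyInverseˡ ρS) (Inverse.strictlyInverseˡ ρE))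
      (φ-cancel (inverse ρ) ρ (Inverse.strictlyInverseʳ ρS) (Inverse.strictlyInverseʳ ρE))
    , φ-· , φ-src , φ-tgt , φ-𝟙 , φ-gen
    where
      open Automorphism ρ
      open Symmetry ρ

theorem9p4 : (I : Pattern) (ℍ : CompleteIGraph I) →
    Finite (CompleteIGraph.V ℍ) →
    (N : ℕ) → 2 ≤ N →
    Σ (IGroupoid I) λ 𝔾 →
    Finite (IGroupoid.G 𝔾) ×
    IGroupoid.Acyclic 𝔾 N ×
    Compatible I 𝔾 ℍ ×
    ((ρ : Automorphism I) → SymmetryOfGraph I ρ ℍ → SymmetryOfGroupoid I ρ 𝔾)
theorem9p4 I ℍ (k , V↔) N 2≤N =
  𝔾 , (_ , mk↔ₛ′ id id (λ _ → refl) (λ _ → refl)) , acyclic , compatible , λ ρ _ → symmetric ρ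
  where
    open Construction I ℍ k V↔ N 2≤N using (𝔾; compatible)
    open Acyclicity I ℍ k V↔ N 2≤N using (acyclic; symmetric)
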